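{- For every sequence $(G_n)_{n\in\mathbb N}$ of $n$-vertex bounded degree expanders and any fixed $\varepsilon>0$, we have \[ t_{\mathsf{cov}}^{\varepsilon\mathsf{TB}}(G_n)=\mathcal{O}\!\left(\frac{n}{\varepsilon}\cdot\log\log n\right). \]
   Context: Graphs are finite, simple and connected. For a graph $G$, let $\mathbf P$ be the transition matrix of the simple random walk, $\tilde{\mathbf P}=(\mathbf I+\mathbf P)/2$ the lazy random walk, and $t_{\mathsf{rel}}(G)=(1-\tilde\lambda_2)^{ -1}$, where $\tilde\lambda_2$ is the second largest eigenvalue of $\tilde{\mathbf P}$. A sequence of graphs $(G_n)$ is a sequence of expanders if $t_{\mathsf{rel}}(G_n)=\Theta(1)$; it is of bounded degree if the maximum degrees are bounded by a constant independent of $n$. The number $\varepsilon$ is a probability (so $\varepsilon\le 1$). The $\varepsilon$-time-biased random walk ($\varepsilon$-TBRW) is the following controlled process: at each step, independently of the past, with probability $1-\varepsilon$ the walk moves to a uniformly random neighbour of the current vertex, and with probability $\varepsilon$ it moves to a neighbour of the current vertex chosen by a controller. The controller's choice may be randomised and may depend on the graph, the time and the whole history of the walk; the rule used is called a strategy. For a vertex $v$, $C_v^{\varepsilon\mathsf{TB}}(G)$ is the minimum, over all strategies, of the expected time for the $\varepsilon$-TBRW started from $v$ to visit every vertex of $G$, and $t_{\mathsf{cov}}^{\varepsilon\mathsf{TB}}(G)=\max_{v\in V}C_v^{\varepsilon\mathsf{TB}}(G)$. -}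

module Defs where

open import Data.Bool using (if_then_else_)
open import Data.Fin as Fin using (Fin; toℕ)
open import Data.Fin.Properties using (all?) renaming (_≟_ to _≟ᶠ_)
open import Data.Integer as ℤ using (+_)
open import Data.List as List using (List; []; _∷_; allFin; filter)
open import Data.List.Membership.Propositional using (_∈_)
import Data.List.Membership.DecPropositional as DecMembership
open import Data.Nat as ℕ using (ℕ; zero; suc)
import Data.Nat.Properties as ℕ
open import Data.Nat.Logarithm using (⌊log₂_⌋)
open import Data.Product using (Σ; ∃; ∃₂; _×_; _,_; proj₁; proj₂)
open import Data.Rational as ℚ using (ℚ; 0ℚ; 1ℚ; ½)
import Data.Rational.Properties as ℚ
open import Data.Rational.Solver using (module +-*-Solver)
open import Data.Vec.Functional using (Vector; foldr)
open import Level using (0ℓ)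
open import Relation.Binary using (Rel; Symmetric; Irreflexive; Decidable)
open import Relation.Binary.Construct.Closure.ReflexiveTransitive using (Star)
open import Relation.Binary.PropositionalEquality using (_≡_; refl; sym; trans; cong; cong₂; subst)
open import Relation.Nullary using (¬_; Dec; does)

IsCauchy : (ℕ → ℚ) → Set
IsCauchy x = ∀ δ → 0ℚ ℚ.< δ →
  ∃ λ N → ∀ m n → N ℕ.≤ m → N ℕ.≤ n → ℚ.∣ x m ℚ.- x n ∣ ℚ.≤ δ

record ℝ : Set where
  constructor mkℝ
  field
    seq    : ℕ → ℚ
    cauchy : IsCauchy seq

open ℝ public

infix 4 _<_ _≤_ _≈_

record _<_ (x y : ℝ) : Set where
  constructor mk<
  field
    gap       : ℚ
    gap-pos   : 0ℚ ℚ.< gap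
    threshold : ℕ
    separated : ∀ n → threshold ℕ.≤ n → seq x n ℚ.+ gap ℚ.≤ seq y n

record _≤_ (x y : ℝ) : Set where
  constructor mk≤
  field
    within : ∀ δ → 0ℚ ℚ.< δ → ∃ λ N → ∀ n → N ℕ.≤ n → seq x n ℚ.≤ seq y n ℚ.+ δ

record _≈_ (x y : ℝ) : Set where
  constructor mk≈
  field
    below : x ≤ y
    above : y ≤ x

private

  open ℚ.≤-Reasoning

  -- Opaque because unfolding these proofs makes checking later types very slow.
  opaque

    half-pos : ∀ {δ} → 0ℚ ℚ.< δ → 0ℚ ℚ.< ½ ℚ.* δ
    half-pos {δ} 0<δ = begin-strict
      0ℚ        ≡⟨ ℚ.*-zeroʳ ½ ⟨
      ½ ℚ.* 0ℚ  <⟨ ℚ.*-monoʳ-<-pos ½ 0<δ ⟩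
      ½ ℚ.* δ   ∎

    half+half : ∀ δ → ½ ℚ.* δ ℚ.+ ½ ℚ.* δ ≡ δ
    half+half = solve 1 (λ d → con ½ :* d :+ con ½ :* d := d) refl
      where open +-*-Solver

    const-cauchy : ∀ q → IsCauchy (λ _ → q)
    const-cauchy q δ 0<δ = 0 , λ _ _ _ _ → begin
      ℚ.∣ q ℚ.- q ∣  ≡⟨ cong ℚ.∣_∣ (ℚ.+-inverseʳ q) ⟩
      0ℚ             ≤⟨ ℚ.<⇒≤ 0<δ ⟩
      δ              ∎

    +-cauchy : ∀ x y → IsCauchy x → IsCauchy y → IsCauchy (λ n → x n ℚ.+ y n)
    +-cauchy x y cx cy δ 0<δ with cx (½ ℚ.* δ) (half-pos 0<δ) | cy (½ ℚ.* δ) (half-pos 0<δ)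
    ... | N₁ , h₁ | N₂ , h₂ = N₁ ℕ.⊔ N₂ , λ m n N≤m N≤n → begin
      ℚ.∣ (x m ℚ.+ y m) ℚ.- (x n ℚ.+ y n) ∣
        ≡⟨ cong ℚ.∣_∣ (rearrange (x m) (y m) (x n) (y n)) ⟩
      ℚ.∣ (x m ℚ.- x n) ℚ.+ (y m ℚ.- y n) ∣
        ≤⟨ ℚ.∣p+q∣≤∣p∣+∣q∣ (x m ℚ.- x n) (y m ℚ.- y n) ⟩
      ℚ.∣ x m ℚ.- x n ∣ ℚ.+ ℚ.∣ y m ℚ.- y n ∣
        ≤⟨ ℚ.+-mono-≤ (h₁ m n (ℕ.m⊔n≤o⇒m≤o N₁ N₂ N≤m) (ℕ.m⊔n≤o⇒m≤o N₁ N₂ N≤n))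
                      (h₂ m n (ℕ.m⊔n≤o⇒n≤o N₁ N₂ N≤m) (ℕ.m⊔n≤o⇒n≤o N₁ N₂ N≤n)) ⟩
      ½ ℚ.* δ ℚ.+ ½ ℚ.* δ
        ≡⟨ half+half δ ⟩
      δ ∎
      where
      rearrange : ∀ a b c d → (a ℚ.+ b) ℚ.- (c ℚ.+ d) ≡ (a ℚ.- c) ℚ.+ (b ℚ.- d)
      rearrange = solve 4 (λ a b c d → (a :+ b) :- (c :+ d) := (a :- c) :+ (b :- d)) refl
        where open +-*-Solver

    neg-cauchy : ∀ x → IsCauchy x → IsCauchy (λ n → ℚ.- x n)
    neg-cauchy x cx δ 0<δ with cx δ 0<δ
    ... | N , h = N , λ m n N≤m N≤n → begin
      ℚ.∣ (ℚ.- x m) ℚ.- (ℚ.- x n) ∣  ≡⟨ cong ℚ.∣_∣ (rearrange (x m) (x n)) ⟩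
      ℚ.∣ ℚ.- (x m ℚ.- x n) ∣        ≡⟨ ℚ.∣-p∣≡∣p∣ (x m ℚ.- x n) ⟩
      ℚ.∣ x m ℚ.- x n ∣              ≤⟨ h m n N≤m N≤n ⟩
      δ                              ∎
      where
      rearrange : ∀ a b → (ℚ.- a) ℚ.- (ℚ.- b) ≡ ℚ.- (a ℚ.- b)
      rearrange = solve 2 (λ a b → (:- a) :- (:- b) := :- (a :- b)) refl
        where open +-*-Solver

    EventuallyBounded : (ℕ → ℚ) → Set
    EventuallyBounded x = ∃ λ B → 0ℚ ℚ.< B × ∃ λ N → ∀ n → N ℕ.≤ n → ℚ.∣ x n ∣ ℚ.≤ B

    0<1 : 0ℚ ℚ.< 1ℚ
    0<1 = ℚ.positive⁻¹ 1ℚ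

    bounded : ∀ x → IsCauchy x → EventuallyBounded x
    bounded x cx with cx 1ℚ 0<1
    ... | N , h = ℚ.∣ x N ∣ ℚ.+ 1ℚ , B-pos , N , λ n N≤n → begin
      ℚ.∣ x n ∣                            ≡⟨ cong ℚ.∣_∣ (rearrange (x n) (x N)) ⟩
      ℚ.∣ x N ℚ.+ (x n ℚ.- x N) ∣          ≤⟨ ℚ.∣p+q∣≤∣p∣+∣q∣ (x N) (x n ℚ.- x N) ⟩
      ℚ.∣ x N ∣ ℚ.+ ℚ.∣ x n ℚ.- x N ∣      ≤⟨ ℚ.+-monoʳ-≤ ℚ.∣ x N ∣ (h n N N≤n ℕ.≤-refl) ⟩
      ℚ.∣ x N ∣ ℚ.+ 1ℚ                     ∎
      where
      B-pos : 0ℚ ℚ.< ℚ.∣ x N ∣ ℚ.+ 1ℚ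
      B-pos = ℚ.+-mono-≤-< (ℚ.0≤∣p∣ (x N)) 0<1
      rearrange : ∀ a b → a ≡ b ℚ.+ (a ℚ.- b)
      rearrange = solve 2 (λ a b → a := b :+ (a :- b)) refl
        where open +-*-Solver

    *-mono-∣∣ : ∀ p q {a b} → 0ℚ ℚ.< a → ℚ.∣ p ∣ ℚ.≤ a → ℚ.∣ q ∣ ℚ.≤ b → ℚ.∣ p ℚ.* q ∣ ℚ.≤ a ℚ.* b
    *-mono-∣∣ p q {a} {b} 0<a p≤a q≤b = begin
      ℚ.∣ p ℚ.* q ∣           ≡⟨ ℚ.∣p*q∣≡∣p∣*∣q∣ p q ⟩
      ℚ.∣ p ∣ ℚ.* ℚ.∣ q ∣     ≤⟨ ℚ.*-monoʳ-≤-nonNeg ℚ.∣ q ∣ {{ℚ.∣-∣-nonNeg q}} p≤a ⟩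
      a ℚ.* ℚ.∣ q ∣           ≤⟨ ℚ.*-monoˡ-≤-nonNeg a {{ℚ.nonNegative (ℚ.<⇒≤ 0<a)}} q≤b ⟩
      a ℚ.* b                 ∎

    *-pos : ∀ {p q} → 0ℚ ℚ.< p → 0ℚ ℚ.< q → 0ℚ ℚ.< p ℚ.* q
    *-pos {p} {q} 0<p 0<q = begin-strict
      0ℚ        ≡⟨ ℚ.*-zeroʳ p ⟨
      p ℚ.* 0ℚ  <⟨ ℚ.*-monoʳ-<-pos p {{ℚ.positive 0<p}} 0<q ⟩
      p ℚ.* q   ∎

    divide : ∀ S δ → 0ℚ ℚ.< S → 0ℚ ℚ.< δ → ∃ λ η → 0ℚ ℚ.< η × S ℚ.* η ≡ δ
    divide S δ 0<S 0<δ = (ℚ.1/ S) ℚ.* δ , *-pos (ℚ.positive⁻¹ (ℚ.1/ S) {{ℚ.1/pos⇒pos S}}) 0<δ ,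
      trans (sym (ℚ.*-assoc S (ℚ.1/ S) δ))
        (trans (cong (ℚ._* δ) (ℚ.*-inverseʳ S)) (ℚ.*-identityˡ δ))
      where
      instance
        S-pos : ℚ.Positive S
        S-pos = ℚ.positive 0<S
        S≢0 : ℚ.NonZero S
        S≢0 = ℚ.pos⇒nonZero S

    *-bound : ∀ {A B η δ} a b c d → 0ℚ ℚ.< A → 0ℚ ℚ.< B → (A ℚ.+ B) ℚ.* η ≡ δ →
      ℚ.∣ a ∣ ℚ.≤ A → ℚ.∣ d ∣ ℚ.≤ B → ℚ.∣ b ℚ.- d ∣ ℚ.≤ η → ℚ.∣ a ℚ.- c ∣ ℚ.≤ η →
      ℚ.∣ a ℚ.* b ℚ.- c ℚ.* d ∣ ℚ.≤ δ
    *-bound {A} {B} {η} {δ} a b c d 0<A 0<B eq a≤A d≤B b-d≤η a-c≤η = begin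
      ℚ.∣ a ℚ.* b ℚ.- c ℚ.* d ∣
        ≡⟨ cong ℚ.∣_∣ (rearrange a b c d) ⟩
      ℚ.∣ a ℚ.* (b ℚ.- d) ℚ.+ d ℚ.* (a ℚ.- c) ∣
        ≤⟨ ℚ.∣p+q∣≤∣p∣+∣q∣ (a ℚ.* (b ℚ.- d)) (d ℚ.* (a ℚ.- c)) ⟩
      ℚ.∣ a ℚ.* (b ℚ.- d) ∣ ℚ.+ ℚ.∣ d ℚ.* (a ℚ.- c) ∣
        ≤⟨ ℚ.+-mono-≤ (*-mono-∣∣ a (b ℚ.- d) 0<A a≤A b-d≤η) (*-mono-∣∣ d (a ℚ.- c) 0<B d≤B a-c≤η) ⟩
      A ℚ.* η ℚ.+ B ℚ.* η
        ≡⟨ ℚ.*-distribʳ-+ η A B ⟨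
      (A ℚ.+ B) ℚ.* η
        ≡⟨ eq ⟩
      δ ∎
      where
      rearrange : ∀ a b c d → a ℚ.* b ℚ.- c ℚ.* d ≡ a ℚ.* (b ℚ.- d) ℚ.+ d ℚ.* (a ℚ.- c)
      rearrange = solve 4 (λ a b c d → a :* b :- c :* d := a :* (b :- d) :+ d :* (a :- c)) refl
        where open +-*-Solver

    *-cauchy : ∀ x y → IsCauchy x → IsCauchy y → IsCauchy (λ n → x n ℚ.* y n)
    *-cauchy x y cx cy δ 0<δ =
      let (A , 0<A , N₁ , x≤A) = bounded x cx
          (B , 0<B , N₂ , y≤B) = bounded y cy
          (η , 0<η , eq)       = divide (A ℚ.+ B) δ (ℚ.+-mono-< 0<A 0<B) 0<δ
          (N₃ , h₃)            = cx η 0<η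
          (N₄ , h₄)            = cy η 0<η
      in combine N₁ N₂ N₃ N₄ 0<A 0<B eq x≤A y≤B h₃ h₄
      where
      combine : ∀ N₁ N₂ N₃ N₄ {A B η} → 0ℚ ℚ.< A → 0ℚ ℚ.< B → (A ℚ.+ B) ℚ.* η ≡ δ →
        (∀ n → N₁ ℕ.≤ n → ℚ.∣ x n ∣ ℚ.≤ A) → (∀ n → N₂ ℕ.≤ n → ℚ.∣ y n ∣ ℚ.≤ B) →
        (∀ m n → N₃ ℕ.≤ m → N₃ ℕ.≤ n → ℚ.∣ x m ℚ.- x n ∣ ℚ.≤ η) →
        (∀ m n → N₄ ℕ.≤ m → N₄ ℕ.≤ n → ℚ.∣ y m ℚ.- y n ∣ ℚ.≤ η) →
        ∃ λ N → ∀ m n → N ℕ.≤ m → N ℕ.≤ n → ℚ.∣ x m ℚ.* y m ℚ.- x n ℚ.* y n ∣ ℚ.≤ δ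
      combine N₁ N₂ N₃ N₄ 0<A 0<B eq x≤A y≤B h₃ h₄ =
        (N₁ ℕ.⊔ N₂) ℕ.⊔ (N₃ ℕ.⊔ N₄) , λ m n N≤m N≤n →
        let m₁₂ = ℕ.m⊔n≤o⇒m≤o (N₁ ℕ.⊔ N₂) (N₃ ℕ.⊔ N₄) N≤m
            n₁₂ = ℕ.m⊔n≤o⇒m≤o (N₁ ℕ.⊔ N₂) (N₃ ℕ.⊔ N₄) N≤n
            m₃₄ = ℕ.m⊔n≤o⇒n≤o (N₁ ℕ.⊔ N₂) (N₃ ℕ.⊔ N₄) N≤m
            n₃₄ = ℕ.m⊔n≤o⇒n≤o (N₁ ℕ.⊔ N₂) (N₃ ℕ.⊔ N₄) N≤n
        in *-bound (x m) (y m) (x n) (y n) 0<A 0<B eq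
             (x≤A m (ℕ.m⊔n≤o⇒m≤o N₁ N₂ m₁₂)) (y≤B n (ℕ.m⊔n≤o⇒n≤o N₁ N₂ n₁₂))
             (h₄ m n (ℕ.m⊔n≤o⇒n≤o N₃ N₄ m₃₄) (ℕ.m⊔n≤o⇒n≤o N₃ N₄ n₃₄))
             (h₃ m n (ℕ.m⊔n≤o⇒m≤o N₃ N₄ m₃₄) (ℕ.m⊔n≤o⇒m≤o N₃ N₄ n₃₄))

infix  8 -_
infixl 7 _*_
infixl 6 _+_ _-_

fromℚ : ℚ → ℝ
fromℚ q = mkℝ (λ _ → q) (const-cauchy q)

0ℝ 1ℝ : ℝ
0ℝ = fromℚ 0ℚ
1ℝ = fromℚ 1ℚ

fromℕ : ℕ → ℝ
fromℕ n = fromℚ (+ n ℚ./ 1)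

_+_ : ℝ → ℝ → ℝ
mkℝ x cx + mkℝ y cy = mkℝ (λ n → x n ℚ.+ y n) (+-cauchy x y cx cy)

-_ : ℝ → ℝ
- mkℝ x cx = mkℝ (λ n → ℚ.- x n) (neg-cauchy x cx)

_-_ : ℝ → ℝ → ℝ
x - y = x + - y

_*_ : ℝ → ℝ → ℝ
mkℝ x cx * mkℝ y cy = mkℝ (λ n → x n ℚ.* y n) (*-cauchy x y cx cy)

private

  ≥-nonZero : ∀ {d} p → 0ℚ ℚ.< d → d ℚ.≤ p → ℚ.NonZero p
  ≥-nonZero p 0<d d≤p = ℚ.pos⇒nonZero p {{ℚ.positive (ℚ.<-≤-trans 0<d d≤p)}}

  invSeq : (ℕ → ℚ) → ∀ d → 0ℚ ℚ.< d → ℕ → ℚ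
  invSeq x d 0<d n = ℚ.1/_ (x n ℚ.⊔ d) {{≥-nonZero (x n ℚ.⊔ d) 0<d (ℚ.p≤q⊔p (x n) d)}}

  opaque

    1/-pos : ∀ p → 0ℚ ℚ.< p → .{{_ : ℚ.NonZero p}} → 0ℚ ℚ.< ℚ.1/ p
    1/-pos p 0<p = ℚ.positive⁻¹ (ℚ.1/ p) {{1/p-pos}}
      where
      1/p-pos : ℚ.Positive (ℚ.1/ p)
      1/p-pos = ℚ.1/pos⇒pos p {{ℚ.positive 0<p}}

    ∣inverse∣-bound : ∀ {d e a} i → 0ℚ ℚ.< i → 0ℚ ℚ.< e → d ℚ.≤ a →
      i ℚ.* a ≡ 1ℚ → d ℚ.* e ≡ 1ℚ → ℚ.∣ i ∣ ℚ.≤ e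
    ∣inverse∣-bound {d} {e} {a} i 0<i 0<e d≤a ia≡1 de≡1 = begin
      ℚ.∣ i ∣          ≡⟨ ℚ.0≤p⇒∣p∣≡p (ℚ.<⇒≤ 0<i) ⟩
      i                ≡⟨ ℚ.*-identityʳ i ⟨
      i ℚ.* 1ℚ         ≡⟨ cong (i ℚ.*_) de≡1 ⟨
      i ℚ.* (d ℚ.* e)  ≤⟨ ℚ.*-monoˡ-≤-nonNeg i {{ℚ.nonNegative (ℚ.<⇒≤ 0<i)}}
                            (ℚ.*-monoʳ-≤-nonNeg e {{ℚ.nonNegative (ℚ.<⇒≤ 0<e)}} d≤a) ⟩
      i ℚ.* (a ℚ.* e)  ≡⟨ ℚ.*-assoc i a e ⟨
      (i ℚ.* a) ℚ.* e  ≡⟨ cong (ℚ._* e) ia≡1 ⟩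
      1ℚ ℚ.* e         ≡⟨ ℚ.*-identityˡ e ⟩
      e                ∎

    inverse-diff : ∀ {a b} i j → i ℚ.* a ≡ 1ℚ → j ℚ.* b ≡ 1ℚ →
      i ℚ.- j ≡ (i ℚ.* j) ℚ.* (b ℚ.- a)
    inverse-diff {a} {b} i j ia≡1 jb≡1 = begin-equality
      i ℚ.- j                                ≡⟨ cong₂ ℚ._-_ (ℚ.*-identityʳ i) (ℚ.*-identityʳ j) ⟨
      i ℚ.* 1ℚ ℚ.- j ℚ.* 1ℚ                  ≡⟨ cong₂ (λ p q → i ℚ.* p ℚ.- j ℚ.* q) jb≡1 ia≡1 ⟨
      i ℚ.* (j ℚ.* b) ℚ.- j ℚ.* (i ℚ.* a)    ≡⟨ rearrange i j b a ⟩
      (i ℚ.* j) ℚ.* (b ℚ.- a)                ∎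
      where
      rearrange : ∀ a b c d → a ℚ.* (b ℚ.* c) ℚ.- b ℚ.* (a ℚ.* d) ≡ (a ℚ.* b) ℚ.* (c ℚ.- d)
      rearrange = solve 4 (λ a b c d → a :* (b :* c) :- b :* (a :* d) := (a :* b) :* (c :- d)) refl
        where open +-*-Solver

    ∣inverse-diff∣-bound : ∀ {d e a b} i j δ → 0ℚ ℚ.< i → 0ℚ ℚ.< j → 0ℚ ℚ.< e → d ℚ.≤ a → d ℚ.≤ b →
      i ℚ.* a ≡ 1ℚ → j ℚ.* b ≡ 1ℚ → d ℚ.* e ≡ 1ℚ →
      ℚ.∣ b ℚ.- a ∣ ℚ.≤ d ℚ.* d ℚ.* δ → ℚ.∣ i ℚ.- j ∣ ℚ.≤ δ
    ∣inverse-diff∣-bound {d} {e} {a} {b} i j δ 0<i 0<j 0<e d≤a d≤b ia≡1 jb≡1 de≡1 b-a≤ = begin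
      ℚ.∣ i ℚ.- j ∣
        ≡⟨ cong ℚ.∣_∣ (inverse-diff i j ia≡1 jb≡1) ⟩
      ℚ.∣ (i ℚ.* j) ℚ.* (b ℚ.- a) ∣
        ≤⟨ *-mono-∣∣ (i ℚ.* j) (b ℚ.- a) (*-pos 0<e 0<e)
             (*-mono-∣∣ i j 0<e (∣inverse∣-bound i 0<i 0<e d≤a ia≡1 de≡1)
                                (∣inverse∣-bound j 0<j 0<e d≤b jb≡1 de≡1))
             b-a≤ ⟩
      (e ℚ.* e) ℚ.* (d ℚ.* d ℚ.* δ)
        ≡⟨ rearrange e d δ ⟩
      (d ℚ.* e) ℚ.* ((d ℚ.* e) ℚ.* δ)
        ≡⟨ cong (λ p → p ℚ.* (p ℚ.* δ)) de≡1 ⟩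
      1ℚ ℚ.* (1ℚ ℚ.* δ)
        ≡⟨ trans (ℚ.*-identityˡ (1ℚ ℚ.* δ)) (ℚ.*-identityˡ δ) ⟩
      δ ∎
      where
      rearrange : ∀ a b c → (a ℚ.* a) ℚ.* (b ℚ.* b ℚ.* c) ≡ (b ℚ.* a) ℚ.* ((b ℚ.* a) ℚ.* c)
      rearrange = solve 3 (λ a b c → (a :* a) :* (b :* b :* c) := (b :* a) :* ((b :* a) :* c)) refl
        where open +-*-Solver

    ∣1/-diff∣-bound : ∀ {d} a b δ .{{_ : ℚ.NonZero a}} .{{_ : ℚ.NonZero b}} → 0ℚ ℚ.< d →
      d ℚ.≤ a → d ℚ.≤ b → ℚ.∣ b ℚ.- a ∣ ℚ.≤ d ℚ.* d ℚ.* δ → ℚ.∣ ℚ.1/ a ℚ.- ℚ.1/ b ∣ ℚ.≤ δ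
    ∣1/-diff∣-bound {d} a b δ 0<d d≤a d≤b =
      ∣inverse-diff∣-bound (ℚ.1/ a) (ℚ.1/ b) δ
        (1/-pos a (ℚ.<-≤-trans 0<d d≤a)) (1/-pos b (ℚ.<-≤-trans 0<d d≤b)) (1/-pos d 0<d)
        d≤a d≤b (ℚ.*-inverseˡ a) (ℚ.*-inverseˡ b) (ℚ.*-inverseʳ d)
      where
      instance
        d≢0 : ℚ.NonZero d
        d≢0 = ℚ.pos⇒nonZero d {{ℚ.positive 0<d}}

    inv-cauchy : ∀ x d 0<d → IsCauchy x → (N : ℕ) → (∀ n → N ℕ.≤ n → d ℚ.≤ x n) →
      IsCauchy (invSeq x d 0<d)
    inv-cauchy x d 0<d cx N d≤x δ 0<δ =
      let (M , h) = cx (d ℚ.* d ℚ.* δ) (*-pos (*-pos 0<d 0<d) 0<δ)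
      in N ℕ.⊔ M , λ m n N≤m N≤n →
        ∣1/-diff∣-bound (x m ℚ.⊔ d) (x n ℚ.⊔ d) δ
          {{≥-nonZero (x m ℚ.⊔ d) 0<d (ℚ.p≤q⊔p (x m) d)}} {{≥-nonZero (x n ℚ.⊔ d) 0<d (ℚ.p≤q⊔p (x n) d)}}
          0<d (ℚ.p≤q⊔p (x m) d) (ℚ.p≤q⊔p (x n) d)
          (subst (ℚ._≤ d ℚ.* d ℚ.* δ)
            (sym (cong₂ (λ p q → ℚ.∣ p ℚ.- q ∣)
              (ℚ.p≥q⇒p⊔q≡p (d≤x n (ℕ.m⊔n≤o⇒m≤o N M N≤n)))
              (ℚ.p≥q⇒p⊔q≡p (d≤x m (ℕ.m⊔n≤o⇒m≤o N M N≤m)))))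
            (h n m (ℕ.m⊔n≤o⇒n≤o N M N≤n) (ℕ.m⊔n≤o⇒n≤o N M N≤m)))

-- The witness of 0 < x supplies a rational d > 0 that x eventually exceeds;
-- taking the maximum with d makes every term invertible without changing x.
inv : (x : ℝ) → 0ℝ < x → ℝ
inv (mkℝ x cx) (mk< d 0<d N h) =
  mkℝ (invSeq x d 0<d)
      (inv-cauchy x d 0<d cx N λ n N≤n → subst (ℚ._≤ x n) (ℚ.+-identityˡ d) (h n N≤n))

∑ : ∀ {n} → Vector ℝ n → ℝ
∑ = foldr _+_ 0ℝ

-- A quantity in [0,∞] that need not be finite, and whose exact value need
-- not be computable, is given by the set of its real upper bounds (so ∞ is
-- the empty set).
UpperReal : Set₁
UpperReal = ℝ → Set

infix 4 _≤ᵘ_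

_≤ᵘ_ : UpperReal → ℝ → Set
a ≤ᵘ K = a K

sup : {I : Set} → (I → ℝ) → UpperReal
sup f K = ∀ i → f i ≤ K

maximum : {I : Set} → (I → UpperReal) → UpperReal
maximum f K = ∀ i → f i ≤ᵘ K

-- The minima below are attained, so that a bound on the minimum is a bound
-- on some member of the family.
minimum : {I : Set} → (I → UpperReal) → UpperReal
minimum f K = ∃ λ i → f i ≤ᵘ K

record Graph (n : ℕ) : Set₁ where
  infix 4 _~_ _~?_
  field
    _~_       : Rel (Fin n) 0ℓ
    _~?_      : Decidable _~_
    symmetric : Symmetric _~_
    loopless  : Irreflexive _≡_ _~_
    connected : ∀ u v → Star _~_ u v

  degree : Fin n → ℕ
  degree u = List.length (filter (u ~?_) (allFin n))

-- The value at 0 is only ever used for the isolated vertex of the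
-- one-vertex graph.
recip : ℕ → ℝ
recip zero    = 0ℝ
recip (suc k) = fromℚ (+ 1 ℚ./ suc k)

Matrix : ℕ → Set
Matrix n = Fin n → Fin n → ℝ

transition : ∀ {n} → Graph n → Matrix n
transition G u v = if does (u ~? v) then recip (degree u) else 0ℝ
  where open Graph G

identity : ∀ {n} → Matrix n
identity u v = if does (u ≟ᶠ v) then 1ℝ else 0ℝ

lazyTransition : ∀ {n} → Graph n → Matrix n
lazyTransition G u v = fromℚ ½ * (identity u v + transition G u v)

-- λs lists the eigenvalues of A with multiplicity, in non-increasing order.
-- Multiplicity is that of a basis of eigenvectors, which exists for the
-- transition matrices above because they are reversible.
record IsSpectrum {n : ℕ} (A : Matrix n) (λs : Vector ℝ n) : Set where
  field
    basis       : Fin n → Vector ℝ n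
    independent : ∀ (c : Vector ℝ n) → (∀ u → ∑ (λ i → c i * basis i u) ≈ 0ℝ) → ∀ i → c i ≈ 0ℝ
    spanning    : ∀ (f : Vector ℝ n) → ∃ λ (c : Vector ℝ n) → ∀ u → f u ≈ ∑ (λ i → c i * basis i u)
    eigenvector : ∀ i u → ∑ (λ v → A u v * basis i v) ≈ λs i * basis i u
    ordered     : ∀ {i j} → i Fin.≤ j → λs j ≤ λs i

IsSecondLargestEigenvalue : ∀ {n} → Matrix n → ℝ → Set
IsSecondLargestEigenvalue {n} A μ =
  ∃ λ (λs : Vector ℝ n) → IsSpectrum A λs × ∃ λ i → toℕ i ≡ 1 × μ ≈ λs i

IsRelaxationTime : ∀ {n} → Graph n → ℝ → Set
IsRelaxationTime G t =
  ∃ λ μ → IsSecondLargestEigenvalue (lazyTransition G) μ ×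
  Σ (0ℝ < 1ℝ - μ) λ gap → t ≈ inv (1ℝ - μ) gap

-- t_rel(Gₙ) = Θ(1).  There is no second eigenvalue when n < 2, so the
-- threshold is at least 2 whenever this holds.
Expanders : (∀ n → Graph n) → Set
Expanders G =
  ∃₂ λ c C → 0ℝ < c × ∃ λ N → ∀ n → N ℕ.≤ n →
  ∃ λ t → IsRelaxationTime (G n) t × c ≤ t × t ≤ C

BoundedDegree : (∀ n → Graph n) → Set
BoundedDegree G = ∃ λ Δ → ∀ n u → Graph.degree (G n) u ℕ.≤ Δ

-- A history is a pair of the list of earlier positions, most recent first,
-- and the current position.
module _ {n : ℕ} (G : Graph n) where

  open Graph G

  -- The law of the controller's choice given the history; the time is the
  -- length of the history.
  record Strategy : Set where
    field
      choice       : List (Fin n) → Fin n → Fin n → ℝ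
      nonneg       : ∀ past u v → 0ℝ ≤ choice past u v
      total        : ∀ past u → ∑ (choice past u) ≈ 1ℝ
      to-neighbour : ∀ past u v → ¬ (u ~ v) → choice past u v ≈ 0ℝ

  Covered : List (Fin n) → Fin n → Set
  Covered past u = ∀ w → w ∈ u ∷ past

  covered? : ∀ past u → Dec (Covered past u)
  covered? past u = all? λ w → w ∈? (u ∷ past)
    where open DecMembership _≟ᶠ_

  -- min(τ, T) for a trajectory of T steps, where τ is the cover time: the
  -- number of times t < T at which the first t steps do not yet cover.
  truncatedCoverTime : List (Fin n) → Fin n → ℕ
  truncatedCoverTime []         u = 0
  truncatedCoverTime (v ∷ past) u =
    (if does (covered? past v) then 0 else 1) ℕ.+ truncatedCoverTime past v

  module TBRW (ε : ℝ) (σ : Strategy) where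

    open Strategy σ

    step : List (Fin n) → Fin n → Fin n → ℝ
    step past u v = (1ℝ - ε) * transition G u v + ε * choice past u v

    -- Conditional expectation, given the history, of a function of the
    -- history T steps later.
    𝔼 : (T : ℕ) → (List (Fin n) → Fin n → ℝ) → List (Fin n) → Fin n → ℝ
    𝔼 zero    f past u = f past u
    𝔼 (suc T) f past u = ∑ λ v → step past u v * 𝔼 T f (u ∷ past) v

    -- 𝔼[τ] = sup over T of 𝔼[min(τ, T)], by monotone convergence.
    expectedCoverTime : Fin n → UpperReal
    expectedCoverTime v =
      sup λ T → 𝔼 T (λ past u → fromℕ (truncatedCoverTime past u)) [] v

  optimalCoverTime : ℝ → Fin n → UpperReal
  optimalCoverTime ε v = minimum λ σ → TBRW.expectedCoverTime ε σ v

  coverTime : ℝ → UpperReal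
  coverTime ε = maximum (optimalCoverTime ε)

-- For use inside O(·) only: ⌊log₂ ⌊log₂ n ⌋⌋ and log log n differ by at
-- most bounded positive factors for n ≥ 4.
loglog : ℕ → ℕ
loglog n = ⌊log₂ ⌊log₂ n ⌋ ⌋

{-# OPTIONS --safe #-}

-- An expander of bounded degree mixes in O(log n) steps and has hitting times O(n). Walking
-- uncontrolled for O(K n log log n) steps, ε = 1/K, therefore leaves only O(n / (log n)^K) vertices
-- unvisited on average. When j vertices are unvisited, the simple walk finds one of them
-- within T = O(log n) steps with probability p ≥ c j/n from any starting point, and a controller
-- that always moves to the most promising neighbour raises this to p^(1 - 1/K); so the next new
-- vertex costs O(T (n/j)^(1 - 1/K)), and the sum of these costs over the few remaining j is O(n).
-- Both phases are expressed by one potential that decreases by 1 in expectation.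
--
-- The spectral gap enters as ⟨f, L f⟩ ≤ (1 - 1/D) ⟨f, f⟩ for rational f of mean 0. The given eigenbasis
-- need not be orthogonal, but it shows that ⟨f, (L + s)^j f⟩ grows at most like (1 - 1/D + s)^j, and by
-- Cauchy–Schwarz these moments grow at least like the powers of the Rayleigh quotient.
module Submission where

open import Algebra.Bundles using (CommutativeRing)
import Algebra.Properties.CommutativeSemigroup as CommutativeSemigroupProperties
import Algebra.Properties.CommutativeSemiring.Exp as Exp
import Algebra.Properties.Ring as RingProperties
import Algebra.Properties.Semiring.Sum as Sum
open import Data.Bool using (Bool; true; false; if_then_else_)
open import Data.Fin as Fin using (Fin; zero; suc)
import Data.Fin.Properties as Fin
import Data.Integer as ℤ
import Data.Integer.Properties as ℤ
open import Data.List as List using (List; []; _∷_; allFin; filter)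
import Data.List.Extrema as Extrema
open import Data.List.Membership.Propositional using (_∈_)
open import Data.List.Membership.Propositional.Properties using (∈-filter⁺; ∈-filter⁻; ∈-allFin)
import Data.List.Relation.Unary.All as All
open import Data.List.Relation.Unary.Any using (here; there)
open import Data.Nat as ℕ using (ℕ; zero; suc; s≤s; z≤n)
open import Data.Nat.Logarithm using (⌊log₂_⌋; ⌊log₂⌋-mono-≤; ⌊log₂[2^n]⌋≡n)
import Data.Nat.Properties as ℕ
open import Data.Nat.Tactic.RingSolver using () renaming (solve-∀ to ℕ-solve-∀)
open import Data.Product using (∃; _×_; _,_; proj₁; proj₂)
open import Data.Rational as ℚ using (ℚ; 0ℚ; 1ℚ; ½)
import Data.Rational.Properties as ℚ
import Data.Rational.Unnormalised as ℚᵘ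
import Data.Rational.Unnormalised.Properties as ℚᵘ
open import Data.Sum using (_⊎_; inj₁; inj₂)
open import Data.Vec.Functional using (Vector; removeAt)
open import Function using (_∘_)
open import Level using (0ℓ)
open import Relation.Binary.Bundles using (DecTotalOrder)
open import Relation.Binary.Construct.Closure.ReflexiveTransitive as Closure using (_◅_)
open import Relation.Binary.PropositionalEquality as ≡ using (_≡_; _≢_; refl; cong; cong₂; subst)
import Relation.Binary.Reasoning.Setoid as SetoidReasoning
open import Relation.Nullary using (¬_; Dec; yes; no; does; ofʸ; ofⁿ; contradiction)
open import Relation.Nullary.Decidable using (dec⇒maybe; dec-true)
open import Tactic.RingSolver using (solve-∀)
open import Tactic.RingSolver.Core.AlmostCommutativeRing using (AlmostCommutativeRing; fromCommutativeRing)
open import Defs using (Graph; covered?; truncatedCoverTime; loglog)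

-- Weighted linear algebra over a commutative ring

-- The controlled walk is analysed over `ℚ`. The order of `ℝ` is not decidable, so a best neighbour
-- could not be selected by comparing real values; the walk and, at bias `1/K`, the controlled law
-- are rational. Reals enter through ε and through the spectrum, which is left behind as a rational
-- Rayleigh bound. Fractional powers become inequalities between integer powers, `1 - 1/(2D)` stands
-- for the root of `1 - 1/D`, exponential decay is `(1 - 1/m)^m ≤ 1/2`, and `(X/j)^(1 - 1/K)`
-- becomes a sum over dyadic levels. The order `n log log n` arises as follows. Summed over all `j`,
-- the boosted costs exceed `O(n)` by a factor of about `T = O(log n)`. Starting the levels at `i₀`
-- with `2^i₀ ≥ T 2^K` removes it, but requires the warm-up to shrink the unvisited set by
-- `2^(K i₀)`, which takes `O(n K i₀)` steps. Since `i₀` is `log log n` up to a summand depending on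
-- `K`, the exponential dependence on `K` affects only the threshold for `n`, and the constant is
-- independent of ε.

module Linear (R : CommutativeRing 0ℓ 0ℓ) where

  open CommutativeRing R hiding (zero; distrib; refl)
  private module Library = Sum semiring
  open RingProperties ring using (-‿distribʳ-*)
  open CommutativeSemigroupProperties *-commutativeSemigroup using (x∙yz≈y∙xz)
  open SetoidReasoning setoid

  -- Opaque so that unification can recover the summand from a sum.
  opaque

    sum : ∀ {n} → Vector Carrier n → Carrier
    sum = Library.sum

    sum-def : ∀ {n} (f : Vector Carrier n) → sum f ≡ Library.sum f
    sum-def f = ≡.refl

    sum-[] : (f : Vector Carrier 0) → sum f ≡ 0#
    sum-[] f = ≡.refl

    sum-suc : ∀ {n} (f : Vector Carrier (suc n)) → sum f ≡ f zero + sum (λ i → f (suc i))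
    sum-suc f = ≡.refl

    sum-cong : ∀ {n} {f g : Vector Carrier n} → (∀ i → f i ≈ g i) → sum f ≈ sum g
    sum-cong = Library.sum-cong-≋

    sum-zero : ∀ {n} {f : Vector Carrier n} → (∀ i → f i ≈ 0#) → sum f ≈ 0#
    sum-zero {n} f≈0 = trans (Library.sum-cong-≋ f≈0) (Library.sum-replicate-zero n)

    sum-remove : ∀ {n} (f : Vector Carrier (suc n)) i → sum f ≈ f i + sum (removeAt f i)
    sum-remove f i = Library.sum-remove {i = i} f

    sum-+ : ∀ {n} (f g : Vector Carrier n) → sum (λ i → f i + g i) ≈ sum f + sum g
    sum-+ = Library.∑-distrib-+

    sum-comm : ∀ {m n} (f : Fin m → Fin n → Carrier) →
      sum (λ i → sum λ j → f i j) ≈ sum (λ j → sum λ i → f i j)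
    sum-comm = Library.∑-comm

    *-sumˡ : ∀ {n} c (f : Vector Carrier n) → c * sum f ≈ sum (λ i → c * f i)
    *-sumˡ = Library.*-distribˡ-sum

    *-sumʳ : ∀ {n} c (f : Vector Carrier n) → sum f * c ≈ sum (λ i → f i * c)
    *-sumʳ = Library.*-distribʳ-sum

  infixr 8 _·_

  _·_ : ∀ {n} → (Fin n → Fin n → Carrier) → Vector Carrier n → Vector Carrier n
  (A · f) u = sum λ v → A u v * f v

  inner : ∀ {n} (w f g : Vector Carrier n) → Carrier
  inner w f g = sum λ u → w u * (f u * g u)

  sum-single : ∀ {n} (f : Vector Carrier n) i → (∀ j → j ≢ i → f j ≈ 0#) → sum f ≈ f i
  sum-single {suc n} f i rest = begin
    sum f  ≈⟨ sum-remove f i ⟩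
    f i + sum (removeAt f i)  ≈⟨ +-congˡ (sum-zero λ j → rest (Fin.punchIn i j) (Fin.punchInᵢ≢i i j)) ⟩
    f i + 0#  ≈⟨ +-identityʳ (f i) ⟩
    f i  ∎

  ·-cong : ∀ {n} (A : Fin n → Fin n → Carrier) {f g : Vector Carrier n} →
    (∀ u → f u ≈ g u) → ∀ u → (A · f) u ≈ (A · g) u
  ·-cong A f≈g u = sum-cong λ v → *-congˡ (f≈g v)

  inner-cong : ∀ {n} (w : Vector Carrier n) {f f′ g g′ : Vector Carrier n} →
    (∀ u → f u ≈ f′ u) → (∀ u → g u ≈ g′ u) → inner w f g ≈ inner w f′ g′
  inner-cong w f≈f′ g≈g′ = sum-cong λ u → *-congˡ (*-cong (f≈f′ u) (g≈g′ u))

  ·-+ : ∀ {n} (A : Fin n → Fin n → Carrier) (f g : Vector Carrier n) u →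
    (A · (λ v → f v + g v)) u ≈ (A · f) u + (A · g) u
  ·-+ A f g u = trans (sum-cong λ v → distribˡ (A u v) (f v) (g v)) (sum-+ _ _)

  ·-* : ∀ {n} (A : Fin n → Fin n → Carrier) c (f : Vector Carrier n) u →
    (A · (λ v → c * f v)) u ≈ c * (A · f) u
  ·-* A c f u = trans (sum-cong λ v → x∙yz≈y∙xz (A u v) c (f v)) (sym (*-sumˡ c _))

  ·-sum : ∀ {m n} (A : Fin n → Fin n → Carrier) (f : Fin m → Vector Carrier n) u →
    (A · (λ v → sum λ i → f i v)) u ≈ sum λ i → (A · f i) u
  ·-sum A f u = trans (sum-cong λ v → *-sumˡ (A u v) (λ i → f i v)) (sum-comm _)

  inner-comm : ∀ {n} (w f g : Vector Carrier n) → inner w f g ≈ inner w g f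
  inner-comm w f g = sum-cong λ u → *-congˡ (*-comm (f u) (g u))

  inner-+ʳ : ∀ {n} (w f g h : Vector Carrier n) →
    inner w f (λ u → g u + h u) ≈ inner w f g + inner w f h
  inner-+ʳ w f g h = trans (sum-cong λ u → trans (*-congˡ (distribˡ (f u) (g u) (h u))) (distribˡ (w u) _ _)) (sum-+ _ _)

  inner-*ʳ : ∀ {n} (w f : Vector Carrier n) c (g : Vector Carrier n) →
    inner w f (λ u → c * g u) ≈ c * inner w f g
  inner-*ʳ w f c g = trans (sum-cong λ u → trans (*-congˡ (x∙yz≈y∙xz (f u) c (g u))) (x∙yz≈y∙xz (w u) c _)) (sym (*-sumˡ c _))

  inner-sumʳ : ∀ {m n} (w f : Vector Carrier n) (g : Fin m → Vector Carrier n) →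
    inner w f (λ u → sum λ i → g i u) ≈ sum λ i → inner w f (g i)
  inner-sumʳ w f g = trans (sum-cong λ u → trans (*-congˡ (*-sumˡ (f u) _)) (*-sumˡ (w u) _)) (sum-comm _)

  Reversible : ∀ {n} → Vector Carrier n → (Fin n → Fin n → Carrier) → Set
  Reversible w A = ∀ u v → w u * A u v ≈ w v * A v u

  Stochastic : ∀ {n} → (Fin n → Fin n → Carrier) → Set
  Stochastic A = ∀ u → sum (A u) ≈ 1#

  module _ {n} {w : Vector Carrier n} {A : Fin n → Fin n → Carrier} (rev : Reversible w A) where

    self-adjoint : ∀ f g → inner w f (A · g) ≈ inner w (A · f) g
    self-adjoint f g = begin
      (sum λ u → w u * (f u * sum λ v → A u v * g v))
        ≈⟨ sum-cong (λ u → trans (*-congˡ (*-sumˡ (f u) _)) (*-sumˡ (w u) _)) ⟩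
      (sum λ u → sum λ v → w u * (f u * (A u v * g v)))
        ≈⟨ sum-comm _ ⟩
      (sum λ v → sum λ u → w u * (f u * (A u v * g v)))
        ≈⟨ sum-cong (λ v → sum-cong λ u → move u v) ⟩
      (sum λ v → sum λ u → w v * ((A v u * f u) * g v))
        ≈⟨ sum-cong (λ v → trans (*-congˡ (*-sumʳ (g v) _)) (*-sumˡ (w v) _)) ⟨
      (sum λ v → w v * ((sum λ u → A v u * f u) * g v))
        ∎
      where
      regroup : ∀ a b c d → a * (b * (c * d)) ≈ (a * c) * (b * d)
      regroup a b c d = trans (*-congˡ (x∙yz≈y∙xz b c d)) (sym (*-assoc a c _))
      regroup′ : ∀ a b c d → (a * c) * (b * d) ≈ a * ((c * b) * d)
      regroup′ a b c d = trans (*-assoc a c _) (*-congˡ (sym (*-assoc c b d)))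
      move : ∀ u v → w u * (f u * (A u v * g v)) ≈ w v * ((A v u * f u) * g v)
      move u v = begin
        w u * (f u * (A u v * g v))  ≈⟨ regroup (w u) (f u) (A u v) (g v) ⟩
        (w u * A u v) * (f u * g v)  ≈⟨ *-congʳ (rev u v) ⟩
        (w v * A v u) * (f u * g v)  ≈⟨ regroup′ (w v) (f u) (A v u) (g v) ⟩
        w v * ((A v u * f u) * g v)  ∎

    sum-preserved : Stochastic A → ∀ f → (sum λ u → w u * (A · f) u) ≈ sum λ u → w u * f u
    sum-preserved stoch f = begin
      (sum λ u → w u * (A · f) u)  ≈⟨ sum-cong (λ u → *-congˡ (*-identityˡ _)) ⟨
      inner w (λ _ → 1#) (A · f)  ≈⟨ self-adjoint (λ _ → 1#) f ⟩
      inner w (A · (λ _ → 1#)) f  ≈⟨ inner-cong w (λ u → trans (sum-cong λ v → *-identityʳ (A u v)) (stoch u)) (λ _ → CommutativeRing.refl R) ⟩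
      inner w (λ _ → 1#) f  ≈⟨ sum-cong (λ u → *-congˡ (*-identityˡ _)) ⟩
      (sum λ u → w u * f u)  ∎

    -- Pairing an eigenvector of eigenvalue μ ≠ 1 with the constant function 1, which is fixed by A,
    -- shows that it has mean 0; so only the i₀-th coefficients of f and of 1 contribute to their means.
    module _ (stoch : Stochastic A) (b : Fin n → Vector Carrier n) (μ : Vector Carrier n) (i₀ : Fin n)
      (eigen : ∀ i u → (A · b i) u ≈ μ i * b i u)
      (cancel : ∀ i → i ≢ i₀ → ∀ x → x * (1# - μ i) ≈ 0# → x ≈ 0#)
      where

      mean : Fin n → Carrier
      mean i = sum λ u → w u * b i u

      mean≈0 : ∀ i → i ≢ i₀ → mean i ≈ 0#
      mean≈0 i i≢i₀ = cancel i i≢i₀ (mean i) (begin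
        mean i * (1# - μ i)  ≈⟨ expand (mean i) (μ i) ⟩
        mean i - μ i * mean i  ≈⟨ +-congˡ (-‿cong (begin
          μ i * mean i  ≈⟨ *-sumˡ (μ i) _ ⟩
          (sum λ u → μ i * (w u * b i u))  ≈⟨ sum-cong (λ u → x∙yz≈y∙xz (μ i) (w u) (b i u)) ⟩
          (sum λ u → w u * (μ i * b i u))  ≈⟨ sum-cong (λ u → *-congˡ (eigen i u)) ⟨
          (sum λ u → w u * (A · b i) u)  ≈⟨ sum-preserved stoch (b i) ⟩
          mean i  ∎)) ⟩
        mean i - mean i  ≈⟨ -‿inverseʳ (mean i) ⟩
        0#  ∎)
        where
        expand : ∀ a b → a * (1# - b) ≈ a - b * a
        expand a b = trans (distribˡ a 1# (- b)) (+-cong (*-identityʳ a) (trans (sym (-‿distribʳ-* a b)) (-‿cong (*-comm a b))))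

      sum-expansion : ∀ (c f : Vector Carrier n) → (∀ u → f u ≈ sum λ i → c i * b i u) →
        (sum λ u → w u * f u) ≈ c i₀ * mean i₀
      sum-expansion c f f≈ = begin
        (sum λ u → w u * f u)  ≈⟨ sum-cong (λ u → *-congˡ (f≈ u)) ⟩
        (sum λ u → w u * sum λ i → c i * b i u)  ≈⟨ sum-cong (λ u → *-sumˡ (w u) _) ⟩
        (sum λ u → sum λ i → w u * (c i * b i u))  ≈⟨ sum-comm _ ⟩
        (sum λ i → sum λ u → w u * (c i * b i u))  ≈⟨ sum-cong (λ i → trans (sum-cong λ u → x∙yz≈y∙xz (w u) (c i) (b i u))
                                                                             (sym (*-sumˡ (c i) _))) ⟩
        (sum λ i → c i * mean i)  ≈⟨ sum-single _ i₀ (λ i i≢i₀ → trans (*-congˡ (mean≈0 i i≢i₀)) (zeroʳ (c i))) ⟩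
        c i₀ * mean i₀  ∎

      -- Expanding 1 in the same basis writes the total weight as `d i₀ * mean i₀`, so the vanishing
      -- of `c i₀ * mean i₀` passes to `c i₀ * sum w`. The detour through 1 takes the place of a
      -- proof that `mean i₀` is invertible.
      coefficient≈0 : ∀ (c f : Vector Carrier n) → (∀ u → f u ≈ sum λ i → c i * b i u) →
        ∀ (d : Vector Carrier n) → (∀ u → 1# ≈ sum λ i → d i * b i u) →
        (sum λ u → w u * f u) ≈ 0# → c i₀ * sum w ≈ 0#
      coefficient≈0 c f f≈ d 1≈ mean-f≈0 = begin
        c i₀ * sum w  ≈⟨ *-congˡ (sum-cong λ u → *-identityʳ (w u)) ⟨
        c i₀ * (sum λ u → w u * 1#)  ≈⟨ *-congˡ (sum-expansion d (λ _ → 1#) 1≈) ⟩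
        c i₀ * (d i₀ * mean i₀)  ≈⟨ x∙yz≈y∙xz (c i₀) (d i₀) (mean i₀) ⟩
        d i₀ * (c i₀ * mean i₀)  ≈⟨ *-congˡ (sum-expansion c f f≈) ⟨
        d i₀ * (sum λ u → w u * f u)  ≈⟨ *-congˡ mean-f≈0 ⟩
        d i₀ * 0#  ≈⟨ zeroʳ (d i₀) ⟩
        0#  ∎

-- Dyadic levels

n≤2^n : ∀ n → n ℕ.≤ 2 ℕ.^ n
n≤2^n zero    = z≤n
n≤2^n (suc n) = ℕ.+-mono-≤ (ℕ.m^n>0 2 n) (ℕ.≤-trans (n≤2^n n) (ℕ.≤-reflexive (≡.sym (ℕ.+-identityʳ (2 ℕ.^ n)))))

2^-positive : ∀ n → 1 ℕ.≤ 2 ℕ.^ n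
2^-positive n = ℕ.m^n>0 2 n

<ᵇ-cases : ∀ m n → ((m ℕ.<ᵇ n) ≡ true × m ℕ.< n) ⊎ ((m ℕ.<ᵇ n) ≡ false × n ℕ.≤ m)
<ᵇ-cases m n with m ℕ.<ᵇ n | ℕ.<ᵇ-reflects-< m n
... | true  | ofʸ m<n = inj₁ (refl , m<n)
... | false | ofⁿ m≮n = inj₂ (refl , ℕ.≮⇒≥ m≮n)

module Levels (κ i₀ X : ℕ) where

  open import Data.Nat using (_+_; _*_; _^_; _≤_; _<ᵇ_)
  open ℕ.≤-Reasoning

  private
    K = suc κ

  -- Level `i₀ + d` fails at `j` if `2^(K (i₀ + d))` is still below `X/j`; the price of the next
  -- level is then added.
  extra : ℕ → ℕ → ℕ
  extra d j = if j * 2 ^ (K * (i₀ + d)) <ᵇ X then 2 ^ (κ * suc (i₀ + d)) else 0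

  -- Sums the powers 2^(κ i) over the levels i at which j is small; a substitute for (X/j)^(κ/K)
  -- that stays in ℕ.
  cost : ℕ → ℕ → ℕ
  cost zero    j = 2 ^ (κ * i₀)
  cost (suc d) j = cost d j + extra d j

  -- Descending from the top, the search stops at a level whose predecessor fails, so that `extra`
  -- has added its price, or at `i₀`, whose price is the initial term.
  cost-large : ∀ d j → X ≤ j * 2 ^ (K * (i₀ + d)) →
    ∃ λ i → X ≤ j * 2 ^ (K * i) × 2 ^ (κ * i) ≤ cost d j
  cost-large zero    j X≤ = i₀ , subst (λ i → X ≤ j * 2 ^ (K * i)) (ℕ.+-identityʳ i₀) X≤ , ℕ.≤-refl
  cost-large (suc d) j X≤ with <ᵇ-cases (j * 2 ^ (K * (i₀ + d))) X
  ... | inj₁ (small , _) rewrite small =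
    suc (i₀ + d) , subst (λ i → X ≤ j * 2 ^ (K * i)) (ℕ.+-suc i₀ d) X≤ , ℕ.m≤n+m _ (cost d j)
  ... | inj₂ (_ , X≤d) with cost-large d j X≤d
  ...   | i , X≤i , ≤cost = i , X≤i , ℕ.≤-trans ≤cost (ℕ.m≤m+n (cost d j) _)

  total : (ℕ → ℕ) → ℕ → ℕ
  total f zero    = 0
  total f (suc m) = f (suc m) + total f m

  total-+ : ∀ f g m → total (λ j → f j + g j) m ≡ total f m + total g m
  total-+ f g zero    = refl
  total-+ f g (suc m) = ≡.trans (cong (_+_ (f (suc m) + g (suc m))) (total-+ f g m))
    (interchange (f (suc m)) (g (suc m)) (total f m) (total g m))
    where
    interchange : ∀ a b c d → a + b + (c + d) ≡ a + c + (b + d)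
    interchange = ℕ-solve-∀

  total-const : ∀ c m → total (λ _ → c) m ≡ m * c
  total-const c zero    = refl
  total-const c (suc m) = cong (c +_) (total-const c m)

  -- At most `X/a` values of `j` contribute: at the largest of them, `suc m * a < X` already bounds
  -- the crude count of `suc m` terms.
  total-threshold : ∀ a b m → a * total (λ j → if j * a <ᵇ X then b else 0) m ≤ X * b
  total-threshold a b zero    = ℕ.≤-trans (ℕ.≤-reflexive (ℕ.*-zeroʳ a)) z≤n
  total-threshold a b (suc m) with <ᵇ-cases (suc m * a) X
  ... | inj₂ (large , _)  rewrite large = total-threshold a b m
  ... | inj₁ (small , <X) rewrite small = begin
    a * (b + total (λ j → if j * a <ᵇ X then b else 0) m)  ≤⟨ ℕ.*-monoʳ-≤ a (ℕ.+-monoʳ-≤ b (crude m)) ⟩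
    a * (b + m * b)  ≡⟨ regroup a b m ⟩
    (suc m * a) * b  ≤⟨ ℕ.*-monoˡ-≤ b (ℕ.<⇒≤ <X) ⟩
    X * b  ∎
    where
    regroup : ∀ a b m → a * (b + m * b) ≡ (suc m * a) * b
    regroup = ℕ-solve-∀
    crude : ∀ m → total (λ j → if j * a <ᵇ X then b else 0) m ≤ m * b
    crude zero    = z≤n
    crude (suc m) with (suc m * a) <ᵇ X
    ... | true  = ℕ.+-monoʳ-≤ b (crude m)
    ... | false = ℕ.≤-trans (crude m) (ℕ.m≤n+m (m * b) b)

  -- At level `i` at most `X / 2^(K i)` values of `j` pay `2^(κ (i + 1))` each. As `K = κ + 1`, a
  -- factor `2^(- i)` is left over, and the totals of the levels are dominated by a geometric
  -- series.
  extra-total : ∀ d m → 2 ^ (i₀ + d) * total (extra d) m ≤ X * 2 ^ κ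
  extra-total d m = ℕ.*-cancelʳ-≤ _ _ (2 ^ (κ * i)) {{ℕ.m^n≢0 2 (κ * i)}} (begin
    (2 ^ i * total (extra d) m) * 2 ^ (κ * i)  ≡⟨ regroup (2 ^ i) (total (extra d) m) (2 ^ (κ * i)) ⟩
    (2 ^ i * 2 ^ (κ * i)) * total (extra d) m  ≡⟨ cong (_* total (extra d) m) (ℕ.^-distribˡ-+-* 2 i (κ * i)) ⟨
    2 ^ (K * i) * total (extra d) m  ≤⟨ total-threshold (2 ^ (K * i)) (2 ^ (κ * suc i)) m ⟩
    X * 2 ^ (κ * suc i)  ≡⟨ cong (λ e → X * 2 ^ e) (ℕ.*-suc κ i) ⟩
    X * 2 ^ (κ + κ * i)  ≡⟨ cong (X *_) (ℕ.^-distribˡ-+-* 2 κ (κ * i)) ⟩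
    X * (2 ^ κ * 2 ^ (κ * i))  ≡⟨ ℕ.*-assoc X (2 ^ κ) (2 ^ (κ * i)) ⟨
    (X * 2 ^ κ) * 2 ^ (κ * i)  ∎)
    where
    i = i₀ + d
    regroup : ∀ a b c → (a * b) * c ≡ (a * c) * b
    regroup = ℕ-solve-∀

  -- The summand `2 * (X * 2 ^ κ)` on the left is the missing tail of the geometric series; with it
  -- the bound exactly doubles from `d` to `suc d`, and the induction closes.
  cost-total : ∀ d m → 2 ^ (i₀ + d) * total (cost d) m + 2 * (X * 2 ^ κ) ℕ.≤
    2 ^ (i₀ + d) * (m * 2 ^ (κ * i₀)) + 2 * 2 ^ d * (X * 2 ^ κ)
  cost-total zero    m = ℕ.≤-reflexive (cong (λ x → 2 ^ (i₀ + 0) * x + 2 * (X * 2 ^ κ)) (total-const (2 ^ (κ * i₀)) m))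
  cost-total (suc d) m = begin
    2 ^ (i₀ + suc d) * total (cost (suc d)) m + 2 * x
      ≡⟨ cong₂ (λ i y → 2 ^ i * y + 2 * x) (ℕ.+-suc i₀ d) (total-+ (cost d) (extra d) m) ⟩
    2 * p * (total (cost d) m + total (extra d) m) + 2 * x
      ≡⟨ regroup p (total (cost d) m) (total (extra d) m) x ⟩
    2 * (p * total (cost d) m + p * total (extra d) m) + 2 * x
      ≤⟨ ℕ.+-monoˡ-≤ (2 * x) (ℕ.*-monoʳ-≤ 2 (ℕ.+-monoʳ-≤ (p * total (cost d) m) (extra-total d m))) ⟩
    2 * (p * total (cost d) m + x) + 2 * x
      ≡⟨ regroup′ (p * total (cost d) m) x ⟩
    2 * (p * total (cost d) m + 2 * x)
      ≤⟨ ℕ.*-monoʳ-≤ 2 (cost-total d m) ⟩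
    2 * (p * (m * c) + 2 * 2 ^ d * x)
      ≡⟨ regroup″ p (m * c) (2 ^ d) x ⟩
    2 * p * (m * c) + 2 * (2 * 2 ^ d) * x
      ≡⟨ cong (λ i → 2 ^ i * (m * c) + 2 * (2 * 2 ^ d) * x) (ℕ.+-suc i₀ d) ⟨
    2 ^ (i₀ + suc d) * (m * c) + 2 * 2 ^ suc d * x ∎
    where
    p = 2 ^ (i₀ + d)
    c = 2 ^ (κ * i₀)
    x = X * 2 ^ κ
    regroup : ∀ p a b x → 2 * p * (a + b) + 2 * x ≡ 2 * (p * a + p * b) + 2 * x
    regroup = ℕ-solve-∀
    regroup′ : ∀ a x → 2 * (a + x) + 2 * x ≡ 2 * (a + 2 * x)
    regroup′ = ℕ-solve-∀
    regroup″ : ∀ p a d x → 2 * (p * a + 2 * d * x) ≡ 2 * p * a + 2 * (2 * d) * x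
    regroup″ = ℕ-solve-∀

  -- The base level is high enough for `2^i₀` to absorb both `T` and the factor `2 * 2^κ` of the
  -- series. The bound is independent of the number `d` of levels.
  scaled-cost-total : ∀ T d m → T * 2 ^ K ≤ 2 ^ i₀ →
    T * total (cost d) m ≤ T * (m * 2 ^ (κ * i₀)) + X
  scaled-cost-total T d m T≤ = ℕ.*-cancelˡ-≤ p {{ℕ.m^n≢0 2 (i₀ + d)}} (begin
    p * (T * total (cost d) m)  ≡⟨ swap p T (total (cost d) m) ⟩
    T * (p * total (cost d) m)  ≤⟨ ℕ.*-monoʳ-≤ T (ℕ.≤-trans (ℕ.m≤m+n _ _) (cost-total d m)) ⟩
    T * (p * (m * c) + 2 * 2 ^ d * (X * 2 ^ κ))  ≡⟨ regroup T p (m * c) (2 ^ d) X (2 ^ κ) ⟩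
    p * (T * (m * c)) + (T * (2 * 2 ^ κ)) * (2 ^ d * X) ≤⟨ ℕ.+-monoʳ-≤ _ (ℕ.*-monoˡ-≤ (2 ^ d * X) T≤) ⟩
    p * (T * (m * c)) + 2 ^ i₀ * (2 ^ d * X)  ≡⟨ cong (_+_ (p * (T * (m * c)))) (≡.trans (≡.sym (ℕ.*-assoc (2 ^ i₀) (2 ^ d) X)) (cong (_* X) (≡.sym (ℕ.^-distribˡ-+-* 2 i₀ d)))) ⟩
    p * (T * (m * c)) + p * X  ≡⟨ ℕ.*-distribˡ-+ p (T * (m * c)) X ⟨
    p * (T * (m * c) + X)  ∎)
    where
    p = 2 ^ (i₀ + d)
    c = 2 ^ (κ * i₀)
    swap : ∀ a b c → a * (b * c) ≡ b * (a * c)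
    swap = ℕ-solve-∀
    regroup : ∀ T p a d X k → T * (p * a + 2 * d * (X * k)) ≡ p * (T * a) + (T * (2 * k)) * (d * X)
    regroup = ℕ-solve-∀

module Rational where

  open import Data.Rational using (_+_; _*_; _-_; -_; _≤_; _<_; ∣_∣)
  open ℚ.≤-Reasoning

  -- Rational arithmetic

  open Exp (CommutativeRing.commutativeSemiring ℚ.+-*-commutativeRing)
    using (_^_; ^-homo-*; ^-assocʳ; ^-distrib-*)
  open Linear ℚ.+-*-commutativeRing

  ring : AlmostCommutativeRing 0ℓ 0ℓ
  ring = fromCommutativeRing ℚ.+-*-commutativeRing λ x → dec⇒maybe (0ℚ ℚ.≟ x)

  2ℚ 3ℚ : ℚ
  2ℚ = 1ℚ + 1ℚ
  3ℚ = 1ℚ + 2ℚ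

  0<1 : 0ℚ < 1ℚ
  0<1 = ℚ.positive⁻¹ 1ℚ

  0≤1 : 0ℚ ≤ 1ℚ
  0≤1 = ℚ.<⇒≤ 0<1

  <⇒≱ : ∀ {p q} → p < q → ¬ (q ≤ p)
  <⇒≱ p<q q≤p = ℚ.<-irrefl refl (ℚ.<-≤-trans p<q q≤p)

  *-monoˡ : ∀ {r p q} → 0ℚ ≤ r → p ≤ q → r * p ≤ r * q
  *-monoˡ {r} 0≤r = ℚ.*-monoˡ-≤-nonNeg r {{ℚ.nonNegative 0≤r}}

  *-monoʳ : ∀ {r p q} → 0ℚ ≤ r → p ≤ q → p * r ≤ q * r
  *-monoʳ {r} 0≤r = ℚ.*-monoʳ-≤-nonNeg r {{ℚ.nonNegative 0≤r}}

  *-mono : ∀ {p p′ q q′} → 0ℚ ≤ p′ → 0ℚ ≤ q → p ≤ p′ → q ≤ q′ → p * q ≤ p′ * q′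
  *-mono 0≤p′ 0≤q p≤p′ q≤q′ = ℚ.≤-trans (*-monoʳ 0≤q p≤p′) (*-monoˡ 0≤p′ q≤q′)

  *-nonneg : ∀ {p q} → 0ℚ ≤ p → 0ℚ ≤ q → 0ℚ ≤ p * q
  *-nonneg {p} 0≤p 0≤q = subst (_≤ p * _) (ℚ.*-zeroʳ p) (*-monoˡ 0≤p 0≤q)

  *-pos : ∀ {p q} → 0ℚ < p → 0ℚ < q → 0ℚ < p * q
  *-pos {p} {q} 0<p 0<q = subst (_< p * q) (ℚ.*-zeroʳ p) (ℚ.*-monoʳ-<-pos p {{ℚ.positive 0<p}} 0<q)

  +-nonneg : ∀ {p q} → 0ℚ ≤ p → 0ℚ ≤ q → 0ℚ ≤ p + q
  +-nonneg = ℚ.+-mono-≤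

  ≤-by : ∀ {p q} r → 0ℚ ≤ r → q ≡ p + r → p ≤ q
  ≤-by {p} {q} r 0≤r q≡p+r = begin
    p  ≡⟨ ℚ.+-identityʳ p ⟨
    p + 0ℚ  ≤⟨ ℚ.+-monoʳ-≤ p 0≤r ⟩
    p + r  ≡⟨ q≡p+r ⟨
    q  ∎

  p≤q⇒0≤q-p : ∀ {p q} → p ≤ q → 0ℚ ≤ q - p
  p≤q⇒0≤q-p {p} {q} p≤q = begin
    0ℚ  ≡⟨ ℚ.+-inverseʳ p ⟨
    p - p  ≤⟨ ℚ.+-monoˡ-≤ (- p) p≤q ⟩
    q - p  ∎

  *-cancelˡ : ∀ {r p q} → 0ℚ < r → r * p ≤ r * q → p ≤ q
  *-cancelˡ {r} 0<r = ℚ.*-cancelˡ-≤-pos r {{ℚ.positive 0<r}}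

  square-nonneg : ∀ p → 0ℚ ≤ p * p
  square-nonneg p with ℚ.≤-total 0ℚ p
  ... | inj₁ 0≤p = *-nonneg 0≤p 0≤p
  ... | inj₂ p≤0 = subst (0ℚ ≤_) (neg-square p) (*-nonneg 0≤-p 0≤-p)
    where
    0≤-p : 0ℚ ≤ - p
    0≤-p = ℚ.neg-antimono-≤ p≤0
    neg-square : ∀ p → - p * - p ≡ p * p
    neg-square = solve-∀ ring

  square-cancel-≤ : ∀ {p q} → 0ℚ ≤ q → p * p ≤ q * q → p ≤ q
  square-cancel-≤ {p} {q} 0≤q p²≤q² with p ℚ.≤? q
  ... | yes p≤q = p≤q
  ... | no  p≰q = contradiction p²≤q² (<⇒≱ (begin-strict
    q * q  ≤⟨ *-monoˡ 0≤q (ℚ.<⇒≤ q<p) ⟩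
    q * p  <⟨ ℚ.*-monoˡ-<-pos p {{ℚ.positive (ℚ.≤-<-trans 0≤q q<p)}} q<p ⟩
    p * p  ∎))
    where
    q<p : q < p
    q<p = ℚ.≰⇒> p≰q

  neg-≤ : ∀ {p q} → - p ≤ q → - q ≤ p
  neg-≤ {p} {q} -p≤q = subst (- q ≤_) (neg-neg p) (ℚ.neg-antimono-≤ -p≤q)
    where
    neg-neg : ∀ p → - - p ≡ p
    neg-neg = solve-∀ ring

  ^-nonneg : ∀ {p} n → 0ℚ ≤ p → 0ℚ ≤ p ^ n
  ^-nonneg zero    0≤p = 0≤1
  ^-nonneg (suc n) 0≤p = *-nonneg 0≤p (^-nonneg n 0≤p)

  ^-pos : ∀ {p} n → 0ℚ < p → 0ℚ < p ^ n
  ^-pos zero    0<p = 0<1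
  ^-pos (suc n) 0<p = *-pos 0<p (^-pos n 0<p)

  ^-mono : ∀ {p q} n → 0ℚ ≤ p → p ≤ q → p ^ n ≤ q ^ n
  ^-mono zero    0≤p p≤q = ℚ.≤-refl
  ^-mono (suc n) 0≤p p≤q = *-mono (ℚ.≤-trans 0≤p p≤q) (^-nonneg n 0≤p) p≤q (^-mono n 0≤p p≤q)

  1^n≡1 : ∀ n → 1ℚ ^ n ≡ 1ℚ
  1^n≡1 zero    = refl
  1^n≡1 (suc n) = ≡.trans (ℚ.*-identityˡ _) (1^n≡1 n)

  1≤^ : ∀ {p} n → 1ℚ ≤ p → 1ℚ ≤ p ^ n
  1≤^ {p} n 1≤p = subst (_≤ p ^ n) (1^n≡1 n) (^-mono n 0≤1 1≤p)

  ^-≤1 : ∀ {p} n → 0ℚ ≤ p → p ≤ 1ℚ → p ^ n ≤ 1ℚ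
  ^-≤1 {p} n 0≤p p≤1 = subst (p ^ n ≤_) (1^n≡1 n) (^-mono n 0≤p p≤1)

  1≤^⇒1≤ : ∀ {p} n → 0ℚ ≤ p → 1ℚ ≤ p ^ suc n → 1ℚ ≤ p
  1≤^⇒1≤ {p} n 0≤p 1≤p^ with 1ℚ ℚ.≤? p
  ... | yes 1≤p = 1≤p
  ... | no  1≰p = contradiction 1≤p^ (<⇒≱ (begin-strict
    p * p ^ n  ≤⟨ *-monoˡ 0≤p (^-≤1 n 0≤p (ℚ.<⇒≤ p<1)) ⟩
    p * 1ℚ  ≡⟨ ℚ.*-identityʳ p ⟩
    p  <⟨ p<1 ⟩
    1ℚ  ∎))
    where
    p<1 : p < 1ℚ
    p<1 = ℚ.≰⇒> 1≰p

  opaque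

    ι : ℕ → ℚ
    ι n = ℤ.+ n ℚ./ 1

    toℚᵘ-ι : ∀ n → ℚ.toℚᵘ (ι n) ℚᵘ.≃ ℚᵘ.mkℚᵘ (ℤ.+ n) 0
    toℚᵘ-ι n = ℚ.toℚᵘ-fromℚᵘ (ℚᵘ.mkℚᵘ (ℤ.+ n) 0)

    ι-+ : ∀ m n → ι (m ℕ.+ n) ≡ ι m + ι n
    ι-+ m n = ℚ.toℚᵘ-injective (ℚᵘ.≃-trans (toℚᵘ-ι (m ℕ.+ n)) (ℚᵘ.≃-trans
      (ℚᵘ.*≡* (cong (λ z → z ℤ.* ℤ.+ 1) (≡.sym (cong₂ ℤ._+_ (ℤ.*-identityʳ (ℤ.+ m)) (ℤ.*-identityʳ (ℤ.+ n))))))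
      (ℚᵘ.≃-sym (ℚᵘ.≃-trans (ℚ.toℚᵘ-homo-+ (ι m) (ι n)) (ℚᵘ.+-cong (toℚᵘ-ι m) (toℚᵘ-ι n))))))

    ι-* : ∀ m n → ι (m ℕ.* n) ≡ ι m * ι n
    ι-* m n = ℚ.toℚᵘ-injective (ℚᵘ.≃-trans (toℚᵘ-ι (m ℕ.* n)) (ℚᵘ.≃-trans
      (ℚᵘ.*≡* (cong (λ z → z ℤ.* ℤ.+ 1) (ℤ.pos-* m n)))
      (ℚᵘ.≃-sym (ℚᵘ.≃-trans (ℚ.toℚᵘ-homo-* (ι m) (ι n)) (ℚᵘ.*-cong (toℚᵘ-ι m) (toℚᵘ-ι n))))))

    ι-mono : ∀ {m n} → m ℕ.≤ n → ι m ≤ ι n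
    ι-mono {m} {n} m≤n = ℚ.toℚᵘ-cancel-≤ (ℚᵘ.≤-respˡ-≃ (ℚᵘ.≃-sym (toℚᵘ-ι m)) (ℚᵘ.≤-respʳ-≃ (ℚᵘ.≃-sym (toℚᵘ-ι n))
      (ℚᵘ.*≤* (ℤ.*-monoʳ-≤-nonNeg (ℤ.+ 1) (ℤ.+≤+ m≤n)))))

    ι-0 : ι 0 ≡ 0ℚ
    ι-0 = refl

    ι-1 : ι 1 ≡ 1ℚ
    ι-1 = refl

    ι-def : ∀ n → ι n ≡ ℤ.+ n ℚ./ 1
    ι-def n = refl

    -- 1/ι 0 = 0.
    1/ι : ℕ → ℚ
    1/ι zero    = 0ℚ
    1/ι (suc n) = ℤ.+ 1 ℚ./ suc n

    0≤1/ι : ∀ n → 0ℚ ≤ 1/ι n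
    0≤1/ι zero    = ℚ.≤-refl
    0≤1/ι (suc n) = ℚ.nonNegative⁻¹ _ {{ℚ.normalize-nonNeg 1 (suc n)}}

    ι*1/ι : ∀ {n} → 1 ℕ.≤ n → ι n * 1/ι n ≡ 1ℚ
    ι*1/ι {suc n} _ = ℚ.toℚᵘ-injective (ℚᵘ.≃-trans (ℚ.toℚᵘ-homo-* (ι (suc n)) (ℤ.+ 1 ℚ./ suc n))
      (ℚᵘ.≃-trans (ℚᵘ.*-cong (toℚᵘ-ι (suc n)) (ℚ.toℚᵘ-fromℚᵘ (ℚᵘ.mkℚᵘ (ℤ.+ 1) n)))
      (ℚᵘ.*≡* (≡.trans (ℤ.*-identityʳ (ℤ.+ suc n ℤ.* ℤ.+ 1)) (≡.trans (ℤ.*-identityʳ (ℤ.+ suc n)) (≡.sym (≡.trans (ℤ.*-identityˡ (ℤ.+ 1 ℤ.* ℤ.+ suc n)) (ℤ.*-identityˡ (ℤ.+ suc n)))))))))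

    1/ι-suc : ∀ n → 1/ι (suc n) ≡ ℤ.+ 1 ℚ./ suc n
    1/ι-suc n = refl

    1/ι-0 : 1/ι 0 ≡ 0ℚ
    1/ι-0 = refl

  0≤ι : ∀ n → 0ℚ ≤ ι n
  0≤ι n = subst (_≤ ι n) ι-0 (ι-mono z≤n)

  1≤ι : ∀ {n} → 1 ℕ.≤ n → 1ℚ ≤ ι n
  1≤ι {n} 1≤n = subst (_≤ ι n) ι-1 (ι-mono 1≤n)

  ι-suc : ∀ n → ι (suc n) ≡ 1ℚ + ι n
  ι-suc n = ≡.trans (ι-+ 1 n) (cong (_+ ι n) ι-1)

  ι-2 : ι 2 ≡ 2ℚ
  ι-2 = ≡.trans (ι-suc 1) (cong (1ℚ +_) ι-1)

  ι-3 : ι 3 ≡ 3ℚ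
  ι-3 = ≡.trans (ι-suc 2) (cong (1ℚ +_) ι-2)

  ι-^ : ∀ m n → ι (m ℕ.^ n) ≡ ι m ^ n
  ι-^ m zero    = ι-1
  ι-^ m (suc n) = ≡.trans (ι-* m (m ℕ.^ n)) (cong (ι m *_) (ι-^ m n))

  1/ι*ι : ∀ {n} → 1 ℕ.≤ n → 1/ι n * ι n ≡ 1ℚ
  1/ι*ι {n} 1≤n = ≡.trans (ℚ.*-comm (1/ι n) (ι n)) (ι*1/ι 1≤n)

  1/ι≤1 : ∀ n → 1/ι n ≤ 1ℚ
  1/ι≤1 zero    = subst (_≤ 1ℚ) (≡.sym 1/ι-0) 0≤1
  1/ι≤1 (suc n) = begin
    1/ι (suc n)  ≡⟨ ℚ.*-identityˡ _ ⟨
    1ℚ * 1/ι (suc n)  ≤⟨ *-monoʳ (0≤1/ι (suc n)) (1≤ι (s≤s z≤n)) ⟩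
    ι (suc n) * 1/ι (suc n)  ≡⟨ ι*1/ι (s≤s z≤n) ⟩
    1ℚ  ∎

  -- Takes the place of `(1 - y)^n ≤ exp (- n y)`; at `y = 1/n` it says that the power is at most
  -- one half.
  [1-y]^n*[1+ny]≤1 : ∀ {y} n → 0ℚ ≤ y → y ≤ 1ℚ → (1ℚ - y) ^ n * (1ℚ + ι n * y) ≤ 1ℚ
  [1-y]^n*[1+ny]≤1 {y} zero    0≤y y≤1 = ℚ.≤-reflexive (base y)
    where
    base : ∀ y → 1ℚ * (1ℚ + ι 0 * y) ≡ 1ℚ
    base y = ≡.trans (cong (λ z → 1ℚ * (1ℚ + z * y)) ι-0) (simplify y)
      where
      simplify : ∀ y → 1ℚ * (1ℚ + 0ℚ * y) ≡ 1ℚ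
      simplify = solve-∀ ring
  [1-y]^n*[1+ny]≤1 {y} (suc n) 0≤y y≤1 = begin
    ((1ℚ - y) * (1ℚ - y) ^ n) * (1ℚ + ι (suc n) * y)
      ≡⟨ cong (λ z → ((1ℚ - y) * (1ℚ - y) ^ n) * (1ℚ + z * y)) (ι-suc n) ⟩
    ((1ℚ - y) * (1ℚ - y) ^ n) * (1ℚ + (1ℚ + ι n) * y)
      ≤⟨ ≤-by _ (*-nonneg (^-nonneg n (p≤q⇒0≤q-p y≤1)) (*-nonneg (+-nonneg 0≤1 (0≤ι n)) (*-nonneg 0≤y 0≤y)))
           (rearrange y ((1ℚ - y) ^ n) (ι n)) ⟩
    (1ℚ - y) ^ n * (1ℚ + ι n * y)
      ≤⟨ [1-y]^n*[1+ny]≤1 n 0≤y y≤1 ⟩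
    1ℚ ∎
    where
    rearrange : ∀ y p n → p * (1ℚ + n * y) ≡ ((1ℚ - y) * p) * (1ℚ + (1ℚ + n) * y) + p * ((1ℚ + n) * (y * y))
    rearrange = solve-∀ ring

  2*[1-1/n]^n≤1 : ∀ {n} → 1 ℕ.≤ n → 2ℚ * (1ℚ - 1/ι n) ^ n ≤ 1ℚ
  2*[1-1/n]^n≤1 {n} 1≤n = begin
    2ℚ * (1ℚ - 1/ι n) ^ n  ≡⟨ ℚ.*-comm 2ℚ ((1ℚ - 1/ι n) ^ n) ⟩
    (1ℚ - 1/ι n) ^ n * (1ℚ + 1ℚ)  ≡⟨ cong (λ z → (1ℚ - 1/ι n) ^ n * (1ℚ + z)) (ι*1/ι 1≤n) ⟨
    (1ℚ - 1/ι n) ^ n * (1ℚ + ι n * 1/ι n)  ≤⟨ [1-y]^n*[1+ny]≤1 n (0≤1/ι n) (1/ι≤1 n) ⟩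
    1ℚ  ∎

  2^j*[1-1/n]^nj≤1 : ∀ {n} j → 1 ℕ.≤ n → 2ℚ ^ j * (1ℚ - 1/ι n) ^ (n ℕ.* j) ≤ 1ℚ
  2^j*[1-1/n]^nj≤1 {n} j 1≤n = begin
    2ℚ ^ j * (1ℚ - 1/ι n) ^ (n ℕ.* j)  ≡⟨ cong (2ℚ ^ j *_) (^-assocʳ (1ℚ - 1/ι n) n j) ⟨
    2ℚ ^ j * ((1ℚ - 1/ι n) ^ n) ^ j  ≡⟨ ^-distrib-* 2ℚ _ j ⟨
    (2ℚ * (1ℚ - 1/ι n) ^ n) ^ j  ≤⟨ ^-≤1 j (*-nonneg (+-nonneg 0≤1 0≤1) (^-nonneg n (p≤q⇒0≤q-p (1/ι≤1 n)))) (2*[1-1/n]^n≤1 1≤n) ⟩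
    1ℚ  ∎

  -- The first two terms of the binomial expansion, in homogeneous form so that nothing is divided
  -- by `p`.
  bernoulli : ∀ {p d} k → 0ℚ ≤ p → 0ℚ ≤ d → p ^ suc k + ι (suc k) * (p ^ k * d) ≤ (p + d) ^ suc k
  bernoulli {p} {d} zero    0≤p 0≤d = ℚ.≤-reflexive (base p d)
    where
    base : ∀ p d → p * 1ℚ + ι 1 * (1ℚ * d) ≡ (p + d) * 1ℚ
    base p d = ≡.trans (cong (λ z → p * 1ℚ + z * (1ℚ * d)) ι-1) (simplify p d)
      where
      simplify : ∀ p d → p * 1ℚ + 1ℚ * (1ℚ * d) ≡ (p + d) * 1ℚ
      simplify = solve-∀ ring
  bernoulli {p} {d} (suc k) 0≤p 0≤d = begin
    p * p ^ suc k + ι (suc (suc k)) * ((p * p ^ k) * d)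
      ≡⟨ cong (λ z → p * p ^ suc k + z * ((p * p ^ k) * d)) (ι-suc (suc k)) ⟩
    p * p ^ suc k + (1ℚ + ι (suc k)) * ((p * p ^ k) * d)
      ≤⟨ ≤-by _ (*-nonneg 0≤d (*-nonneg (0≤ι (suc k)) (*-nonneg (^-nonneg k 0≤p) 0≤d))) (rearrange p d (p ^ k) (ι (suc k))) ⟩
    (p + d) * (p ^ suc k + ι (suc k) * (p ^ k * d))
      ≤⟨ *-monoˡ (+-nonneg 0≤p 0≤d) (bernoulli k 0≤p 0≤d) ⟩
    (p + d) * (p + d) ^ suc k ∎
    where
    rearrange : ∀ p d q m → (p + d) * (p * q + m * (q * d)) ≡ (p * (p * q) + (1ℚ + m) * ((p * q) * d)) + d * (m * (q * d))
    rearrange = solve-∀ ring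

  sum-mono : ∀ {n} {f g : Vector ℚ n} → (∀ i → f i ≤ g i) → sum f ≤ sum g
  sum-mono {zero}  {f} {g} f≤g = ℚ.≤-reflexive (≡.trans (sum-[] f) (≡.sym (sum-[] g)))
  sum-mono {suc n} {f} {g} f≤g = begin
    sum f  ≡⟨ sum-suc f ⟩
    f zero + sum (λ i → f (suc i))  ≤⟨ ℚ.+-mono-≤ (f≤g zero) (sum-mono λ i → f≤g (suc i)) ⟩
    g zero + sum (λ i → g (suc i))  ≡⟨ sum-suc g ⟨
    sum g  ∎

  sum-nonneg : ∀ {n} {f : Vector ℚ n} → (∀ i → 0ℚ ≤ f i) → 0ℚ ≤ sum f
  sum-nonneg {n} {f} 0≤f = begin
    0ℚ  ≡⟨ sum-zero {n} (λ _ → refl) ⟨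
    sum {n} (λ _ → 0ℚ)  ≤⟨ sum-mono 0≤f ⟩
    sum f  ∎

  term≤sum : ∀ {n} {f : Vector ℚ n} → (∀ i → 0ℚ ≤ f i) → ∀ i → f i ≤ sum f
  term≤sum {suc n} {f} 0≤f i = ≤-by (sum (removeAt f i)) (sum-nonneg λ j → 0≤f (Fin.punchIn i j)) (sum-remove f i)

  sum-const : ∀ {n} c → sum {n} (λ _ → c) ≡ ι n * c
  sum-const {zero}  c = ≡.trans (sum-[] _) (≡.sym (≡.trans (cong (_* c) ι-0) (ℚ.*-zeroˡ c)))
  sum-const {suc n} c = ≡.trans (sum-suc {n} (λ _ → c)) (≡.trans (cong (c +_) (sum-const {n} c)) (≡.trans (factor c (ι n)) (cong (_* c) (≡.sym (ι-suc n)))))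
    where
    factor : ∀ c m → c + m * c ≡ (1ℚ + m) * c
    factor = solve-∀ ring

  -- The vector `h` is `a` times the component of `g` orthogonal to `f`, and its squared norm is
  -- `a (a c - b²)`.
  cauchy-schwarz : ∀ {n} (w f g : Vector ℚ n) → (∀ u → 0ℚ ≤ w u) → 0ℚ < inner w f f →
    inner w f g * inner w f g ≤ inner w f f * inner w g g
  cauchy-schwarz w f g 0≤w 0<a = *-cancelˡ 0<a (begin
    a * (b * b)  ≤⟨ ≤-by _ (sum-nonneg λ u → *-nonneg (0≤w u) (square-nonneg (h u))) expansion ⟩
    a * (a * c)  ∎)
    where
    a = inner w f f
    b = inner w f g
    c = inner w g g
    h : Vector ℚ _
    h u = a * g u + - b * f u
    square : ∀ a b c x → a * (a * c + - b * b) + - b * (a * b + - b * a) ≡ x → a * (a * c) ≡ a * (b * b) + x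
    square a b c _ refl = identity a b c
      where
      identity : ∀ a b c → a * (a * c) ≡ a * (b * b) + (a * (a * c + - b * b) + - b * (a * b + - b * a))
      identity = solve-∀ ring
    linear : ∀ k → inner w k h ≡ a * inner w k g + - b * inner w k f
    linear k = ≡.trans (inner-+ʳ w k _ _) (cong₂ _+_ (inner-*ʳ w k a g) (inner-*ʳ w k (- b) f))
    expansion : a * (a * c) ≡ a * (b * b) + inner w h h
    expansion = square a b c _ (≡.sym (begin-equality
      inner w h h  ≡⟨ linear h ⟩
      a * inner w h g + - b * inner w h f  ≡⟨ cong₂ (λ x y → a * x + - b * y)
                                                                   (≡.trans (inner-comm w h g) (linear g))
                                                                   (≡.trans (inner-comm w h f) (linear f)) ⟩
      a * (a * c + - b * inner w g f) + - b * (a * b + - b * a)  ≡⟨ cong (λ x → a * (a * c + - b * x) + - b * (a * b + - b * a)) (inner-comm w g f) ⟩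
      a * (a * c + - b * b) + - b * (a * b + - b * a)  ∎))

  -- The boosting inequality and the simple random walk

  -- The mediant (a + c)/(b + d) is at most the larger of a/b and c/d.
  mediant-^-ordered : ∀ {a b c d M} k → 0ℚ ≤ a → 0ℚ ≤ b → 0ℚ ≤ c → 0ℚ ≤ d →
    a ^ suc k ≤ b ^ suc k * M → c ^ suc k ≤ d ^ suc k * M → a * d ≤ b * c →
    (a + c) ^ suc k ≤ (b + d) ^ suc k * M
  mediant-^-ordered {a} {b} {c} {d} {M} k 0≤a 0≤b 0≤c 0≤d a≤bM c≤dM ad≤bc with 0ℚ ℚ.<? d
  ... | yes 0<d = *-cancelˡ (^-pos (suc k) 0<d) (begin
    d ^ suc k * (a + c) ^ suc k  ≡⟨ ^-distrib-* d (a + c) (suc k) ⟨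
    (d * (a + c)) ^ suc k  ≤⟨ ^-mono (suc k) (*-nonneg 0≤d (+-nonneg 0≤a 0≤c)) cross ⟩
    ((b + d) * c) ^ suc k  ≡⟨ ^-distrib-* (b + d) c (suc k) ⟩
    (b + d) ^ suc k * c ^ suc k  ≤⟨ *-monoˡ (^-nonneg (suc k) (+-nonneg 0≤b 0≤d)) c≤dM ⟩
    (b + d) ^ suc k * (d ^ suc k * M)  ≡⟨ swap ((b + d) ^ suc k) (d ^ suc k) M ⟩
    d ^ suc k * ((b + d) ^ suc k * M)  ∎)
    where
    swap : ∀ x y z → x * (y * z) ≡ y * (x * z)
    swap = solve-∀ ring
    expand : ∀ a b c d → (b + d) * c ≡ d * (a + c) + (b * c - a * d)
    expand = solve-∀ ring
    cross : d * (a + c) ≤ (b + d) * c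
    cross = ≤-by _ (p≤q⇒0≤q-p ad≤bc) (expand a b c d)
  ... | no  0≮d = begin
    (a + c) ^ suc k  ≡⟨ cong (_^ suc k) (≡.trans (cong (a +_) c≡0) (ℚ.+-identityʳ a)) ⟩
    a ^ suc k  ≤⟨ a≤bM ⟩
    b ^ suc k * M  ≡⟨ cong (λ z → z ^ suc k * M) (≡.trans (cong (b +_) d≡0) (ℚ.+-identityʳ b)) ⟨
    (b + d) ^ suc k * M  ∎
    where
    d≡0 : d ≡ 0ℚ
    d≡0 = ℚ.≤-antisym (ℚ.≮⇒≥ 0≮d) 0≤d
    c≡0 : c ≡ 0ℚ
    c≡0 with 0ℚ ℚ.<? c
    ... | no  0≮c = ℚ.≤-antisym (ℚ.≮⇒≥ 0≮c) 0≤c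
    ... | yes 0<c = contradiction c≤dM (<⇒≱ (begin-strict
      d ^ suc k * M  ≡⟨ cong (λ z → z ^ suc k * M) d≡0 ⟩
      (0ℚ * 0ℚ ^ k) * M  ≡⟨ cong (_* M) (ℚ.*-zeroˡ (0ℚ ^ k)) ⟩
      0ℚ * M  ≡⟨ ℚ.*-zeroˡ M ⟩
      0ℚ  <⟨ ^-pos (suc k) 0<c ⟩
      c ^ suc k  ∎))

  mediant-^ : ∀ {a b c d M} k → 0ℚ ≤ a → 0ℚ ≤ b → 0ℚ ≤ c → 0ℚ ≤ d →
    a ^ suc k ≤ b ^ suc k * M → c ^ suc k ≤ d ^ suc k * M → (a + c) ^ suc k ≤ (b + d) ^ suc k * M
  mediant-^ {a} {b} {c} {d} {M} k 0≤a 0≤b 0≤c 0≤d a≤bM c≤dM with ℚ.≤-total (a * d) (b * c)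
  ... | inj₁ ad≤bc = mediant-^-ordered k 0≤a 0≤b 0≤c 0≤d a≤bM c≤dM ad≤bc
  ... | inj₂ bc≤ad = begin
    (a + c) ^ suc k  ≡⟨ cong (_^ suc k) (ℚ.+-comm a c) ⟩
    (c + a) ^ suc k  ≤⟨ mediant-^-ordered k 0≤c 0≤d 0≤a 0≤b c≤dM a≤bM
                                  (≡.subst₂ _≤_ (ℚ.*-comm b c) (ℚ.*-comm a d) bc≤ad) ⟩
    (d + b) ^ suc k * M  ≡⟨ cong (λ z → z ^ suc k * M) (ℚ.+-comm d b) ⟩
    (b + d) ^ suc k * M  ∎

  -- With a root of `M` this would be a sum of termwise bounds; adding one fraction at a time by the
  -- mediant inequality avoids the root.
  sum-^ : ∀ {n} {f g : Vector ℚ n} {M} k → 0ℚ ≤ M → (∀ i → 0ℚ ≤ f i) → (∀ i → 0ℚ ≤ g i) →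
    (∀ i → f i ^ suc k ≤ g i ^ suc k * M) → sum f ^ suc k ≤ sum g ^ suc k * M
  sum-^ {zero}  {f} {g} {M} k 0≤M 0≤f 0≤g f≤gM = begin
    sum f * sum f ^ k  ≡⟨ cong (_* sum f ^ k) (sum-[] f) ⟩
    0ℚ * sum f ^ k  ≡⟨ ℚ.*-zeroˡ (sum f ^ k) ⟩
    0ℚ  ≤⟨ *-nonneg (^-nonneg (suc k) (sum-nonneg 0≤g)) 0≤M ⟩
    sum g ^ suc k * M  ∎
  sum-^ {suc n} {f} {g} {M} k 0≤M 0≤f 0≤g f≤gM = begin
    sum f ^ suc k  ≡⟨ cong (_^ suc k) (sum-suc f) ⟩
    (f zero + sum (λ i → f (suc i))) ^ suc k  ≤⟨ mediant-^ k (0≤f zero) (0≤g zero)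
                                                             (sum-nonneg λ i → 0≤f (suc i)) (sum-nonneg λ i → 0≤g (suc i))
                                                             (f≤gM zero) (sum-^ k 0≤M (λ i → 0≤f (suc i)) (λ i → 0≤g (suc i)) λ i → f≤gM (suc i)) ⟩
    (g zero + sum (λ i → g (suc i))) ^ suc k * M  ≡⟨ cong (λ z → z ^ suc k * M) (sum-suc g) ⟨
    sum g ^ suc k * M  ∎

  -- With y = x^(1 - 1/K) this is the boosting of a probability p to p^(1 - 1/K), stated without
  -- fractional powers; the last step is weighted AM–GM, in the form of Bernoulli's inequality.
  boost-step : ∀ {n} (p x y : Vector ℚ n) {M} k → let K = suc (suc k) in
    (∀ v → 0ℚ ≤ p v) → sum p ≡ 1ℚ → 0ℚ ≤ M → (∀ v → 0ℚ ≤ x v) → (∀ v → 0ℚ ≤ y v) →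
    (∀ v → p v ≡ 0ℚ ⊎ y v ≤ M) → (∀ v → x v ^ suc k ≤ y v ^ K) →
    (sum λ v → p v * x v) ^ suc k ≤ ((1ℚ - 1/ι K) * (sum λ v → p v * y v) + 1/ι K * M) ^ K
  boost-step p x y {M} k 0≤p ∑p≡1 0≤M 0≤x 0≤y y≤M x≤y = begin
    x̄ ^ suc k
      -- Where `y v ≤ M`, termwise `x^(k+1) ≤ y^K ≤ y^(k+1) M`; where `p v` vanishes, so does the
      -- left side.
      ≤⟨ sum-^ k 0≤M (λ v → *-nonneg (0≤p v) (0≤x v)) (λ v → *-nonneg (0≤p v) (0≤y v)) pointwise ⟩
    ȳ ^ suc k * M
      ≡⟨ split (ȳ ^ suc k) ȳ M ⟩
    ȳ * ȳ ^ suc k + 1ℚ * (ȳ ^ suc k * (M - ȳ))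
      ≡⟨ cong (λ z → ȳ * ȳ ^ suc k + z * (ȳ ^ suc k * (M - ȳ))) (ι*1/ι {K} (s≤s z≤n)) ⟨
    ȳ * ȳ ^ suc k + (ι K * 1/ι K) * (ȳ ^ suc k * (M - ȳ))
      ≡⟨ regroup (ȳ ^ K) (ι K) (1/ι K) (ȳ ^ suc k) (M - ȳ) ⟩
    ȳ ^ K + ι K * (ȳ ^ suc k * (1/ι K * (M - ȳ)))
      ≤⟨ bernoulli (suc k) 0≤ȳ (*-nonneg (0≤1/ι K) (p≤q⇒0≤q-p ȳ≤M)) ⟩
    (ȳ + 1/ι K * (M - ȳ)) ^ K
      ≡⟨ cong (_^ K) (mix ȳ (1/ι K) M) ⟩
    ((1ℚ - 1/ι K) * ȳ + 1/ι K * M) ^ K ∎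
    where
    K = suc (suc k)
    x̄ = sum λ v → p v * x v
    ȳ = sum λ v → p v * y v
    0≤ȳ : 0ℚ ≤ ȳ
    0≤ȳ = sum-nonneg λ v → *-nonneg (0≤p v) (0≤y v)
    split : ∀ a y M → a * M ≡ y * a + 1ℚ * (a * (M - y))
    split = solve-∀ ring
    regroup : ∀ a m i q d → a + (m * i) * (q * d) ≡ a + m * (q * (i * d))
    regroup = solve-∀ ring
    mix : ∀ y i M → y + i * (M - y) ≡ (1ℚ - i) * y + i * M
    mix = solve-∀ ring
    py≤pM : ∀ v → p v * y v ≤ p v * M
    py≤pM v with y≤M v
    ... | inj₁ p≡0 = ℚ.≤-reflexive (≡.trans (cong (_* y v) p≡0) (≡.trans (ℚ.*-zeroˡ (y v)) (≡.sym (≡.trans (cong (_* M) p≡0) (ℚ.*-zeroˡ M)))))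
    ... | inj₂ y≤M = *-monoˡ (0≤p v) y≤M
    ȳ≤M : ȳ ≤ M
    ȳ≤M = begin
      ȳ  ≤⟨ sum-mono py≤pM ⟩
      (sum λ v → p v * M)  ≡⟨ *-sumʳ M p ⟨
      sum p * M  ≡⟨ cong (_* M) ∑p≡1 ⟩
      1ℚ * M  ≡⟨ ℚ.*-identityˡ M ⟩
      M  ∎
    pointwise : ∀ v → (p v * x v) ^ suc k ≤ (p v * y v) ^ suc k * M
    pointwise v with y≤M v
    ... | inj₁ p≡0 = begin
      (p v * x v) * (p v * x v) ^ k  ≡⟨ cong (λ z → (z * x v) * (p v * x v) ^ k) p≡0 ⟩
      (0ℚ * x v) * (p v * x v) ^ k  ≡⟨ zero-product (x v) _ ⟩
      0ℚ  ≤⟨ *-nonneg (^-nonneg (suc k) (*-nonneg (0≤p v) (0≤y v))) 0≤M ⟩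
      (p v * y v) ^ suc k * M  ∎
      where
      zero-product : ∀ a b → (0ℚ * a) * b ≡ 0ℚ
      zero-product = solve-∀ ring
    ... | inj₂ y≤M = begin
      (p v * x v) ^ suc k  ≡⟨ ^-distrib-* (p v) (x v) (suc k) ⟩
      p v ^ suc k * x v ^ suc k  ≤⟨ *-monoˡ (^-nonneg (suc k) (0≤p v)) (x≤y v) ⟩
      p v ^ suc k * (y v * y v ^ suc k)  ≤⟨ *-monoˡ (^-nonneg (suc k) (0≤p v)) (*-monoʳ (^-nonneg (suc k) (0≤y v)) y≤M) ⟩
      p v ^ suc k * (M * y v ^ suc k)  ≡⟨ shuffle (p v ^ suc k) M (y v ^ suc k) ⟩
      (p v ^ suc k * y v ^ suc k) * M  ≡⟨ cong (_* M) (^-distrib-* (p v) (y v) (suc k)) ⟨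
      (p v * y v) ^ suc k * M  ∎
      where
      shuffle : ∀ a b c → a * (b * c) ≡ (a * c) * b
      shuffle = solve-∀ ring

  indicator : ∀ {P : Set} → Dec P → ℚ
  indicator p? = if does p? then 1ℚ else 0ℚ

  0≤indicator : ∀ {P : Set} (p? : Dec P) → 0ℚ ≤ indicator p?
  0≤indicator (yes _) = 0≤1
  0≤indicator (no _)  = ℚ.≤-refl

  sum-indicator : ∀ {n} {A : Set} {P : A → Set} (P? : ∀ x → Dec (P x)) (f : Fin n → A) →
    (sum λ i → indicator (P? (f i))) ≡ ι (List.length (filter P? (List.tabulate f)))
  sum-indicator {zero}  P? f = ≡.trans (sum-[] _) (≡.sym ι-0)
  sum-indicator {suc n} P? f with sum-indicator P? (λ i → f (suc i)) | sum-suc (λ i → indicator (P? (f i)))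
  ... | rest | split with P? (f zero)
  ... | yes _ = ≡.trans split (≡.trans (cong (1ℚ +_) rest) (≡.sym (ι-suc _)))
  ... | no  _ = ≡.trans split (≡.trans (cong (0ℚ +_) rest) (ℚ.+-identityˡ _))

  point : ∀ {n} → Fin n → Vector ℚ n
  point v u = indicator (u Fin.≟ v)

  point-self : ∀ {n} (v : Fin n) → point v v ≡ 1ℚ
  point-self v with v Fin.≟ v
  ... | yes _ = refl
  ... | no v≢v = contradiction refl v≢v

  point-other : ∀ {n} {u v : Fin n} → u ≢ v → point v u ≡ 0ℚ
  point-other {u = u} {v} u≢v with u Fin.≟ v
  ... | yes u≡v = contradiction u≡v u≢v
  ... | no  _   = refl

  point-sym : ∀ {n} (v u : Fin n) → point v u ≡ point u v
  point-sym v u with u Fin.≟ v | v Fin.≟ u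
  ... | yes _   | yes _   = refl
  ... | no  _   | no  _   = refl
  ... | yes u≡v | no  v≢u = contradiction (≡.sym u≡v) v≢u
  ... | no  u≢v | yes v≡u = contradiction (≡.sym v≡u) u≢v

  sum-point : ∀ {n} (f : Vector ℚ n) v → (sum λ u → f u * point v u) ≡ f v
  sum-point f v = ≡.trans (sum-single _ v λ u u≢v → ≡.trans (cong (f u *_) (point-other u≢v)) (ℚ.*-zeroʳ (f u)))
    (≡.trans (cong (f v *_) (point-self v)) (ℚ.*-identityʳ (f v)))

  ·-const : ∀ {n} {A : Fin n → Fin n → ℚ} → Stochastic A → ∀ c u → (A · (λ _ → c)) u ≡ c
  ·-const {A = A} stoch c u = ≡.trans (≡.sym (*-sumʳ c (A u))) (≡.trans (cong (_* c) (stoch u)) (ℚ.*-identityˡ c))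

  module _ {n : ℕ} (G : Graph n) where

    open Graph G

    weight : Vector ℚ n
    weight u = ι (degree u)

    walk : Fin n → Fin n → ℚ
    walk u v = if does (u ~? v) then 1/ι (degree u) else 0ℚ

    lazy : Fin n → Fin n → ℚ
    lazy u v = ½ * (point v u + walk u v)

    walk-nonneg : ∀ u v → 0ℚ ≤ walk u v
    walk-nonneg u v with u ~? v
    ... | yes _ = 0≤1/ι (degree u)
    ... | no  _ = ℚ.≤-refl

    walk-off-edge : ∀ u v → ¬ (u ~ v) → walk u v ≡ 0ℚ
    walk-off-edge u v u≁v with u ~? v
    ... | yes u~v = contradiction u~v u≁v
    ... | no  _   = refl

    degree≥1 : 2 ℕ.≤ n → ∀ u → 1 ℕ.≤ degree u
    degree≥1 2≤n u with another 2≤n u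
      where
      another : ∀ {n} → 2 ℕ.≤ n → (u : Fin n) → ∃ λ v → u ≢ v
      another (s≤s (s≤s _)) zero    = suc zero , λ ()
      another (s≤s (s≤s _)) (suc u) = zero , λ ()
    ... | v , u≢v with connected u v
    ... | Closure.ε = contradiction refl u≢v
    ... | _◅_ {j = x} u~x _ = nonempty (∈-filter⁺ (u ~?_) (∈-allFin x) u~x)
      where
      nonempty : ∀ {xs : List (Fin n)} → x ∈ xs → 1 ℕ.≤ List.length xs
      nonempty (here _)  = s≤s z≤n
      nonempty (there _) = s≤s z≤n

    module _ (degree≥1 : ∀ u → 1 ℕ.≤ degree u) where

      walk-stochastic : Stochastic walk
      walk-stochastic u = begin-equality
        (sum λ v → walk u v)  ≡⟨ sum-cong (λ v → as-multiple (does (u ~? v))) ⟩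
        (sum λ v → 1/ι (degree u) * indicator (u ~? v))  ≡⟨ *-sumˡ (1/ι (degree u)) _ ⟨
        1/ι (degree u) * (sum λ v → indicator (u ~? v))  ≡⟨ cong (1/ι (degree u) *_) (sum-indicator (u ~?_) (λ v → v)) ⟩
        1/ι (degree u) * ι (degree u)  ≡⟨ 1/ι*ι (degree≥1 u) ⟩
        1ℚ  ∎
        where
        as-multiple : ∀ b → (if b then 1/ι (degree u) else 0ℚ) ≡ 1/ι (degree u) * (if b then 1ℚ else 0ℚ)
        as-multiple true  = ≡.sym (ℚ.*-identityʳ (1/ι (degree u)))
        as-multiple false = ≡.sym (ℚ.*-zeroʳ (1/ι (degree u)))

      walk-reversible : Reversible weight walk
      walk-reversible u v with u ~? v | v ~? u
      ... | yes _   | yes _   = ≡.trans (ι*1/ι (degree≥1 u)) (≡.sym (ι*1/ι (degree≥1 v)))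
      ... | no  _   | no  _   = ≡.trans (ℚ.*-zeroʳ (weight u)) (≡.sym (ℚ.*-zeroʳ (weight v)))
      ... | yes u~v | no  v≁u = contradiction (symmetric u~v) v≁u
      ... | no  u≁v | yes v~u = contradiction (symmetric v~u) u≁v

    lazy-· : ∀ f u → (lazy · f) u ≡ ½ * (f u + (walk · f) u)
    lazy-· f u = begin-equality
      (sum λ v → (½ * (point v u + walk u v)) * f v)  ≡⟨ sum-cong (λ v → expand ½ (point v u) (walk u v) (f v)) ⟩
      (sum λ v → ½ * (f v * point v u + walk u v * f v))  ≡⟨ *-sumˡ ½ _ ⟨
      ½ * (sum λ v → f v * point v u + walk u v * f v)  ≡⟨ cong (½ *_) (sum-+ _ _) ⟩
      ½ * ((sum λ v → f v * point v u) + (walk · f) u)  ≡⟨ cong (λ z → ½ * (z + (walk · f) u))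
                                                                                (≡.trans (sum-cong λ v → cong (f v *_) (point-sym v u)) (sum-point f u)) ⟩
      ½ * (f u + (walk · f) u)  ∎
      where
      expand : ∀ h p w f → (h * (p + w)) * f ≡ h * (f * p + w * f)
      expand = solve-∀ ring

  -- Mixing and hitting times from a spectral gap

  inverse : ∀ {p} → 0ℚ < p → ∃ λ q → 0ℚ < q × p * q ≡ 1ℚ
  inverse {p} 0<p = ℚ.1/ p , ℚ.positive⁻¹ (ℚ.1/ p) {{ℚ.1/pos⇒pos p}} , ℚ.*-inverseʳ p
    where
    instance
      p-positive : ℚ.Positive p
      p-positive = ℚ.positive 0<p
      p-nonZero : ℚ.NonZero p
      p-nonZero = ℚ.pos⇒nonZero p

  1/ι-* : ∀ {m n} → 1 ℕ.≤ m → 1 ℕ.≤ n → 1/ι (m ℕ.* n) ≡ 1/ι m * 1/ι n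
  1/ι-* {m} {n} 1≤m 1≤n = begin-equality
    1/ι (m ℕ.* n)  ≡⟨ ones (1/ι (m ℕ.* n)) ⟩
    1/ι (m ℕ.* n) * (1ℚ * 1ℚ)  ≡⟨ cong₂ (λ x y → 1/ι (m ℕ.* n) * (x * y)) (ι*1/ι 1≤m) (ι*1/ι 1≤n) ⟨
    1/ι (m ℕ.* n) * ((ι m * 1/ι m) * (ι n * 1/ι n))  ≡⟨ regroup (1/ι (m ℕ.* n)) (ι m) (1/ι m) (ι n) (1/ι n) ⟩
    (1/ι (m ℕ.* n) * (ι m * ι n)) * (1/ι m * 1/ι n)  ≡⟨ cong (λ z → (1/ι (m ℕ.* n) * z) * (1/ι m * 1/ι n)) (ι-* m n) ⟨
    (1/ι (m ℕ.* n) * ι (m ℕ.* n)) * (1/ι m * 1/ι n)  ≡⟨ cong (_* (1/ι m * 1/ι n)) (1/ι*ι (ℕ.*-mono-≤ 1≤m 1≤n)) ⟩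
    1ℚ * (1/ι m * 1/ι n)  ≡⟨ ℚ.*-identityˡ _ ⟩
    1/ι m * 1/ι n  ∎
    where
    ones : ∀ a → a ≡ a * (1ℚ * 1ℚ)
    ones = solve-∀ ring
    regroup : ∀ a b c d e → a * ((b * c) * (d * e)) ≡ (a * (b * d)) * (c * e)
    regroup = solve-∀ ring

  2*1/ι[2*n] : ∀ {n} → 1 ℕ.≤ n → 2ℚ * 1/ι (2 ℕ.* n) ≡ 1/ι n
  2*1/ι[2*n] {n} 1≤n = begin-equality
    2ℚ * 1/ι (2 ℕ.* n)  ≡⟨ cong (2ℚ *_) (1/ι-* {2} (s≤s z≤n) 1≤n) ⟩
    2ℚ * (1/ι 2 * 1/ι n)  ≡⟨ ℚ.*-assoc 2ℚ (1/ι 2) (1/ι n) ⟨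
    (2ℚ * 1/ι 2) * 1/ι n  ≡⟨ cong (λ z → (z * 1/ι 2) * 1/ι n) ι-2 ⟨
    (ι 2 * 1/ι 2) * 1/ι n  ≡⟨ cong (_* 1/ι n) (ι*1/ι {2} (s≤s z≤n)) ⟩
    1ℚ * 1/ι n  ≡⟨ ℚ.*-identityˡ _ ⟩
    1/ι n  ∎

  3*1/ι[3*n] : ∀ {n} → 1 ℕ.≤ n → 3ℚ * 1/ι (3 ℕ.* n) ≡ 1/ι n
  3*1/ι[3*n] {n} 1≤n = begin-equality
    3ℚ * 1/ι (3 ℕ.* n)  ≡⟨ cong (3ℚ *_) (1/ι-* {3} (s≤s z≤n) 1≤n) ⟩
    3ℚ * (1/ι 3 * 1/ι n)  ≡⟨ ℚ.*-assoc 3ℚ (1/ι 3) (1/ι n) ⟨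
    (3ℚ * 1/ι 3) * 1/ι n  ≡⟨ cong (λ z → (z * 1/ι 3) * 1/ι n) ι-3 ⟨
    (ι 3 * 1/ι 3) * 1/ι n  ≡⟨ cong (_* 1/ι n) (ι*1/ι {3} (s≤s z≤n)) ⟩
    1ℚ * 1/ι n  ≡⟨ ℚ.*-identityˡ _ ⟩
    1/ι n  ∎

  1≤p*ι⇒1/ι≤p : ∀ {p n} → 1 ℕ.≤ n → 1ℚ ≤ p * ι n → 1/ι n ≤ p
  1≤p*ι⇒1/ι≤p {p} {n} 1≤n 1≤pn = begin
    1/ι n  ≡⟨ ℚ.*-identityˡ _ ⟨
    1ℚ * 1/ι n  ≤⟨ *-monoʳ (0≤1/ι n) 1≤pn ⟩
    (p * ι n) * 1/ι n  ≡⟨ ℚ.*-assoc p (ι n) (1/ι n) ⟩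
    p * (ι n * 1/ι n)  ≡⟨ cong (p *_) (ι*1/ι 1≤n) ⟩
    p * 1ℚ  ≡⟨ ℚ.*-identityʳ p ⟩
    p  ∎

  p*ι≤1⇒p≤1/ι : ∀ {p n} → 1 ℕ.≤ n → p * ι n ≤ 1ℚ → p ≤ 1/ι n
  p*ι≤1⇒p≤1/ι {p} {n} 1≤n pn≤1 = begin
    p  ≡⟨ ℚ.*-identityʳ p ⟨
    p * 1ℚ  ≡⟨ cong (p *_) (ι*1/ι 1≤n) ⟨
    p * (ι n * 1/ι n)  ≡⟨ ℚ.*-assoc p (ι n) (1/ι n) ⟨
    (p * ι n) * 1/ι n  ≤⟨ *-monoʳ (0≤1/ι n) pn≤1 ⟩
    1ℚ * 1/ι n  ≡⟨ ℚ.*-identityˡ _ ⟩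
    1/ι n  ∎

  iterate : ∀ {n} → (Fin n → Fin n → ℚ) → ℕ → Vector ℚ n → Vector ℚ n
  iterate A zero    f = f
  iterate A (suc t) f = A · iterate A t f

  iterate-cong : ∀ {n} (A : Fin n → Fin n → ℚ) t {f g : Vector ℚ n} → (∀ u → f u ≡ g u) →
    ∀ u → iterate A t f u ≡ iterate A t g u
  iterate-cong A zero    f≗g u = f≗g u
  iterate-cong A (suc t) f≗g u = ·-cong A (iterate-cong A t f≗g) u

  iterate-combination : ∀ {m n} (A : Fin n → Fin n → ℚ) t (c : Vector ℚ m) (f : Fin m → Vector ℚ n) u →
    iterate A t (λ u → sum λ i → c i * f i u) u ≡ sum λ i → c i * iterate A t (f i) u
  iterate-combination A zero    c f u = refl
  iterate-combination A (suc t) c f u = begin-equality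
    (A · iterate A t (λ u → sum λ i → c i * f i u)) u  ≡⟨ ·-cong A (iterate-combination A t c f) u ⟩
    (A · (λ u → sum λ i → c i * iterate A t (f i) u)) u  ≡⟨ ·-sum A (λ i u → c i * iterate A t (f i) u) u ⟩
    (sum λ i → (A · (λ u → c i * iterate A t (f i) u)) u)  ≡⟨ sum-cong (λ i → ·-* A (c i) (iterate A t (f i)) u) ⟩
    (sum λ i → c i * (A · iterate A t (f i)) u)  ∎

  module _ {n : ℕ} (G : Graph n) (degree≥1 : ∀ u → 1 ℕ.≤ Graph.degree G u) where

    lazy-stochastic : Stochastic (lazy G)
    lazy-stochastic u = begin-equality
      sum (lazy G u)  ≡⟨ sum-cong (λ v → ℚ.*-identityʳ (lazy G u v)) ⟨
      (lazy G · (λ _ → 1ℚ)) u  ≡⟨ lazy-· G (λ _ → 1ℚ) u ⟩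
      ½ * (1ℚ + (walk G · (λ _ → 1ℚ)) u)  ≡⟨ cong (λ z → ½ * (1ℚ + z)) (≡.trans (sum-cong λ v → ℚ.*-identityʳ (walk G u v)) (walk-stochastic G degree≥1 u)) ⟩
      1ℚ  ∎

    lazy-reversible : Reversible (weight G) (lazy G)
    lazy-reversible u v = begin-equality
      weight G u * (½ * (point v u + walk G u v))  ≡⟨ expand (weight G u) (point v u) (walk G u v) ⟩
      ½ * (weight G u * point v u + weight G u * walk G u v)  ≡⟨ cong₂ (λ x z → ½ * (x + z)) (diagonal u v) (walk-reversible G degree≥1 u v) ⟩
      ½ * (weight G v * point u v + weight G v * walk G v u)  ≡⟨ expand (weight G v) (point u v) (walk G v u) ⟨
      weight G v * (½ * (point u v + walk G v u))  ∎
      where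
      expand : ∀ a b c → a * (½ * (b + c)) ≡ ½ * (a * b + a * c)
      expand = solve-∀ ring
      diagonal : ∀ u v → weight G u * point v u ≡ weight G v * point u v
      diagonal u v with u Fin.≟ v
      ... | yes refl = cong (weight G u *_) (≡.sym (point-self u))
      ... | no  u≢v = ≡.trans (ℚ.*-zeroʳ (weight G u)) (≡.sym (≡.trans (cong (weight G v *_) (point-other (u≢v ∘ ≡.sym))) (ℚ.*-zeroʳ (weight G v))))

  HasGap : ∀ {n} → Graph n → ℕ → Set
  HasGap G D = ∀ f → (sum λ u → weight G u * f u) ≡ 0ℚ →
    inner (weight G) f (lazy G · f) ≤ (1ℚ - 1/ι D) * inner (weight G) f f

  module Mixing {n : ℕ} (G : Graph n) (Δ D : ℕ) (1≤n : 1 ℕ.≤ n) (1≤D : 1 ℕ.≤ D)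
    (degree≥1 : ∀ u → 1 ℕ.≤ Graph.degree G u) (degree≤Δ : ∀ u → Graph.degree G u ℕ.≤ Δ)
    (gap : HasGap G D)
    where

    private
      w = weight G
      P = walk G
      L = lazy G
      W = sum w

    1≤Δ : 1 ℕ.≤ Δ
    1≤Δ = vertex 1≤n λ v → ℕ.≤-trans (degree≥1 v) (degree≤Δ v)
      where
      vertex : ∀ {m} {A : Set} → 1 ℕ.≤ m → (Fin m → A) → A
      vertex (s≤s _) f = f zero

    1≤w : ∀ u → 1ℚ ≤ w u
    1≤w u = 1≤ι (degree≥1 u)

    0≤w : ∀ u → 0ℚ ≤ w u
    0≤w u = 0≤ι _

    1≤2D : 1 ℕ.≤ 2 ℕ.* D
    1≤2D = ℕ.*-mono-≤ {1} {2} (s≤s z≤n) 1≤D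

    -- A rational substitute for the square root of `1 - 1/D`: squared norms shrink by
    -- `1 - 1/D ≤ ρ²` per step, hence values by `ρ`.
    y ρ : ℚ
    y = 1/ι (2 ℕ.* D)
    ρ = 1ℚ - y

    0≤y : 0ℚ ≤ y
    0≤y = 0≤1/ι (2 ℕ.* D)

    0≤ρ : 0ℚ ≤ ρ
    0≤ρ = p≤q⇒0≤q-p (1/ι≤1 (2 ℕ.* D))

    1-1/D≤ρ² : 1ℚ - 1/ι D ≤ ρ * ρ
    1-1/D≤ρ² = begin
      1ℚ - 1/ι D  ≡⟨ cong (λ z → 1ℚ - z) (2*1/ι[2*n] 1≤D) ⟨
      1ℚ - 2ℚ * y  ≤⟨ ≤-by (y * y) (square-nonneg y) (expand y) ⟩
      ρ * ρ  ∎
      where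
      expand : ∀ y → (1ℚ - y) * (1ℚ - y) ≡ (1ℚ - 2ℚ * y) + y * y
      expand = solve-∀ ring

    norm-nonneg : ∀ f → 0ℚ ≤ inner w f f
    norm-nonneg f = sum-nonneg λ u → *-nonneg (0≤w u) (square-nonneg (f u))

    -- The two sides differ by the variance of `f` after one step from `u`.
    jensen : ∀ f u → (P · f) u * (P · f) u ≤ (P · (λ v → f v * f v)) u
    jensen f u = ≤-by _ (sum-nonneg λ v → *-nonneg (walk-nonneg G u v) (square-nonneg (f v - m))) variance
      where
      m = (P · f) u
      expand : ∀ p x m → p * ((x - m) * (x - m)) ≡ p * (x * x) + (- (2ℚ * m) * (p * x) + (m * m) * p)
      expand = solve-∀ ring
      collect : ∀ a m → a ≡ m * m + (a + (- (2ℚ * m) * m + (m * m) * 1ℚ))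
      collect = solve-∀ ring
      variance : (P · (λ v → f v * f v)) u ≡ m * m + sum λ v → P u v * ((f v - m) * (f v - m))
      variance = ≡.trans (collect _ m) (cong (m * m +_) (≡.sym (begin-equality
        (sum λ v → P u v * ((f v - m) * (f v - m)))
          ≡⟨ sum-cong (λ v → expand (P u v) (f v) m) ⟩
        (sum λ v → P u v * (f v * f v) + (- (2ℚ * m) * (P u v * f v) + (m * m) * P u v))
          ≡⟨ sum-+ _ _ ⟩
        a + (sum λ v → - (2ℚ * m) * (P u v * f v) + (m * m) * P u v)
          ≡⟨ cong (_+_ a) (sum-+ _ _) ⟩
        a + ((sum λ v → - (2ℚ * m) * (P u v * f v)) + (sum λ v → (m * m) * P u v))
          ≡⟨ cong₂ (λ x z → a + (x + z)) (≡.sym (*-sumˡ (- (2ℚ * m)) _)) (≡.sym (*-sumˡ (m * m) _)) ⟩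
        a + (- (2ℚ * m) * m + (m * m) * sum (P u))
          ≡⟨ cong (λ z → a + (- (2ℚ * m) * m + (m * m) * z)) (walk-stochastic G degree≥1 u) ⟩
        a + (- (2ℚ * m) * m + (m * m) * 1ℚ) ∎)))
        where a = (P · (λ v → f v * f v)) u

    walk-contracts : ∀ f → inner w (P · f) (P · f) ≤ inner w f f
    walk-contracts f = begin
      inner w (P · f) (P · f)  ≤⟨ sum-mono (λ u → *-monoˡ (0≤w u) (jensen f u)) ⟩
      (sum λ u → w u * (P · (λ v → f v * f v)) u)  ≡⟨ sum-preserved {w = w} (walk-reversible G degree≥1) (walk-stochastic G degree≥1) _ ⟩
      inner w f f  ∎

    -- L = (I + P)/2 makes L - L² = (I - P²)/4 positive.
    lazy-positive : ∀ f → inner w (L · f) (L · f) ≤ inner w f (L · f)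
    lazy-positive f = begin
      inner w (L · f) (L · f)
        ≡⟨ sum-cong (λ u → cong (λ z → w u * (z * z)) (lazy-· G f u)) ⟩
      (sum λ u → w u * ((½ * (f u + g u)) * (½ * (f u + g u))))
        ≡⟨ sum-cong (λ u → expand₁ (w u) (f u) (g u)) ⟩
      (sum λ u → ½ * (w u * (f u * g u)) + (½ * ½) * (w u * (f u * f u) + w u * (g u * g u)))
        ≡⟨ combine _ ⟩
      ½ * b + (½ * ½) * (a + inner w g g)
        ≤⟨ ℚ.+-monoʳ-≤ (½ * b) (*-monoˡ 0≤¼ (ℚ.+-monoʳ-≤ a (walk-contracts f))) ⟩
      ½ * b + (½ * ½) * (a + a)
        ≡⟨ combine _ ⟨
      (sum λ u → ½ * (w u * (f u * g u)) + (½ * ½) * (w u * (f u * f u) + w u * (f u * f u)))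
        ≡⟨ sum-cong (λ u → expand₂ (w u) (f u) (g u)) ⟩
      (sum λ u → w u * (f u * (½ * (f u + g u))))
        ≡⟨ sum-cong (λ u → cong (λ z → w u * (f u * z)) (lazy-· G f u)) ⟨
      inner w f (L · f) ∎
      where
      g = P · f
      a = inner w f f
      b = inner w f g
      0≤¼ : 0ℚ ≤ ½ * ½
      0≤¼ = ℚ.<⇒≤ (ℚ.positive⁻¹ (½ * ½))
      expand₁ : ∀ w f g → w * ((½ * (f + g)) * (½ * (f + g))) ≡ ½ * (w * (f * g)) + (½ * ½) * (w * (f * f) + w * (g * g))
      expand₁ = solve-∀ ring
      expand₂ : ∀ w f g → ½ * (w * (f * g)) + (½ * ½) * (w * (f * f) + w * (f * f)) ≡ w * (f * (½ * (f + g)))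
      expand₂ = solve-∀ ring
      combine : ∀ (h : Vector ℚ n) → (sum λ u → ½ * (w u * (f u * g u)) + (½ * ½) * (w u * (f u * f u) + h u))
        ≡ ½ * b + (½ * ½) * (a + sum h)
      combine h = ≡.trans (sum-+ _ _) (cong₂ _+_ (≡.sym (*-sumˡ ½ _)) (≡.trans (≡.sym (*-sumˡ (½ * ½) _)) (cong ((½ * ½) *_) (sum-+ _ h))))

    Centred : Vector ℚ n → Set
    Centred f = (sum λ u → w u * f u) ≡ 0ℚ

    iterate-centred : ∀ t {f} → Centred f → Centred (iterate L t f)
    iterate-centred zero    f-centred = f-centred
    iterate-centred (suc t) f-centred = ≡.trans (sum-preserved {w = w} (lazy-reversible G degree≥1) (lazy-stochastic G degree≥1) _) (iterate-centred t f-centred)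

    -- The gap controls only the quadratic form of `L`, not the norm of `L g`; `lazy-positive`
    -- passes from the one to the other, which negative eigenvalues could prevent.
    norm-decay : ∀ t {f} → Centred f → inner w (iterate L t f) (iterate L t f) ≤ (ρ ^ t * ρ ^ t) * inner w f f
    norm-decay zero    {f} f-centred = ℚ.≤-reflexive (≡.sym (≡.trans (cong (_* inner w f f) (ℚ.*-identityˡ 1ℚ)) (ℚ.*-identityˡ _)))
    norm-decay (suc t) {f} f-centred = begin
      inner w (L · g) (L · g)  ≤⟨ lazy-positive g ⟩
      inner w g (L · g)  ≤⟨ gap g (iterate-centred t f-centred) ⟩
      (1ℚ - 1/ι D) * inner w g g  ≤⟨ *-mono (*-nonneg 0≤ρ 0≤ρ) (norm-nonneg g) 1-1/D≤ρ² (norm-decay t f-centred) ⟩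
      (ρ * ρ) * ((ρ ^ t * ρ ^ t) * inner w f f)  ≡⟨ regroup ρ (ρ ^ t) (inner w f f) ⟩
      ((ρ * ρ ^ t) * (ρ * ρ ^ t)) * inner w f f  ∎
      where
      g = iterate L t f
      regroup : ∀ r q a → (r * r) * ((q * q) * a) ≡ ((r * q) * (r * q)) * a
      regroup = solve-∀ ring

    square≤norm : ∀ f u → f u * f u ≤ inner w f f
    square≤norm f u = begin
      f u * f u  ≡⟨ ℚ.*-identityˡ _ ⟨
      1ℚ * (f u * f u)  ≤⟨ *-monoʳ (square-nonneg (f u)) (1≤w u) ⟩
      w u * (f u * f u)  ≤⟨ term≤sum (λ v → *-nonneg (0≤w v) (square-nonneg (f v))) u ⟩
      inner w f f  ∎

    ιn≤W : ι n ≤ W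
    ιn≤W = begin
      ι n  ≡⟨ ℚ.*-identityʳ (ι n) ⟨
      ι n * 1ℚ  ≡⟨ sum-const {n} 1ℚ ⟨
      sum {n} (λ _ → 1ℚ)  ≤⟨ sum-mono 1≤w ⟩
      W  ∎

    W≤Δn : W ≤ ι (Δ ℕ.* n)
    W≤Δn = begin
      W  ≤⟨ sum-mono (λ u → ι-mono (degree≤Δ u)) ⟩
      sum {n} (λ _ → ι Δ)  ≡⟨ sum-const {n} (ι Δ) ⟩
      ι n * ι Δ  ≡⟨ ℚ.*-comm (ι n) (ι Δ) ⟩
      ι Δ * ι n  ≡⟨ ι-* Δ n ⟨
      ι (Δ ℕ.* n)  ∎

    1≤Δn : 1 ℕ.≤ Δ ℕ.* n
    1≤Δn = ℕ.*-mono-≤ 1≤Δ 1≤n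

    W-inverse = inverse (ℚ.<-≤-trans (ℚ.<-≤-trans 0<1 (1≤ι 1≤n)) ιn≤W)

    W⁻¹ : ℚ
    W⁻¹ = proj₁ W-inverse

    W*W⁻¹ : W * W⁻¹ ≡ 1ℚ
    W*W⁻¹ = proj₂ (proj₂ W-inverse)

    π : Vector ℚ n
    π v = w v * W⁻¹

    0≤π : ∀ v → 0ℚ ≤ π v
    0≤π v = *-nonneg (0≤w v) (ℚ.<⇒≤ (proj₁ (proj₂ W-inverse)))

    1/Δn≤π : ∀ v → 1/ι (Δ ℕ.* n) ≤ π v
    1/Δn≤π v = 1≤p*ι⇒1/ι≤p 1≤Δn (begin
      1ℚ  ≡⟨ W*W⁻¹ ⟨
      W * W⁻¹  ≡⟨ ℚ.*-comm W W⁻¹ ⟩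
      W⁻¹ * W  ≤⟨ *-mono (0≤π v) (ℚ.≤-trans (0≤ι n) ιn≤W) W⁻¹≤π W≤Δn ⟩
      π v * ι (Δ ℕ.* n)  ∎)
      where
      W⁻¹≤π : W⁻¹ ≤ π v
      W⁻¹≤π = subst (_≤ π v) (ℚ.*-identityˡ W⁻¹) (*-monoʳ (ℚ.<⇒≤ (proj₁ (proj₂ W-inverse))) (1≤w v))

    -- As a function of `u`, `iterate L t (point v) u` is the `t`-step probability of the lazy walk
    -- from `u` to `v`. Subtracting the stationary value `π v` leaves a function of mean 0, to which
    -- the gap applies.
    deviation : Fin n → Vector ℚ n
    deviation v u = point v u - π v

    deviation-centred : ∀ v → Centred (deviation v)
    deviation-centred v = begin-equality
      (sum λ u → w u * (point v u - π v))  ≡⟨ sum-cong (λ u → expand (w u) (point v u) (π v)) ⟩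
      (sum λ u → w u * point v u + - π v * w u)  ≡⟨ sum-+ _ _ ⟩
      (sum λ u → w u * point v u) + (sum λ u → - π v * w u)  ≡⟨ cong₂ _+_ (sum-point w v) (≡.sym (*-sumˡ (- π v) w)) ⟩
      w v + - (w v * W⁻¹) * W  ≡⟨ regroup (w v) W⁻¹ W ⟩
      w v - w v * (W * W⁻¹)  ≡⟨ cong (λ z → w v - w v * z) W*W⁻¹ ⟩
      w v - w v * 1ℚ  ≡⟨ cancel (w v) ⟩
      0ℚ  ∎
      where
      expand : ∀ w p q → w * (p - q) ≡ w * p + - q * w
      expand = solve-∀ ring
      regroup : ∀ a i b → a + - (a * i) * b ≡ a - a * (b * i)
      regroup = solve-∀ ring
      cancel : ∀ a → a - a * 1ℚ ≡ 0ℚ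
      cancel = solve-∀ ring

    deviation-norm : ∀ v → inner w (deviation v) (deviation v) ≤ ι Δ
    deviation-norm v = begin
      inner w d d  ≡⟨ sum-cong (λ u → expand (w u) (d u) (point v u) (π v)) ⟩
      (sum λ u → (w u * d u) * point v u + - π v * (w u * d u))  ≡⟨ sum-+ _ _ ⟩
      (sum λ u → (w u * d u) * point v u) + (sum λ u → - π v * (w u * d u)) ≡⟨ cong₂ _+_ (sum-point (λ u → w u * d u) v) (≡.sym (*-sumˡ (- π v) _)) ⟩
      w v * d v + - π v * (sum λ u → w u * d u)  ≡⟨ cong (λ z → w v * d v + - π v * z) (deviation-centred v) ⟩
      w v * d v + - π v * 0ℚ  ≡⟨ simplify (w v * d v) (π v) ⟩
      w v * (point v v - π v)  ≡⟨ cong (λ z → w v * (z - π v)) (point-self v) ⟩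
      w v * (1ℚ - π v)  ≤⟨ ≤-by (w v * π v) (*-nonneg (0≤w v) (0≤π v)) (complete (w v) (π v)) ⟩
      w v  ≤⟨ ι-mono (degree≤Δ v) ⟩
      ι Δ  ∎
      where
      d = deviation v
      expand : ∀ w d p q → w * (d * (p - q)) ≡ (w * d) * p + - q * (w * d)
      expand = solve-∀ ring
      simplify : ∀ a q → a + - q * 0ℚ ≡ a
      simplify = solve-∀ ring
      complete : ∀ w p → w ≡ w * (1ℚ - p) + w * p
      complete = solve-∀ ring

    decay-square : ∀ t v u → let x = iterate L t (deviation v) u in x * x ≤ (ι Δ * ρ ^ t) * (ι Δ * ρ ^ t)
    decay-square t v u = begin
      iterate L t (deviation v) u * iterate L t (deviation v) u  ≤⟨ square≤norm (iterate L t (deviation v)) u ⟩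
      inner w (iterate L t (deviation v)) (iterate L t (deviation v)) ≤⟨ norm-decay t (deviation-centred v) ⟩
      (ρ ^ t * ρ ^ t) * inner w (deviation v) (deviation v)  ≤⟨ *-monoˡ 0≤ρ²ᵗ (deviation-norm v) ⟩
      (ρ ^ t * ρ ^ t) * ι Δ  ≡⟨ cong ((ρ ^ t * ρ ^ t) *_) (ℚ.*-identityˡ (ι Δ)) ⟨
      -- Weakening `Δ` to `Δ²` makes the bound a perfect square, so that the root can be taken in
      -- `ℚ`.
      (ρ ^ t * ρ ^ t) * (1ℚ * ι Δ)  ≤⟨ *-monoˡ 0≤ρ²ᵗ (*-monoʳ (0≤ι Δ) (1≤ι 1≤Δ)) ⟩
      (ρ ^ t * ρ ^ t) * (ι Δ * ι Δ)  ≡⟨ regroup (ρ ^ t) (ι Δ) ⟩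
      (ι Δ * ρ ^ t) * (ι Δ * ρ ^ t)  ∎
      where
      0≤ρ²ᵗ : 0ℚ ≤ ρ ^ t * ρ ^ t
      0≤ρ²ᵗ = *-nonneg (^-nonneg t 0≤ρ) (^-nonneg t 0≤ρ)
      regroup : ∀ q d → (q * q) * (d * d) ≡ (d * q) * (d * q)
      regroup = solve-∀ ring

    decay-≤ : ∀ t v u → iterate L t (deviation v) u ≤ ι Δ * ρ ^ t
    decay-≤ t v u = square-cancel-≤ (*-nonneg (0≤ι Δ) (^-nonneg t 0≤ρ)) (decay-square t v u)

    decay-≥ : ∀ t v u → - iterate L t (deviation v) u ≤ ι Δ * ρ ^ t
    decay-≥ t v u = square-cancel-≤ (*-nonneg (0≤ι Δ) (^-nonneg t 0≤ρ))
      (subst (_≤ (ι Δ * ρ ^ t) * (ι Δ * ρ ^ t)) (neg-square (iterate L t (deviation v) u)) (decay-square t v u))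
      where
      neg-square : ∀ x → x * x ≡ - x * - x
      neg-square = solve-∀ ring

    lazy-const : ∀ c u → (L · (λ _ → c)) u ≡ c
    lazy-const = ·-const (lazy-stochastic G degree≥1)

    iterate-point : ∀ t v u → iterate L t (point v) u ≡ iterate L t (deviation v) u + π v
    iterate-point zero    v u = restore (point v u) (π v)
      where
      restore : ∀ p q → p ≡ (p - q) + q
      restore = solve-∀ ring
    iterate-point (suc t) v u = begin-equality
      (L · iterate L t (point v)) u  ≡⟨ ·-cong L (iterate-point t v) u ⟩
      (L · (λ u → iterate L t (deviation v) u + π v)) u  ≡⟨ ·-+ L _ (λ _ → π v) u ⟩
      (L · iterate L t (deviation v)) u + (L · (λ _ → π v)) u  ≡⟨ cong (_+_ ((L · iterate L t (deviation v)) u)) (lazy-const (π v) u) ⟩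
      (L · iterate L t (deviation v)) u + π v  ∎

    module Horizon (J : ℕ) (J-large : 2 ℕ.* (Δ ℕ.* Δ ℕ.* n) ℕ.≤ 2 ℕ.^ J) where

      -- Every `2 * D` steps at least halve the power of `ρ`, and `T` allows `J` halvings. `1/X` is
      -- half of the lower bound `1/(Δ n)` for `π`; the other half pays for the mixing error. `1/Q`
      -- is the drift of `ψ` under the simple walk, namely `c/(Δ n)`.
      T X Q : ℕ
      T = 2 ℕ.* D ℕ.* J
      X = 2 ℕ.* (Δ ℕ.* n)
      Q = 2 ℕ.* D ℕ.* Δ ℕ.* (Δ ℕ.* n)

      1≤X : 1 ℕ.≤ X
      1≤X = ℕ.*-mono-≤ {1} {2} (s≤s z≤n) 1≤Δn

      1≤Q : 1 ℕ.≤ Q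
      1≤Q = ℕ.*-mono-≤ (ℕ.*-mono-≤ 1≤2D 1≤Δ) 1≤Δn

      error≤1/X : ι Δ * ρ ^ T ≤ 1/ι X
      error≤1/X = p*ι≤1⇒p≤1/ι 1≤X (begin
        (ι Δ * ρ ^ T) * ι X  ≡⟨ regroup (ι Δ) (ρ ^ T) (ι X) ⟩
        (ι Δ * ι X) * ρ ^ T  ≡⟨ cong (_* ρ ^ T) (ι-* Δ X) ⟨
        ι (Δ ℕ.* X) * ρ ^ T  ≤⟨ *-monoʳ (^-nonneg T 0≤ρ) (ι-mono ΔX≤2^J) ⟩
        ι (2 ℕ.^ J) * ρ ^ T  ≡⟨ cong (_* ρ ^ T) (≡.trans (ι-^ 2 J) (cong (_^ J) ι-2)) ⟩
        2ℚ ^ J * ρ ^ T  ≤⟨ 2^j*[1-1/n]^nj≤1 J 1≤2D ⟩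
        1ℚ  ∎)
        where
        regroup : ∀ a b c → (a * b) * c ≡ (a * c) * b
        regroup = solve-∀ ring
        ΔX≤2^J : Δ ℕ.* X ℕ.≤ 2 ℕ.^ J
        ΔX≤2^J = ℕ.≤-trans (ℕ.≤-reflexive (rearrange Δ n)) J-large
          where
          rearrange : ∀ Δ n → Δ ℕ.* (2 ℕ.* (Δ ℕ.* n)) ≡ 2 ℕ.* (Δ ℕ.* Δ ℕ.* n)
          rearrange = ℕ-solve-∀

      mixed : ∀ u v → 1/ι X ≤ iterate L T (point v) u
      mixed u v = begin
        1/ι X  ≡⟨ split (1/ι X) ⟩
        2ℚ * 1/ι X - 1/ι X  ≡⟨ cong (_- 1/ι X) (2*1/ι[2*n] 1≤Δn) ⟩
        1/ι (Δ ℕ.* n) - 1/ι X  ≤⟨ ℚ.+-mono-≤ (1/Δn≤π v) (neg-≤ (ℚ.≤-trans (decay-≥ T v u) error≤1/X)) ⟩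
        π v + iterate L T (deviation v) u  ≡⟨ ℚ.+-comm (π v) _ ⟩
        iterate L T (deviation v) u + π v  ≡⟨ iterate-point T v u ⟨
        iterate L T (point v) u  ∎
        where
        split : ∀ a → a ≡ 2ℚ * a - a
        split = solve-∀ ring

      green : ℕ → Fin n → Vector ℚ n
      green zero    v u = 0ℚ
      green (suc t) v u = green t v u + iterate L t (deviation v) u

      -- Applying `L` shifts the sum of iterates by one, so that only the two end terms survive the
      -- subtraction.
      lazy-green : ∀ t v u → (L · green t v) u ≡ green t v u + (iterate L t (deviation v) u - deviation v u)
      lazy-green zero v u = ≡.trans (lazy-const 0ℚ u) (cancel (deviation v u))
        where
        cancel : ∀ d → 0ℚ ≡ 0ℚ + (d - d)
        cancel = solve-∀ ring
      lazy-green (suc t) v u = begin-equality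
        (L · green (suc t) v) u  ≡⟨ ·-+ L (green t v) (iterate L t (deviation v)) u ⟩
        (L · green t v) u + l′  ≡⟨ cong (_+ l′) (lazy-green t v u) ⟩
        (green t v u + (iterate L t (deviation v) u - d)) + l′  ≡⟨ regroup (green t v u) (iterate L t (deviation v) u) d l′ ⟩
        (green t v u + iterate L t (deviation v) u) + (l′ - d)  ∎
        where
        l′ = (L · iterate L t (deviation v)) u
        d = deviation v u
        regroup : ∀ g l d l′ → (g + (l - d)) + l′ ≡ (g + l) + (l′ - d)
        regroup = solve-∀ ring

      -- A geometric series, with `y = 1 - ρ` multiplied out instead of divided by. Allowing any
      -- `partial` with increments `a` covers both `green` and its negative.
      geometric : ∀ t (a : ℕ → ℚ) → (∀ s → a s ≤ ι Δ * ρ ^ s) → (partial : ℕ → ℚ) →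
        partial 0 ≡ 0ℚ → (∀ s → partial (suc s) ≡ partial s + a s) → y * partial t ≤ ι Δ * (1ℚ - ρ ^ t)
      geometric zero    a a≤ partial base step = ℚ.≤-reflexive (≡.trans (cong (y *_) base) (zeros y (ι Δ)))
        where
        zeros : ∀ y d → y * 0ℚ ≡ d * (1ℚ - 1ℚ)
        zeros = solve-∀ ring
      geometric (suc t) a a≤ partial base step = begin
        y * partial (suc t)  ≡⟨ cong (y *_) (step t) ⟩
        y * (partial t + a t)  ≡⟨ ℚ.*-distribˡ-+ y (partial t) (a t) ⟩
        y * partial t + y * a t  ≤⟨ ℚ.+-mono-≤ (geometric t a a≤ partial base step) (*-monoˡ 0≤y (a≤ t)) ⟩
        ι Δ * (1ℚ - ρ ^ t) + y * (ι Δ * ρ ^ t)  ≡⟨ regroup (ι Δ) (ρ ^ t) y ⟩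
        ι Δ * (1ℚ - (1ℚ - y) * ρ ^ t)  ∎
        where
        regroup : ∀ d q y → d * (1ℚ - q) + y * (d * q) ≡ d * (1ℚ - (1ℚ - y) * q)
        regroup = solve-∀ ring

      Δ[1-ρ^t]≤Δ : ∀ t → ι Δ * (1ℚ - ρ ^ t) ≤ ι Δ
      Δ[1-ρ^t]≤Δ t = ≤-by (ι Δ * ρ ^ t) (*-nonneg (0≤ι Δ) (^-nonneg t 0≤ρ)) (complete (ι Δ) (ρ ^ t))
        where
        complete : ∀ d q → d ≡ d * (1ℚ - q) + d * q
        complete = solve-∀ ring

      green-≤ : ∀ v u → y * green T v u ≤ ι Δ
      green-≤ v u = ℚ.≤-trans
        (geometric T (λ t → iterate L t (deviation v) u) (λ t → decay-≤ t v u) (λ t → green t v u) refl (λ _ → refl))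
        (Δ[1-ρ^t]≤Δ T)

      green-≥ : ∀ v u → y * - green T v u ≤ ι Δ
      green-≥ v u = ℚ.≤-trans
        (geometric T (λ t → - iterate L t (deviation v) u) (λ t → decay-≥ t v u) (λ t → - green t v u) refl
          (λ t → ℚ.neg-distrib-+ (green t v u) (iterate L t (deviation v) u)))
        (Δ[1-ρ^t]≤Δ T)

      c : ℚ
      c = 1/ι Δ * y

      0≤c : 0ℚ ≤ c
      0≤c = *-nonneg (0≤1/ι Δ) 0≤y

      scaled≤1 : ∀ g → y * g ≤ ι Δ → c * g ≤ 1ℚ
      scaled≤1 g yg≤Δ = begin
        (1/ι Δ * y) * g  ≡⟨ ℚ.*-assoc (1/ι Δ) y g ⟩
        1/ι Δ * (y * g)  ≤⟨ *-monoˡ (0≤1/ι Δ) yg≤Δ ⟩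
        1/ι Δ * ι Δ  ≡⟨ 1/ι*ι 1≤Δ ⟩
        1ℚ  ∎

      -- Up to scaling and an additive constant, minus the truncated Green function is the
      -- expected time to reach v.
      ψ : Fin n → Vector ℚ n
      ψ v u = 2ℚ + - c * green T v u

      1≤ψ : ∀ v u → 1ℚ ≤ ψ v u
      1≤ψ v u = ≤-by _ (p≤q⇒0≤q-p (scaled≤1 (green T v u) (green-≤ v u))) (complete c (green T v u))
        where
        complete : ∀ c g → 2ℚ + - c * g ≡ 1ℚ + (1ℚ - c * g)
        complete = solve-∀ ring

      ψ≤3 : ∀ v u → ψ v u ≤ 3ℚ
      ψ≤3 v u = ≤-by _ (p≤q⇒0≤q-p (scaled≤1 (- green T v u) (green-≥ v u))) (complete c (green T v u))
        where
        complete : ∀ c g → 3ℚ ≡ (2ℚ + - c * g) + (1ℚ - c * - g)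
        complete = solve-∀ ring

      -- Away from `v` the deviation is `- π v`, so the telescoped sum leaves exactly the lazy
      -- `T`-step probability from `u` to `v`, which `mixed` bounds below.
      lazy-ψ : ∀ {u v} → u ≢ v → (L · ψ v) u ≤ ψ v u - c * 1/ι X
      lazy-ψ {u} {v} u≢v = begin
        (L · ψ v) u  ≡⟨ ·-+ L (λ _ → 2ℚ) (λ u → - c * green T v u) u ⟩
        (L · (λ _ → 2ℚ)) u + (L · (λ u → - c * green T v u)) u  ≡⟨ cong₂ _+_ (lazy-const 2ℚ u) (·-* L (- c) (green T v) u) ⟩
        2ℚ + - c * (L · green T v) u  ≡⟨ cong (λ z → 2ℚ + - c * z) (lazy-green T v u) ⟩
        2ℚ + - c * (green T v u + (l - (point v u - π v)))  ≡⟨ cong (λ z → 2ℚ + - c * (green T v u + (l - (z - π v)))) (point-other u≢v) ⟩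
        2ℚ + - c * (green T v u + (l - (0ℚ - π v)))  ≡⟨ regroup c (green T v u) l (π v) ⟩
        ψ v u - c * (l + π v)  ≡⟨ cong (λ z → ψ v u - c * z) (iterate-point T v u) ⟨
        ψ v u - c * iterate L T (point v) u  ≤⟨ ℚ.+-monoʳ-≤ (ψ v u) (ℚ.neg-antimono-≤ (*-monoˡ 0≤c (mixed u v))) ⟩
        ψ v u - c * 1/ι X  ∎
        where
        l = iterate L T (deviation v) u
        regroup : ∀ c g l p → 2ℚ + - c * (g + (l - (0ℚ - p))) ≡ (2ℚ + - c * g) - c * (l + p)
        regroup = solve-∀ ring

      -- Since `P = 2 L - I`, the drift doubles to `1/Q`. As `ψ ≤ 3`, an additive decrease of `1/Q`
      -- is a multiplicative one at rate `1/(3 Q)`, which can be iterated.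
      walk-ψ : ∀ {u v} → u ≢ v → (P · ψ v) u ≤ (1ℚ - 1/ι (3 ℕ.* Q)) * ψ v u
      walk-ψ {u} {v} u≢v = begin
        (P · ψ v) u  ≡⟨ recover (ψ v u) ((P · ψ v) u) ⟩
        2ℚ * (½ * (ψ v u + (P · ψ v) u)) - ψ v u  ≡⟨ cong (λ z → 2ℚ * z - ψ v u) (lazy-· G (ψ v) u) ⟨
        2ℚ * (L · ψ v) u - ψ v u  ≤⟨ ℚ.+-monoˡ-≤ (- ψ v u) (*-monoˡ (+-nonneg 0≤1 0≤1) (lazy-ψ u≢v)) ⟩
        2ℚ * (ψ v u - c * 1/ι X) - ψ v u  ≡⟨ regroup (ψ v u) c (1/ι X) ⟩
        ψ v u - c * (2ℚ * 1/ι X)  ≡⟨ cong (λ z → ψ v u - c * z) (2*1/ι[2*n] 1≤Δn) ⟩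
        ψ v u - c * 1/ι (Δ ℕ.* n)  ≡⟨ cong (λ z → ψ v u - z) drift ⟩
        ψ v u - 3ℚ * 1/ι (3 ℕ.* Q)  ≤⟨ ℚ.+-monoʳ-≤ (ψ v u) (ℚ.neg-antimono-≤ (*-monoʳ (0≤1/ι (3 ℕ.* Q)) (ψ≤3 v u))) ⟩
        ψ v u - ψ v u * 1/ι (3 ℕ.* Q)  ≡⟨ factor (ψ v u) (1/ι (3 ℕ.* Q)) ⟩
        (1ℚ - 1/ι (3 ℕ.* Q)) * ψ v u  ∎
        where
        recover : ∀ a b → b ≡ 2ℚ * (½ * (a + b)) - a
        recover = solve-∀ ring
        regroup : ∀ a c x → 2ℚ * (a - c * x) - a ≡ a - c * (2ℚ * x)
        regroup = solve-∀ ring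
        factor : ∀ a t → a - a * t ≡ (1ℚ - t) * a
        factor = solve-∀ ring
        drift : c * 1/ι (Δ ℕ.* n) ≡ 3ℚ * 1/ι (3 ℕ.* Q)
        drift = begin-equality
          (1/ι Δ * y) * 1/ι (Δ ℕ.* n)  ≡⟨ cong (_* 1/ι (Δ ℕ.* n)) (ℚ.*-comm (1/ι Δ) y) ⟩
          (y * 1/ι Δ) * 1/ι (Δ ℕ.* n)  ≡⟨ cong (_* 1/ι (Δ ℕ.* n)) (1/ι-* 1≤2D 1≤Δ) ⟨
          1/ι (2 ℕ.* D ℕ.* Δ) * 1/ι (Δ ℕ.* n)  ≡⟨ 1/ι-* (ℕ.*-mono-≤ 1≤2D 1≤Δ) 1≤Δn ⟨
          1/ι Q  ≡⟨ 3*1/ι[3*n] 1≤Q ⟨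
          3ℚ * 1/ι (3 ℕ.* Q)  ∎

  -- Hitting probabilities

  count : ∀ {n} → (Fin n → Bool) → ℕ
  count {zero}  S = 0
  count {suc n} S = (if S zero then 1 else 0) ℕ.+ count (λ i → S (suc i))

  ⟦_⟧ : Bool → ℚ
  ⟦ b ⟧ = if b then 1ℚ else 0ℚ

  0≤⟦_⟧ : ∀ b → 0ℚ ≤ ⟦ b ⟧
  0≤⟦ true ⟧  = 0≤1
  0≤⟦ false ⟧ = ℚ.≤-refl

  ⟦_⟧≤1 : ∀ b → ⟦ b ⟧ ≤ 1ℚ
  ⟦ true ⟧≤1  = ℚ.≤-refl
  ⟦ false ⟧≤1 = 0≤1

  ι-count : ∀ {n} (S : Fin n → Bool) → ι (count S) ≡ sum λ v → ⟦ S v ⟧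
  ι-count {zero}  S = ≡.trans ι-0 (≡.sym (sum-[] _))
  ι-count {suc n} S = begin-equality
    ι ((if S zero then 1 else 0) ℕ.+ count (λ i → S (suc i)))  ≡⟨ ι-+ _ (count (λ i → S (suc i))) ⟩
    ι (if S zero then 1 else 0) + ι (count (λ i → S (suc i)))  ≡⟨ cong₂ _+_ (ι-if (S zero)) (ι-count (λ i → S (suc i))) ⟩
    ⟦ S zero ⟧ + (sum λ i → ⟦ S (suc i) ⟧)  ≡⟨ sum-suc (λ i → ⟦ S i ⟧) ⟨
    (sum λ v → ⟦ S v ⟧)  ∎
    where
    ι-if : ∀ b → ι (if b then 1 else 0) ≡ ⟦ b ⟧
    ι-if true  = ι-1
    ι-if false = ι-0

  count-cong : ∀ {n} {S S′ : Fin n → Bool} → (∀ v → S v ≡ S′ v) → count S ≡ count S′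
  count-cong {zero}  S≗S′ = refl
  count-cong {suc n} S≗S′ = cong₂ ℕ._+_ (cong (λ b → if b then 1 else 0) (S≗S′ zero)) (count-cong λ i → S≗S′ (suc i))

  count≡0⇒false : ∀ {n} {S : Fin n → Bool} → count S ≡ 0 → ∀ v → S v ≡ false
  count≡0⇒false {suc n} {S} count≡0 zero with S zero | count≡0
  ... | false | _ = refl
  ... | true  | ()
  count≡0⇒false {suc n} {S} count≡0 (suc v) = count≡0⇒false (ℕ.m+n≡0⇒n≡0 (if S zero then 1 else 0) count≡0) v

  remove : ∀ {n} → Fin n → (Fin n → Bool) → Fin n → Bool
  remove v S u = if does (u Fin.≟ v) then false else S u

  remove-self : ∀ {n} v (S : Fin n → Bool) → remove v S v ≡ false
  remove-self v S with v Fin.≟ v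
  ... | yes _   = refl
  ... | no  v≢v = contradiction refl v≢v

  count-remove : ∀ {n} v (S : Fin n → Bool) → S v ≡ true → count S ≡ suc (count (remove v S))
  count-remove {suc n} zero S Sv≡true rewrite Sv≡true = refl
  count-remove {suc n} (suc v) S Sv≡true = ≡.trans
    (cong ((if S zero then 1 else 0) ℕ.+_) (count-remove v (λ i → S (suc i)) Sv≡true))
    (≡.trans (ℕ.+-suc (if S zero then 1 else 0) _)
      (cong (λ c → suc ((if S zero then 1 else 0) ℕ.+ c)) (count-cong λ u → shift u)))
    where
    shift : ∀ u → remove v (λ i → S (suc i)) u ≡ remove (suc v) S (suc u)
    shift u with u Fin.≟ v
    ... | yes _ = refl
    ... | no  _ = refl

  -- Literally S when v ∉ S, so that the value functions of S need not be compared with those of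
  -- an extensionally equal set.
  visit : ∀ {n} → Fin n → (Fin n → Bool) → Fin n → Bool
  visit v S = if S v then remove v S else S

  visit-old : ∀ {n} v (S : Fin n → Bool) → S v ≡ false → visit v S ≡ S
  visit-old v S Sv≡false rewrite Sv≡false = refl

  visit-self : ∀ {n} v (S : Fin n → Bool) → visit v S v ≡ false
  visit-self v S with S v in eq
  ... | true  = remove-self v S
  ... | false = eq

  visit-⊆ : ∀ {n} v (S : Fin n → Bool) u → ⟦ visit v S u ⟧ ≤ ⟦ S u ⟧
  visit-⊆ v S u with S v
  ... | false = ℚ.≤-refl
  ... | true with u Fin.≟ v
  ...   | yes _ = 0≤⟦ S u ⟧
  ...   | no  _ = ℚ.≤-refl

  unvisited : ∀ {n} → List (Fin n) → Fin n → Bool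
  unvisited []       = λ _ → true
  unvisited (v ∷ vs) = visit v (unvisited vs)

  unvisited-false : ∀ {n} (vs : List (Fin n)) w → unvisited vs w ≡ false → w ∈ vs
  unvisited-false (v ∷ vs) w w-visited with unvisited vs v
  ... | false = there (unvisited-false vs w w-visited)
  ... | true with w Fin.≟ v
  ...   | yes w≡v = here w≡v
  ...   | no  _   = there (unvisited-false vs w w-visited)

  module _ {n : ℕ} {A : Fin n → Fin n → ℚ} (0≤A : ∀ u v → 0ℚ ≤ A u v) where

    ·-mono : ∀ {f g} → (∀ v → f v ≤ g v) → ∀ u → (A · f) u ≤ (A · g) u
    ·-mono f≤g u = sum-mono λ v → *-monoˡ (0≤A u v) (f≤g v)

    ·-nonneg : ∀ {f} → (∀ v → 0ℚ ≤ f v) → ∀ u → 0ℚ ≤ (A · f) u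
    ·-nonneg 0≤f u = sum-nonneg λ v → *-nonneg (0≤A u v) (0≤f v)

  module Hitting {n : ℕ} (G : Graph n) (degree≥1 : ∀ u → 1 ℕ.≤ Graph.degree G u) where

    open Graph G

    private
      P = walk G
      P-nonneg = walk-nonneg G
      P-stochastic = walk-stochastic G degree≥1

    hit : (Fin n → Bool) → ℕ → Vector ℚ n
    hit S zero    u = ⟦ S u ⟧
    hit S (suc r) u = if S u then 1ℚ else (P · hit S r) u

    hit-nonneg : ∀ S r u → 0ℚ ≤ hit S r u
    hit-nonneg S zero    u = 0≤⟦ S u ⟧
    hit-nonneg S (suc r) u with S u
    ... | true  = 0≤1
    ... | false = ·-nonneg P-nonneg (hit-nonneg S r) u

    hit≤1 : ∀ S r u → hit S r u ≤ 1ℚ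
    hit≤1 S zero    u = ⟦ S u ⟧≤1
    hit≤1 S (suc r) u with S u
    ... | true  = ℚ.≤-refl
    ... | false = subst ((P · hit S r) u ≤_) (·-const P-stochastic 1ℚ u) (·-mono P-nonneg (hit≤1 S r) u)

    hit-suc : ∀ S r u → hit S r u ≤ hit S (suc r) u
    hit-suc S zero    u with S u
    ... | true  = ℚ.≤-refl
    ... | false = ·-nonneg P-nonneg (hit-nonneg S 0) u
    hit-suc S (suc r) u with S u
    ... | true  = ℚ.≤-refl
    ... | false = ·-mono P-nonneg (hit-suc S r) u

    lazy-nonneg : ∀ u v → 0ℚ ≤ lazy G u v
    lazy-nonneg u v = *-nonneg (ℚ.<⇒≤ (ℚ.positive⁻¹ ½)) (+-nonneg (0≤indicator (u Fin.≟ v)) (P-nonneg u v))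

    -- Among `r` lazy steps at most `r` are moves, so a lazy walk that is in `S` at time `r` comes
    -- from a simple walk that has met `S` by then. In the induction, a step on which the walk stays
    -- put is absorbed by the monotonicity of `hit` in `r`.
    lazy-hit-≤ : ∀ S r u → iterate (lazy G) r (λ v → ⟦ S v ⟧) u ≤ hit S r u
    lazy-hit-≤ S zero    u = ℚ.≤-refl
    lazy-hit-≤ S (suc r) u = begin
      (lazy G · iterate (lazy G) r (λ v → ⟦ S v ⟧)) u  ≤⟨ ·-mono lazy-nonneg (lazy-hit-≤ S r) u ⟩
      (lazy G · hit S r) u  ≡⟨ lazy-· G (hit S r) u ⟩
      ½ * (hit S r u + (P · hit S r) u)  ≤⟨ average ⟩
      hit S (suc r) u  ∎
      where
      0≤½ : 0ℚ ≤ ½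
      0≤½ = ℚ.<⇒≤ (ℚ.positive⁻¹ ½)
      halves : ∀ a → ½ * (a + a) ≡ a
      halves = solve-∀ ring
      average : ½ * (hit S r u + (P · hit S r) u) ≤ hit S (suc r) u
      average with S u | hit-suc S r u
      ... | true  | _ = subst (½ * (hit S r u + (P · hit S r) u) ≤_) (halves 1ℚ)
                          (*-monoˡ 0≤½ (ℚ.+-mono-≤ (hit≤1 S r u) (subst ((P · hit S r) u ≤_) (·-const P-stochastic 1ℚ u) (·-mono P-nonneg (hit≤1 S r) u))))
      ... | false | increasing = subst (½ * (hit S r u + (P · hit S r) u) ≤_) (halves _)
                          (*-monoˡ 0≤½ (ℚ.+-monoˡ-≤ _ increasing))

    neighbours : Fin n → List (Fin n)
    neighbours u = filter (u ~?_) (allFin n)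

    open Extrema (DecTotalOrder.totalOrder ℚ.≤-decTotalOrder) using (argmax; argmax-sel; f[⊥]≤f[argmax]; f[xs]≤f[argmax])

    maximiser : Vector ℚ n → Fin n → List (Fin n) → Fin n
    -- A default that never arises, since every vertex has a neighbour.
    maximiser f u []       = u
    maximiser f u (x ∷ xs) = argmax f x xs

    best : Vector ℚ n → Fin n → Fin n
    best f u = maximiser f u (neighbours u)

    best-neighbour : ∀ f u → u ~ best f u
    best-neighbour f u = proj₂ (∈-filter⁻ (u ~?_) {xs = allFin n} (maximiser∈ (neighbours u) (degree≥1 u)))
      where
      maximiser∈ : ∀ xs → 1 ℕ.≤ List.length xs → maximiser f u xs ∈ xs
      maximiser∈ (x ∷ xs) _ with argmax-sel f x xs
      ... | inj₁ ≡x  = here ≡x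
      ... | inj₂ ∈xs = there ∈xs

    best-max : ∀ f {u v} → u ~ v → f v ≤ f (best f u)
    best-max f {u} {v} u~v = maximal (neighbours u) (∈-filter⁺ (u ~?_) (∈-allFin v) u~v)
      where
      maximal : ∀ xs → v ∈ xs → f v ≤ f (maximiser f u xs)
      maximal (x ∷ xs) (here refl) = f[⊥]≤f[argmax] {f = f} x xs
      maximal (x ∷ xs) (there v∈)  = All.lookup (f[xs]≤f[argmax] {f = f} x xs) v∈

    module Boosted (k : ℕ) where

      K : ℕ
      K = suc (suc k)

      greedy : Vector ℚ n → Fin n → Fin n → ℚ
      greedy f u v = (1ℚ - 1/ι K) * P u v + 1/ι K * point (best f u) v

      greedy-nonneg : ∀ f u v → 0ℚ ≤ greedy f u v
      greedy-nonneg f u v = +-nonneg (*-nonneg (p≤q⇒0≤q-p (1/ι≤1 K)) (P-nonneg u v))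
        (*-nonneg (0≤1/ι K) (0≤indicator (v Fin.≟ best f u)))

      greedy-· : ∀ f g u → (greedy f · g) u ≡ (1ℚ - 1/ι K) * (P · g) u + 1/ι K * g (best f u)
      greedy-· f g u = begin-equality
        (sum λ v → ((1ℚ - 1/ι K) * P u v + 1/ι K * point (best f u) v) * g v)
          ≡⟨ sum-cong (λ v → expand (1ℚ - 1/ι K) (P u v) (1/ι K) (point (best f u) v) (g v)) ⟩
        (sum λ v → (1ℚ - 1/ι K) * (P u v * g v) + 1/ι K * (g v * point (best f u) v))
          ≡⟨ sum-+ _ _ ⟩
        (sum λ v → (1ℚ - 1/ι K) * (P u v * g v)) + (sum λ v → 1/ι K * (g v * point (best f u) v))
          ≡⟨ cong₂ _+_ (*-sumˡ (1ℚ - 1/ι K) _) (*-sumˡ (1/ι K) _) ⟨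
        (1ℚ - 1/ι K) * (P · g) u + 1/ι K * (sum λ v → g v * point (best f u) v)
          ≡⟨ cong (λ z → (1ℚ - 1/ι K) * (P · g) u + 1/ι K * z) (sum-point g (best f u)) ⟩
        (1ℚ - 1/ι K) * (P · g) u + 1/ι K * g (best f u) ∎
        where
        expand : ∀ a p b q g → (a * p + b * q) * g ≡ a * (p * g) + b * (g * q)
        expand = solve-∀ ring

      greedy-stochastic : ∀ f → Stochastic (greedy f)
      greedy-stochastic f u = begin-equality
        sum (greedy f u)  ≡⟨ sum-cong (λ v → ℚ.*-identityʳ (greedy f u v)) ⟨
        (greedy f · (λ _ → 1ℚ)) u  ≡⟨ greedy-· f (λ _ → 1ℚ) u ⟩
        (1ℚ - 1/ι K) * (P · (λ _ → 1ℚ)) u + 1/ι K * 1ℚ  ≡⟨ cong (λ z → (1ℚ - 1/ι K) * z + 1/ι K * 1ℚ) (·-const P-stochastic 1ℚ u) ⟩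
        (1ℚ - 1/ι K) * 1ℚ + 1/ι K * 1ℚ  ≡⟨ total (1/ι K) ⟩
        1ℚ  ∎
        where
        total : ∀ a → (1ℚ - a) * 1ℚ + a * 1ℚ ≡ 1ℚ
        total = solve-∀ ring

      -- The largest probability of visiting S within r steps that a controller can achieve.
      boosted : (Fin n → Bool) → ℕ → Vector ℚ n
      boosted S zero    u = ⟦ S u ⟧
      boosted S (suc r) u = if S u then 1ℚ else (greedy (boosted S r) · boosted S r) u

      boosted-nonneg : ∀ S r u → 0ℚ ≤ boosted S r u
      boosted-nonneg S zero    u = 0≤⟦ S u ⟧
      boosted-nonneg S (suc r) u with S u
      ... | true  = 0≤1
      ... | false = ·-nonneg (greedy-nonneg (boosted S r)) (boosted-nonneg S r) u

      boosted≤1 : ∀ S r u → boosted S r u ≤ 1ℚ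
      boosted≤1 S zero    u = ⟦ S u ⟧≤1
      boosted≤1 S (suc r) u with S u
      ... | true  = ℚ.≤-refl
      ... | false = subst ((greedy (boosted S r) · boosted S r) u ≤_) (·-const (greedy-stochastic (boosted S r)) 1ℚ u)
                      (·-mono (greedy-nonneg (boosted S r)) (boosted≤1 S r) u)

      boosted-inside : ∀ S r u → S u ≡ true → boosted S r u ≡ 1ℚ
      boosted-inside S zero    u Su≡true rewrite Su≡true = refl
      boosted-inside S (suc r) u Su≡true rewrite Su≡true = refl

      boosted-outside : ∀ S r u → S u ≡ false → boosted S (suc r) u ≡ (greedy (boosted S r) · boosted S r) u
      boosted-outside S r u Su≡false rewrite Su≡false = refl

      -- Read as `boosted ≥ hit^(1 - 1/K)`. Outside `S` one application of `boost-step` per time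
      -- step carries the bound along, `M` being the value at the best neighbour; on `S` both sides
      -- are 1.
      hit^≤boosted^ : ∀ S r u → hit S r u ^ suc k ≤ boosted S r u ^ K
      hit^≤boosted^ S zero u with S u
      ... | true  = ℚ.≤-reflexive (≡.trans (1^n≡1 (suc k)) (≡.sym (1^n≡1 K)))
      ... | false = ℚ.≤-reflexive (≡.trans (ℚ.*-zeroˡ (0ℚ ^ k)) (≡.sym (ℚ.*-zeroˡ (0ℚ ^ suc k))))
      hit^≤boosted^ S (suc r) u with S u
      ... | true  = ℚ.≤-reflexive (≡.trans (1^n≡1 (suc k)) (≡.sym (1^n≡1 K)))
      ... | false = subst (λ z → (P · hit S r) u ^ suc k ≤ z ^ K) (≡.sym (greedy-· (boosted S r) (boosted S r) u))
          (boost-step (P u) (hit S r) (boosted S r) k (P-nonneg u) (P-stochastic u)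
            (boosted-nonneg S r (best (boosted S r) u)) (hit-nonneg S r) (boosted-nonneg S r) below-max (hit^≤boosted^ S r))
        where
        below-max : ∀ v → P u v ≡ 0ℚ ⊎ boosted S r v ≤ boosted S r (best (boosted S r) u)
        below-max v with u ~? v
        ... | yes u~v = inj₂ (best-max (boosted S r) u~v)
        ... | no  _   = inj₁ refl

  -- The potential of the controlled walk

  expect : ∀ {n} → (List (Fin n) → Fin n → Fin n → ℚ) → ℕ → (List (Fin n) → Fin n → ℚ) → List (Fin n) → Fin n → ℚ
  expect law zero    f past u = f past u
  expect law (suc t) f past u = sum λ v → law past u v * expect law t f (u ∷ past) v

  record Controller {n : ℕ} (G : Graph n) (K C : ℕ) : Set where
    field
      control   : List (Fin n) → Fin n → Fin n → ℚ
      nonneg    : ∀ past u v → 0ℚ ≤ control past u v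
      total     : ∀ past → Stochastic (control past)
      neighbour : ∀ past u v → ¬ (Graph._~_ G u v) → control past u v ≡ 0ℚ

    law : List (Fin n) → Fin n → Fin n → ℚ
    law past u v = (1ℚ - 1/ι K) * walk G u v + 1/ι K * control past u v

    field
      bound : ∀ t v → expect law t (λ past u → ι (truncatedCoverTime G past u)) [] v ≤ ι C

  -- The argument is one less than the number of steps left in the phase or round, so every mode has
  -- a step to make.
  data Mode : Set where
    warm boost : ℕ → Mode

  -- The price of one step: time stops counting once every vertex has been visited.
  nonempty : ℕ → ℚ
  nonempty zero    = 0ℚ
  nonempty (suc _) = 1ℚ

  nonempty≤1 : ∀ c → nonempty c ≤ 1ℚ
  nonempty≤1 zero    = 0≤1
  nonempty≤1 (suc _) = ℚ.≤-refl

  module Potential {n : ℕ} (G : Graph n) (degree≥1 : ∀ u → 1 ℕ.≤ Graph.degree G u) (k T′ : ℕ)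
    (H : ℕ → ℚ) (0≤H : ∀ m → 0ℚ ≤ H m)
    -- Repeating rounds of `suc T′` steps, each successful with probability at least `p`, costs
    -- `suc T′ / p` steps on average, and `H` is to dominate this.
    (H-large : ∀ S u m → count S ≡ suc m →
      ι (suc T′) ≤ H (suc m) * Hitting.Boosted.boosted G degree≥1 k S (suc T′) u)
    where

    open Hitting G degree≥1
    open Boosted k

    private
      P = walk G

    total-H : ℕ → ℚ
    total-H zero    = 0ℚ
    total-H (suc m) = H (suc m) + total-H m

    0≤total-H : ∀ m → 0ℚ ≤ total-H m
    0≤total-H zero    = ℚ.≤-refl
    0≤total-H (suc m) = +-nonneg (0≤H (suc m)) (0≤total-H m)

    -- H (suc m) bounds the time to the next unvisited vertex when suc m vertices are unvisited,
    -- and r steps remain in the current round of suc T′ steps.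
    remaining′ : ℕ → (Fin n → Bool) → Fin n → ℕ → ℚ
    remaining′ zero    S u r = 0ℚ
    remaining′ (suc m) S u r = ι r + (1ℚ - boosted S r u) * H (suc m) + total-H m

    remaining : (Fin n → Bool) → Fin n → ℕ → ℚ
    remaining S = remaining′ (count S) S

    0≤1-boosted : ∀ S r u → 0ℚ ≤ 1ℚ - boosted S r u
    0≤1-boosted S r u = p≤q⇒0≤q-p (boosted≤1 S r u)

    remaining-nonneg : ∀ S u r → 0ℚ ≤ remaining S u r
    remaining-nonneg S u r with count S
    ... | zero  = ℚ.≤-refl
    ... | suc m = +-nonneg (+-nonneg (0≤ι r) (*-nonneg (0≤1-boosted S r u) (0≤H (suc m)))) (0≤total-H m)

    -- Finding `v` in mid-round does not restart the round. There `boosted` is 1, so the charge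
    -- `H (suc m)` has disappeared, and the smaller set with its `r` left-over steps costs at most
    -- what it would if those steps failed.
    remaining-visit : ∀ S r v m → count S ≡ suc m →
      remaining (visit v S) v r ≤ ι r + (1ℚ - boosted S r v) * H (suc m) + total-H m
    remaining-visit S r v m count≡ with S v in Sv
    ... | false = ℚ.≤-reflexive (cong (λ c → remaining′ c S v r) count≡)
    ... | true  = begin
      remaining′ (count (remove v S)) (remove v S) v r  ≡⟨ cong (λ c → remaining′ c (remove v S) v r)
                                                                      (ℕ.suc-injective (≡.trans (≡.sym (count-remove v S Sv)) count≡)) ⟩
      remaining′ m (remove v S) v r  ≤⟨ bound m ⟩
      ι r + total-H m  ≡⟨ simplify (ι r) (H (suc m)) (total-H m) ⟩
      ι r + (1ℚ - 1ℚ) * H (suc m) + total-H m  ≡⟨ cong (λ z → ι r + (1ℚ - z) * H (suc m) + total-H m) (boosted-inside S r v Sv) ⟨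
      ι r + (1ℚ - boosted S r v) * H (suc m) + total-H m  ∎
      where
      simplify : ∀ r h c → r + c ≡ r + (1ℚ - 1ℚ) * h + c
      simplify = solve-∀ ring
      bound : ∀ m → remaining′ m (remove v S) v r ≤ ι r + total-H m
      bound zero    = +-nonneg (0≤ι r) ℚ.≤-refl
      bound (suc m) = ≤-by _ (*-nonneg (boosted-nonneg (remove v S) r v) (0≤H (suc m)))
        (rearrange (ι r) (boosted (remove v S) r v) (H (suc m)) (total-H m))
        where
        rearrange : ∀ r b h c → r + (h + c) ≡ (r + (1ℚ - b) * h + c) + b * h
        rearrange = solve-∀ ring

    affine : ∀ {A : Fin n → Fin n → ℚ} → Stochastic A → ∀ a b f u →
      (A · (λ v → a + b * f v)) u ≡ a + b * (A · f) u
    affine {A} stoch a b f u = ≡.trans (·-+ A (λ _ → a) (λ v → b * f v) u) (cong₂ _+_ (·-const stoch a u) (·-* A b f u))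

    -- Outside `S` the value `boosted S (suc r)` is the exact average of `boosted S r` under the
    -- greedy law, so the failure term is preserved on average and the drop from `suc r` to `r` pays
    -- for the step.
    greedy-step : ∀ S u r → S u ≡ false →
      nonempty (count S) + (greedy (boosted S r) · (λ v → remaining (visit v S) v r)) u ≤ remaining S u (suc r)
    greedy-step S u r Su≡false with count S in count≡
    ... | zero  = ℚ.≤-reflexive (cong (0ℚ +_) (sum-zero λ v → ≡.trans (cong (greedy (boosted S r) u v *_) (covered v)) (ℚ.*-zeroʳ (greedy (boosted S r) u v))))
      where
      covered : ∀ v → remaining (visit v S) v r ≡ 0ℚ
      covered v rewrite visit-old v S (count≡0⇒false count≡ v) | count≡ = refl
    ... | suc m = begin
      1ℚ + (A · (λ v → remaining (visit v S) v r)) u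
        ≤⟨ ℚ.+-monoʳ-≤ 1ℚ (·-mono (greedy-nonneg (boosted S r)) (λ v → remaining-visit S r v m count≡) u) ⟩
      1ℚ + (A · (λ v → ι r + (1ℚ - boosted S r v) * H (suc m) + total-H m)) u
        ≡⟨ cong (1ℚ +_) (·-cong A (λ v → regroup (ι r) (boosted S r v) (H (suc m)) (total-H m)) u) ⟩
      1ℚ + (A · (λ v → (ι r + H (suc m) + total-H m) + - H (suc m) * boosted S r v)) u
        ≡⟨ cong (1ℚ +_) (affine (greedy-stochastic (boosted S r)) (ι r + H (suc m) + total-H m) (- H (suc m)) (boosted S r) u) ⟩
      1ℚ + ((ι r + H (suc m) + total-H m) + - H (suc m) * (A · boosted S r) u)
        ≡⟨ cong (λ z → 1ℚ + ((ι r + H (suc m) + total-H m) + - H (suc m) * z)) (boosted-outside S r u Su≡false) ⟨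
      1ℚ + ((ι r + H (suc m) + total-H m) + - H (suc m) * boosted S (suc r) u)
        ≡⟨ regroup′ (ι r) (boosted S (suc r) u) (H (suc m)) (total-H m) ⟩
      (1ℚ + ι r) + (1ℚ - boosted S (suc r) u) * H (suc m) + total-H m
        ≡⟨ cong (λ z → z + (1ℚ - boosted S (suc r) u) * H (suc m) + total-H m) (ι-suc r) ⟨
      ι (suc r) + (1ℚ - boosted S (suc r) u) * H (suc m) + total-H m ∎
      where
      A = greedy (boosted S r)
      regroup : ∀ r b h c → r + (1ℚ - b) * h + c ≡ (r + h + c) + - h * b
      regroup = solve-∀ ring
      regroup′ : ∀ r b h c → 1ℚ + ((r + h + c) + - h * b) ≡ (1ℚ + r) + (1ℚ - b) * h + c
      regroup′ = solve-∀ ring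

    -- At the end of a round `boosted S 0 u` is 0, so the full charge `H (suc m)` is present; by
    -- `H-large` the part of it released by the chance of success pays for `suc T′` more steps.
    new-round : ∀ S u → S u ≡ false → remaining S u (suc T′) ≤ remaining S u 0
    new-round S u Su≡false with count S in count≡
    ... | zero  = ℚ.≤-refl
    ... | suc m = begin
      ι (suc T′) + (1ℚ - b) * H (suc m) + total-H m  ≤⟨ ℚ.+-monoˡ-≤ (total-H m) (ℚ.+-monoˡ-≤ ((1ℚ - b) * H (suc m)) (H-large S u m count≡)) ⟩
      H (suc m) * b + (1ℚ - b) * H (suc m) + total-H m  ≡⟨ regroup b (H (suc m)) (total-H m) ⟩
      0ℚ + (1ℚ - 0ℚ) * H (suc m) + total-H m  ≡⟨ cong₂ (λ x y → x + (1ℚ - y) * H (suc m) + total-H m) ι-0 (cong ⟦_⟧ Su≡false) ⟨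
      ι 0 + (1ℚ - ⟦ S u ⟧) * H (suc m) + total-H m  ∎
      where
      b = boosted S (suc T′) u
      regroup : ∀ b h c → h * b + (1ℚ - b) * h + c ≡ 0ℚ + (1ℚ - 0ℚ) * h + c
      regroup = solve-∀ ring

    remaining≤ : ∀ S u → remaining S u (suc T′) ≤ ι (suc T′) + total-H (count S)
    remaining≤ S u with count S
    ... | zero  = +-nonneg (0≤ι (suc T′)) ℚ.≤-refl
    ... | suc m = ≤-by _ (*-nonneg (boosted-nonneg S (suc T′) u) (0≤H (suc m)))
        (rearrange (ι (suc T′)) (boosted S (suc T′) u) (H (suc m)) (total-H m))
      where
      rearrange : ∀ r b h c → r + (h + c) ≡ (r + (1ℚ - b) * h + c) + b * h
      rearrange = solve-∀ ring

    module Warm-up (θ : ℚ) (0≤1-θ : 0ℚ ≤ 1ℚ - θ) (ψ : Fin n → Vector ℚ n)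
      (1≤ψ : ∀ v u → 1ℚ ≤ ψ v u) (ψ≤3 : ∀ v u → ψ v u ≤ 3ℚ)
      (walk-ψ : ∀ {u v} → u ≢ v → (P · ψ v) u ≤ (1ℚ - θ) * ψ v u)
      (β B : ℚ) (0≤β : 0ℚ ≤ β) (0≤B : 0ℚ ≤ B)
      (total-H≤ : ∀ m → ι (suc T′) + total-H m ≤ B + β * ι m)
      where

      0≤ψ : ∀ v u → 0ℚ ≤ ψ v u
      0≤ψ v u = ℚ.≤-trans 0≤1 (1≤ψ v u)

      -- Comparable to the number of unvisited vertices, but, unlike that number, contracting in
      -- expectation at every step of the simple walk.
      Ψ : (Fin n → Bool) → Vector ℚ n
      Ψ S u = sum λ x → ⟦ S x ⟧ * ψ x u

      Ψ-nonneg : ∀ S u → 0ℚ ≤ Ψ S u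
      Ψ-nonneg S u = sum-nonneg λ x → *-nonneg 0≤⟦ S x ⟧ (0≤ψ x u)

      count≤Ψ : ∀ S u → ι (count S) ≤ Ψ S u
      count≤Ψ S u = begin
        ι (count S)  ≡⟨ ι-count S ⟩
        (sum λ x → ⟦ S x ⟧)  ≡⟨ sum-cong (λ x → ℚ.*-identityʳ ⟦ S x ⟧) ⟨
        (sum λ x → ⟦ S x ⟧ * 1ℚ)  ≤⟨ sum-mono (λ x → *-monoˡ 0≤⟦ S x ⟧ (1≤ψ x u)) ⟩
        Ψ S u  ∎

      Ψ≤3n : ∀ S u → Ψ S u ≤ ι n * 3ℚ
      Ψ≤3n S u = begin
        Ψ S u  ≤⟨ sum-mono (λ x → *-mono 0≤1 (0≤ψ x u) ⟦ S x ⟧≤1 (ψ≤3 x u)) ⟩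
        sum {n} (λ _ → 1ℚ * 3ℚ)  ≡⟨ sum-const {n} (1ℚ * 3ℚ) ⟩
        ι n * (1ℚ * 3ℚ)  ≡⟨⟩
        ι n * 3ℚ  ∎

      -- The visited vertex `u` differs from every `x` in `S`, so each relevant `ψ x` has its drift;
      -- a visit only deletes non-negative summands.
      walk-Ψ : ∀ S u → S u ≡ false → (P · (λ v → Ψ (visit v S) v)) u ≤ (1ℚ - θ) * Ψ S u
      walk-Ψ S u Su≡false = begin
        (P · (λ v → Ψ (visit v S) v)) u  ≤⟨ ·-mono (walk-nonneg G) (λ v → sum-mono λ x → *-monoʳ (0≤ψ x v) (visit-⊆ v S x)) u ⟩
        (P · (λ v → sum λ x → ⟦ S x ⟧ * ψ x v)) u  ≡⟨ ·-sum P (λ x v → ⟦ S x ⟧ * ψ x v) u ⟩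
        (sum λ x → (P · (λ v → ⟦ S x ⟧ * ψ x v)) u)  ≡⟨ sum-cong (λ x → ·-* P ⟦ S x ⟧ (ψ x) u) ⟩
        (sum λ x → ⟦ S x ⟧ * (P · ψ x) u)  ≤⟨ sum-mono decrease ⟩
        (sum λ x → (1ℚ - θ) * (⟦ S x ⟧ * ψ x u))  ≡⟨ *-sumˡ (1ℚ - θ) _ ⟨
        (1ℚ - θ) * Ψ S u  ∎
        where
        swap : ∀ a b c → a * (b * c) ≡ b * (a * c)
        swap = solve-∀ ring
        decrease : ∀ x → ⟦ S x ⟧ * (P · ψ x) u ≤ (1ℚ - θ) * (⟦ S x ⟧ * ψ x u)
        decrease x with u Fin.≟ x
        ... | yes refl rewrite Su≡false = ℚ.≤-reflexive (zeros ((P · ψ x) u) (1ℚ - θ) (ψ x u))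
          where
          zeros : ∀ a b c → 0ℚ * a ≡ b * (0ℚ * c)
          zeros = solve-∀ ring
        ... | no u≢x = subst (⟦ S x ⟧ * (P · ψ x) u ≤_) (swap ⟦ S x ⟧ (1ℚ - θ) (ψ x u)) (*-monoˡ 0≤⟦ S x ⟧ (walk-ψ u≢x))

      next : Mode → Mode
      next (warm zero)     = boost T′
      next (warm (suc a))  = warm a
      next (boost zero)    = boost T′
      next (boost (suc r)) = boost r

      control : Mode → (Fin n → Bool) → Fin n → Fin n → ℚ
      control (warm a)  S = P
      -- With `suc r` steps left, neighbours are judged by the `r` steps that remain after the move.
      control (boost r) S u = point (best (boosted S r) u)

      control-nonneg : ∀ M S u v → 0ℚ ≤ control M S u v
      control-nonneg (warm a)  S u v = walk-nonneg G u v
      control-nonneg (boost r) S u v = 0≤indicator (v Fin.≟ best (boosted S r) u)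

      control-stochastic : ∀ M S → Stochastic (control M S)
      control-stochastic (warm a)  S u = walk-stochastic G degree≥1 u
      control-stochastic (boost r) S u = ≡.trans (sum-cong λ v → ≡.sym (ℚ.*-identityˡ _)) (sum-point (λ _ → 1ℚ) (best (boosted S r) u))

      control-neighbour : ∀ M S u v → ¬ (Graph._~_ G u v) → control M S u v ≡ 0ℚ
      control-neighbour (warm a)  S u v u≁v = walk-off-edge G u v u≁v
      control-neighbour (boost r) S u v u≁v = point-other {u = v} {best (boosted S r) u} λ { refl → u≁v (best-neighbour (boosted S r) u) }

      kernel : Mode → (Fin n → Bool) → Fin n → Fin n → ℚ
      kernel M S u v = (1ℚ - 1/ι K) * P u v + 1/ι K * control M S u v

      kernel-warm : ∀ a S f u → (kernel (warm a) S · f) u ≡ (P · f) u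
      kernel-warm a S f u = sum-cong λ v → cong (_* f v) (mix (1/ι K) (P u v))
        where
        mix : ∀ i p → (1ℚ - i) * p + i * p ≡ p
        mix = solve-∀ ring

      -- During the warm-up: the steps left in it, plus the linear bound `B + β Ψ` on the cost of
      -- all later rounds, with `Ψ` discounted by the contraction still to come.
      Φ : Mode → (Fin n → Bool) → Fin n → ℚ
      Φ (warm a)  S u = ι (suc a) + (1ℚ - θ) ^ suc a * (β * Ψ S u) + B
      Φ (boost r) S u = remaining S u (suc r)

      kernel-nonneg : ∀ M S u v → 0ℚ ≤ kernel M S u v
      kernel-nonneg M S u v = +-nonneg (*-nonneg (p≤q⇒0≤q-p (1/ι≤1 K)) (walk-nonneg G u v)) (*-nonneg (0≤1/ι K) (control-nonneg M S u v))

      kernel-stochastic : ∀ M S → Stochastic (kernel M S)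
      kernel-stochastic (warm a)  S u = begin-equality
        sum (kernel (warm a) S u)  ≡⟨ sum-cong (λ v → ℚ.*-identityʳ (kernel (warm a) S u v)) ⟨
        (kernel (warm a) S · (λ _ → 1ℚ)) u  ≡⟨ kernel-warm a S (λ _ → 1ℚ) u ⟩
        (P · (λ _ → 1ℚ)) u  ≡⟨ ·-const (walk-stochastic G degree≥1) 1ℚ u ⟩
        1ℚ  ∎
      -- In this mode the kernel is `greedy (boosted S r)` by definition.
      kernel-stochastic (boost r) S = greedy-stochastic (boosted S r)

      Φ-nonneg : ∀ M S u → 0ℚ ≤ Φ M S u
      Φ-nonneg (warm a)  S u = +-nonneg (+-nonneg (0≤ι (suc a)) (*-nonneg (^-nonneg (suc a) 0≤1-θ) (*-nonneg 0≤β (Ψ-nonneg S u)))) 0≤B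
      Φ-nonneg (boost r) S u = remaining-nonneg S u (suc r)

      after-warm : ∀ a S u → Φ (next (warm a)) S u ≤ ι a + (1ℚ - θ) ^ a * (β * Ψ S u) + B
      after-warm (suc a) S u = ℚ.≤-refl
      after-warm zero    S u = begin
        remaining S u (suc T′)  ≤⟨ remaining≤ S u ⟩
        ι (suc T′) + total-H (count S)  ≤⟨ total-H≤ (count S) ⟩
        B + β * ι (count S)  ≤⟨ ℚ.+-monoʳ-≤ B (*-monoˡ 0≤β (count≤Ψ S u)) ⟩
        B + β * Ψ S u  ≡⟨ rearrange B (β * Ψ S u) ⟩
        0ℚ + 1ℚ * (β * Ψ S u) + B  ≡⟨ cong (λ z → z + 1ℚ * (β * Ψ S u) + B) ι-0 ⟨
        ι 0 + 1ℚ * (β * Ψ S u) + B  ∎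
        where
        rearrange : ∀ b x → b + x ≡ 0ℚ + 1ℚ * x + b
        rearrange = solve-∀ ring

      after-boost : ∀ r S u → S u ≡ false → Φ (next (boost r)) S u ≤ remaining S u r
      after-boost zero    S u Su≡false = new-round S u Su≡false
      after-boost (suc r) S u Su≡false = ℚ.≤-refl

      Φ-step : ∀ M S u → S u ≡ false →
        nonempty (count S) + (kernel M S · (λ v → Φ (next M) (visit v S) v)) u ≤ Φ M S u
      Φ-step (boost r) S u Su≡false = ℚ.≤-trans
        -- The vertex just reached counts as visited, which is what starting a new round requires.
        (ℚ.+-monoʳ-≤ (nonempty (count S)) (·-mono (greedy-nonneg (boosted S r)) (λ v → after-boost r (visit v S) v (visit-self v S)) u))
        (greedy-step S u r Su≡false)
      Φ-step (warm a) S u Su≡false = begin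
        nonempty (count S) + (kernel (warm a) S · (λ v → Φ (next (warm a)) (visit v S) v)) u
          ≡⟨ cong (_+_ (nonempty (count S))) (kernel-warm a S _ u) ⟩
        nonempty (count S) + (P · (λ v → Φ (next (warm a)) (visit v S) v)) u
          ≤⟨ ℚ.+-mono-≤ (nonempty≤1 (count S)) (·-mono (walk-nonneg G) (λ v → after-warm a (visit v S) v) u) ⟩
        1ℚ + (P · (λ v → ι a + q * (β * Ψ (visit v S) v) + B)) u
          ≡⟨ cong (1ℚ +_) (·-cong P (λ v → regroup (ι a) q β (Ψ (visit v S) v) B) u) ⟩
        1ℚ + (P · (λ v → (ι a + B) + (q * β) * Ψ (visit v S) v)) u
          ≡⟨ cong (1ℚ +_) (affine (walk-stochastic G degree≥1) (ι a + B) (q * β) (λ v → Ψ (visit v S) v) u) ⟩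
        1ℚ + ((ι a + B) + (q * β) * (P · (λ v → Ψ (visit v S) v)) u)
          ≤⟨ ℚ.+-monoʳ-≤ 1ℚ (ℚ.+-monoʳ-≤ (ι a + B) (*-monoˡ (*-nonneg (^-nonneg a 0≤1-θ) 0≤β) (walk-Ψ S u Su≡false))) ⟩
        1ℚ + ((ι a + B) + (q * β) * ((1ℚ - θ) * Ψ S u))
          ≡⟨ regroup′ (ι a) q β (1ℚ - θ) (Ψ S u) B ⟩
        (1ℚ + ι a) + ((1ℚ - θ) * q) * (β * Ψ S u) + B
          ≡⟨ cong (λ z → z + ((1ℚ - θ) * q) * (β * Ψ S u) + B) (ι-suc a) ⟨
        ι (suc a) + ((1ℚ - θ) * q) * (β * Ψ S u) + B ∎
        where
        q = (1ℚ - θ) ^ a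
        regroup : ∀ a q b x c → a + q * (b * x) + c ≡ (a + c) + (q * b) * x
        regroup = solve-∀ ring
        regroup′ : ∀ a q b t x c → 1ℚ + ((a + c) + (q * b) * (t * x)) ≡ (1ℚ + a) + (t * q) * (b * x) + c
        regroup′ = solve-∀ ring

      module Process (a₀ : ℕ) where

        mode : List (Fin n) → Mode
        mode []       = warm a₀
        mode (x ∷ xs) = next (mode xs)

        law : List (Fin n) → Fin n → Fin n → ℚ
        law past u = kernel (mode past) (unvisited (u ∷ past)) u

        uncovered≤nonempty : ∀ past u →
          ι (if does (covered? G past u) then 0 else 1) ≤ nonempty (count (unvisited (u ∷ past)))
        uncovered≤nonempty past u with count (unvisited (u ∷ past)) in count≡
        ... | zero  = ℚ.≤-reflexive (≡.trans (cong (λ b → ι (if b then 0 else 1)) (dec-true (covered? G past u)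
                        λ w → unvisited-false (u ∷ past) w (count≡0⇒false count≡ w))) ι-0)
        ... | suc _ with does (covered? G past u)
        ...   | true  = subst (_≤ 1ℚ) (≡.sym ι-0) 0≤1
        ...   | false = ℚ.≤-reflexive ι-1

        -- Time counted so far plus potential is a supermartingale, and `Φ ≥ 0` allows stopping at
        -- any horizon `t`.
        expect≤ : ∀ t past u → expect law t (λ past u → ι (truncatedCoverTime G past u)) past u ≤
          ι (truncatedCoverTime G past u) + Φ (mode past) (unvisited (u ∷ past)) u
        expect≤ zero    past u = ≤-by _ (Φ-nonneg (mode past) (unvisited (u ∷ past)) u) refl
        expect≤ (suc t) past u = begin
          (A · (λ v → expect law t (λ past u → ι (truncatedCoverTime G past u)) (u ∷ past) v)) u
            ≤⟨ ·-mono (kernel-nonneg (mode past) S) (λ v → expect≤ t (u ∷ past) v) u ⟩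
          (A · (λ v → ι (i ℕ.+ τ) + Φ (next (mode past)) (visit v S) v)) u
            ≡⟨ ·-+ A (λ _ → ι (i ℕ.+ τ)) (λ v → Φ (next (mode past)) (visit v S) v) u ⟩
          (A · (λ _ → ι (i ℕ.+ τ))) u + next-Φ
            ≡⟨ cong (_+ next-Φ) (≡.trans (·-const (kernel-stochastic (mode past) S) (ι (i ℕ.+ τ)) u) (ι-+ i τ)) ⟩
          ι i + ι τ + next-Φ
            ≡⟨ regroup (ι i) (ι τ) next-Φ ⟩
          ι τ + (ι i + next-Φ)
            ≤⟨ ℚ.+-monoʳ-≤ (ι τ) (ℚ.+-monoˡ-≤ next-Φ (uncovered≤nonempty past u)) ⟩
          ι τ + (nonempty (count S) + next-Φ)
            ≤⟨ ℚ.+-monoʳ-≤ (ι τ) (Φ-step (mode past) S u (visit-self u (unvisited past))) ⟩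
          ι τ + Φ (mode past) S u ∎
          where
          S = unvisited (u ∷ past)
          A = kernel (mode past) S
          i = if does (covered? G past u) then 0 else 1
          τ = truncatedCoverTime G past u
          next-Φ = (A · (λ v → Φ (next (mode past)) (visit v S) v)) u
          regroup : ∀ a b c → a + b + c ≡ b + (a + c)
          regroup = solve-∀ ring

        expect-start : ∀ t v → expect law t (λ past u → ι (truncatedCoverTime G past u)) [] v ≤
          ι (suc a₀) + (1ℚ - θ) ^ suc a₀ * (β * (ι n * 3ℚ)) + B
        expect-start t v = begin
          expect law t (λ past u → ι (truncatedCoverTime G past u)) [] v
            ≤⟨ expect≤ t [] v ⟩
          ι 0 + Φ (warm a₀) (unvisited (v ∷ [])) v
            ≡⟨ ≡.trans (cong (_+ Φ (warm a₀) (unvisited (v ∷ [])) v) ι-0) (ℚ.+-identityˡ _) ⟩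
          ι (suc a₀) + (1ℚ - θ) ^ suc a₀ * (β * Ψ (unvisited (v ∷ [])) v) + B
            ≤⟨ ℚ.+-monoˡ-≤ B (ℚ.+-monoʳ-≤ (ι (suc a₀)) (*-monoˡ (^-nonneg (suc a₀) 0≤1-θ) (*-monoˡ 0≤β (Ψ≤3n (unvisited (v ∷ [])) v)))) ⟩
          ι (suc a₀) + (1ℚ - θ) ^ suc a₀ * (β * (ι n * 3ℚ)) + B ∎

        controller : ∀ {C} → ι (suc a₀) + (1ℚ - θ) ^ suc a₀ * (β * (ι n * 3ℚ)) + B ≤ ι C → Controller G K C
        controller ≤C = record
          { control   = λ past u v → control (mode past) (unvisited (u ∷ past)) u v
          ; nonneg    = λ past u v → control-nonneg (mode past) (unvisited (u ∷ past)) u v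
          ; total     = λ past u → control-stochastic (mode past) (unvisited (u ∷ past)) u
          ; neighbour = λ past u v → control-neighbour (mode past) (unvisited (u ∷ past)) u v
          ; bound     = λ t v → ℚ.≤-trans (expect-start t v) ≤C
          }

  -- Choice of the parameters

  suc-pred : ∀ {n} → 1 ℕ.≤ n → suc (ℕ.pred n) ≡ n
  suc-pred {suc n} _ = refl

  module Assembly {n : ℕ} (G : Graph n) (Δ D : ℕ) (1≤n : 1 ℕ.≤ n) (1≤D : 1 ℕ.≤ D)
    (degree≥1 : ∀ u → 1 ℕ.≤ Graph.degree G u) (degree≤Δ : ∀ u → Graph.degree G u ℕ.≤ Δ) (gap : HasGap G D)
    (J : ℕ) (1≤J : 1 ℕ.≤ J) (J-large : 2 ℕ.* (Δ ℕ.* Δ ℕ.* n) ℕ.≤ 2 ℕ.^ J)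
    (k i₀ : ℕ) (1≤i₀ : 1 ℕ.≤ i₀) (i₀-large : 2 ℕ.* D ℕ.* J ℕ.* 2 ℕ.^ (2 ℕ.+ k) ℕ.≤ 2 ℕ.^ i₀)
    where

    open Mixing G Δ D 1≤n 1≤D degree≥1 degree≤Δ gap using (1≤2D; 1≤Δ; module Horizon)
    open Horizon J J-large
    open Levels (suc k) i₀ X
    open Hitting G degree≥1
    open Boosted k

    private
      κ = suc k

    1≤T : 1 ℕ.≤ T
    1≤T = ℕ.*-mono-≤ 1≤2D 1≤J

    T′ : ℕ
    T′ = ℕ.pred T

    -- The lazy walk occupies one vertex at time `T`, so the bounds of `mixed` add up over the
    -- vertices of `S`; `lazy-hit-≤` transfers the sum to the simple walk.
    hit-large : ∀ S u → ι (count S) * 1/ι X ≤ hit S T u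
    hit-large S u = begin
      ι (count S) * 1/ι X  ≡⟨ cong (_* 1/ι X) (ι-count S) ⟩
      (sum λ v → ⟦ S v ⟧) * 1/ι X  ≡⟨ *-sumʳ (1/ι X) _ ⟩
      (sum λ v → ⟦ S v ⟧ * 1/ι X)  ≤⟨ sum-mono (λ v → *-monoˡ 0≤⟦ S v ⟧ (mixed u v)) ⟩
      (sum λ v → ⟦ S v ⟧ * iterate (lazy G) T (point v) u)  ≡⟨ iterate-combination (lazy G) T (λ v → ⟦ S v ⟧) point u ⟨
      iterate (lazy G) T (λ u → sum λ v → ⟦ S v ⟧ * point v u) u  ≡⟨ iterate-cong (lazy G) T expand u ⟩
      iterate (lazy G) T (λ u → ⟦ S u ⟧) u  ≤⟨ lazy-hit-≤ S T u ⟩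
      hit S T u  ∎
      where
      expand : ∀ u → (sum λ v → ⟦ S v ⟧ * point v u) ≡ ⟦ S u ⟧
      expand u = ≡.trans (sum-cong λ v → cong (⟦ S v ⟧ *_) (point-sym v u)) (sum-point (λ v → ⟦ S v ⟧) u)

    -- A hitting probability of at least `2^(- K i)` is boosted to at least `2^(- κ i)`. Both facts
    -- are compared after raising to the powers `κ` and `K`, where the powers of 2 agree.
    boosted-large : ∀ S u i → X ℕ.≤ count S ℕ.* 2 ℕ.^ (K ℕ.* i) → 1ℚ ≤ ι (2 ℕ.^ (κ ℕ.* i)) * boosted S T u
    boosted-large S u i X≤ = 1≤^⇒1≤ (suc k) (*-nonneg (0≤ι (2 ℕ.^ (κ ℕ.* i))) (boosted-nonneg S T u)) (begin
      1ℚ  ≤⟨ 1≤^ κ hit-scaled ⟩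
      (ι (2 ℕ.^ (K ℕ.* i)) * hit S T u) ^ κ  ≡⟨ ^-distrib-* (ι (2 ℕ.^ (K ℕ.* i))) (hit S T u) κ ⟩
      ι (2 ℕ.^ (K ℕ.* i)) ^ κ * hit S T u ^ κ  ≡⟨ cong (_* hit S T u ^ κ) powers ⟩
      ι (2 ℕ.^ (κ ℕ.* i)) ^ K * hit S T u ^ κ  ≤⟨ *-monoˡ (^-nonneg K (0≤ι (2 ℕ.^ (κ ℕ.* i)))) (hit^≤boosted^ S T u) ⟩
      ι (2 ℕ.^ (κ ℕ.* i)) ^ K * boosted S T u ^ K  ≡⟨ ^-distrib-* (ι (2 ℕ.^ (κ ℕ.* i))) (boosted S T u) K ⟨
      (ι (2 ℕ.^ (κ ℕ.* i)) * boosted S T u) ^ K  ∎)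
      where
      powers : ι (2 ℕ.^ (K ℕ.* i)) ^ κ ≡ ι (2 ℕ.^ (κ ℕ.* i)) ^ K
      powers = begin-equality
        ι (2 ℕ.^ (K ℕ.* i)) ^ κ  ≡⟨ ι-^ (2 ℕ.^ (K ℕ.* i)) κ ⟨
        ι ((2 ℕ.^ (K ℕ.* i)) ℕ.^ κ)  ≡⟨ cong ι (ℕ.^-*-assoc 2 (K ℕ.* i) κ) ⟩
        ι (2 ℕ.^ (K ℕ.* i ℕ.* κ))  ≡⟨ cong (λ e → ι (2 ℕ.^ e)) (rearrange K i κ) ⟩
        ι (2 ℕ.^ (κ ℕ.* i ℕ.* K))  ≡⟨ cong ι (ℕ.^-*-assoc 2 (κ ℕ.* i) K) ⟨
        ι ((2 ℕ.^ (κ ℕ.* i)) ℕ.^ K)  ≡⟨ ι-^ (2 ℕ.^ (κ ℕ.* i)) K ⟩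
        ι (2 ℕ.^ (κ ℕ.* i)) ^ K  ∎
        where
        rearrange : ∀ a b c → a ℕ.* b ℕ.* c ≡ c ℕ.* b ℕ.* a
        rearrange = ℕ-solve-∀
      hit-scaled : 1ℚ ≤ ι (2 ℕ.^ (K ℕ.* i)) * hit S T u
      hit-scaled = begin
        1ℚ  ≡⟨ ι*1/ι 1≤X ⟨
        ι X * 1/ι X  ≤⟨ *-monoʳ (0≤1/ι X) (ι-mono X≤) ⟩
        ι (count S ℕ.* 2 ℕ.^ (K ℕ.* i)) * 1/ι X  ≡⟨ cong (_* 1/ι X) (ι-* (count S) _) ⟩
        (ι (count S) * ι (2 ℕ.^ (K ℕ.* i))) * 1/ι X  ≡⟨ regroup (ι (count S)) (ι (2 ℕ.^ (K ℕ.* i))) (1/ι X) ⟩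
        ι (2 ℕ.^ (K ℕ.* i)) * (ι (count S) * 1/ι X)  ≤⟨ *-monoˡ (0≤ι _) (hit-large S u) ⟩
        ι (2 ℕ.^ (K ℕ.* i)) * hit S T u  ∎
        where
        regroup : ∀ a b c → (a * b) * c ≡ b * (a * c)
        regroup = solve-∀ ring

    H : ℕ → ℚ
    -- `X` levels suffice because `X ≤ 2^X`, and their number does not enter the bound of
    -- `scaled-cost-total`.
    H m = ι (T ℕ.* cost X m)

    H-large : ∀ S u m → count S ≡ suc m → ι (suc T′) ≤ H (suc m) * boosted S (suc T′) u
    H-large S u m count≡ = subst (λ t → ι t ≤ H (suc m) * boosted S t u) (≡.sym (suc-pred 1≤T)) main
      where
      X≤ : X ℕ.≤ suc m ℕ.* 2 ℕ.^ (K ℕ.* (i₀ ℕ.+ X))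
      X≤ = ℕ.≤-trans (n≤2^n X) (ℕ.≤-trans
        (ℕ.^-monoʳ-≤ 2 (ℕ.≤-trans (ℕ.m≤n+m X i₀) (ℕ.m≤m+n (i₀ ℕ.+ X) (κ ℕ.* (i₀ ℕ.+ X)))))
        (ℕ.m≤m+n (2 ℕ.^ (K ℕ.* (i₀ ℕ.+ X))) (m ℕ.* 2 ℕ.^ (K ℕ.* (i₀ ℕ.+ X)))))
      main : ι T ≤ H (suc m) * boosted S T u
      main with cost-large X (suc m) X≤
      ... | i , X≤i , ≤cost = begin
        ι T  ≡⟨ ℚ.*-identityʳ (ι T) ⟨
        ι T * 1ℚ  ≤⟨ *-monoˡ (0≤ι T) (boosted-large S u i (subst (λ c → X ℕ.≤ c ℕ.* 2 ℕ.^ (K ℕ.* i)) (≡.sym count≡) X≤i)) ⟩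
        ι T * (ι (2 ℕ.^ (κ ℕ.* i)) * boosted S T u)  ≤⟨ *-monoˡ (0≤ι T) (*-monoʳ (boosted-nonneg S T u) (ι-mono ≤cost)) ⟩
        ι T * (ι (cost X (suc m)) * boosted S T u)  ≡⟨ ℚ.*-assoc (ι T) (ι (cost X (suc m))) (boosted S T u) ⟨
        (ι T * ι (cost X (suc m))) * boosted S T u  ≡⟨ cong (_* boosted S T u) (ι-* T (cost X (suc m))) ⟨
        H (suc m) * boosted S T u  ∎

    open Potential G degree≥1 k T′ H (λ m → 0≤ι (T ℕ.* cost X m)) H-large

    total-H≡ : ∀ m → total-H m ≡ ι (T ℕ.* total (cost X) m)
    total-H≡ zero    = ≡.trans (≡.sym ι-0) (cong ι (≡.sym (ℕ.*-zeroʳ T)))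
    total-H≡ (suc m) = ≡.trans (cong (H (suc m) +_) (total-H≡ m))
      (≡.trans (≡.sym (ι-+ (T ℕ.* cost X (suc m)) (T ℕ.* total (cost X) m)))
        (cong ι (≡.sym (ℕ.*-distribˡ-+ T (cost X (suc m)) (total (cost X) m)))))

    β B : ℕ
    β = T ℕ.* 2 ℕ.^ (κ ℕ.* i₀)
    B = T ℕ.+ X

    total-H≤ : ∀ m → ι (suc T′) + total-H m ≤ ι B + ι β * ι m
    total-H≤ m = begin
      ι (suc T′) + total-H m  ≡⟨ cong₂ _+_ (cong ι (suc-pred 1≤T)) (total-H≡ m) ⟩
      ι T + ι (T ℕ.* total (cost X) m)  ≡⟨ ι-+ T _ ⟨
      ι (T ℕ.+ T ℕ.* total (cost X) m)  ≤⟨ ι-mono (ℕ.+-monoʳ-≤ T (scaled-cost-total T X m i₀-large)) ⟩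
      ι (T ℕ.+ (T ℕ.* (m ℕ.* 2 ℕ.^ (κ ℕ.* i₀)) ℕ.+ X))  ≡⟨ cong ι (rearrange T m (2 ℕ.^ (κ ℕ.* i₀)) X) ⟩
      ι (B ℕ.+ β ℕ.* m)  ≡⟨ ι-+ B _ ⟩
      ι B + ι (β ℕ.* m)  ≡⟨ cong (ι B +_) (ι-* β m) ⟩
      ι B + ι β * ι m  ∎
      where
      rearrange : ∀ T m c X → T ℕ.+ (T ℕ.* (m ℕ.* c) ℕ.+ X) ≡ (T ℕ.+ X) ℕ.+ T ℕ.* c ℕ.* m
      rearrange = ℕ-solve-∀

    -- Every `3 * Q` steps halve the discount of `Ψ`. Since `T ≤ 2^i₀` gives `β ≤ 2^(K i₀)`,
    -- `K * i₀` halvings cancel `β` and leave at most `3 n`. With `Q` linear in `n` and `i₀` of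
    -- order `log log n`, this is the dominant term.
    warm-up-time : ℕ
    warm-up-time = 3 ℕ.* Q ℕ.* (K ℕ.* i₀)

    1≤3Q : 1 ℕ.≤ 3 ℕ.* Q
    1≤3Q = ℕ.*-mono-≤ {1} {3} (s≤s z≤n) 1≤Q

    1≤warm-up-time : 1 ℕ.≤ warm-up-time
    1≤warm-up-time = ℕ.*-mono-≤ 1≤3Q (ℕ.*-mono-≤ {1} {K} (s≤s z≤n) 1≤i₀)

    open Warm-up (1/ι (3 ℕ.* Q)) (p≤q⇒0≤q-p (1/ι≤1 (3 ℕ.* Q))) ψ 1≤ψ ψ≤3 walk-ψ (ι β) (ι B) (0≤ι β) (0≤ι B) total-H≤
    open Process (ℕ.pred warm-up-time)

    β≤2^ : ι β ≤ 2ℚ ^ (K ℕ.* i₀)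
    β≤2^ = begin
      ι β  ≤⟨ ι-mono (ℕ.*-monoˡ-≤ (2 ℕ.^ (κ ℕ.* i₀)) T≤2^i₀) ⟩
      ι (2 ℕ.^ i₀ ℕ.* 2 ℕ.^ (κ ℕ.* i₀))  ≡⟨ cong ι (ℕ.^-distribˡ-+-* 2 i₀ (κ ℕ.* i₀)) ⟨
      ι (2 ℕ.^ (K ℕ.* i₀))  ≡⟨ ι-^ 2 (K ℕ.* i₀) ⟩
      ι 2 ^ (K ℕ.* i₀)  ≡⟨ cong (_^ (K ℕ.* i₀)) ι-2 ⟩
      2ℚ ^ (K ℕ.* i₀)  ∎
      where
      T≤2^i₀ : T ℕ.≤ 2 ℕ.^ i₀
      T≤2^i₀ = ℕ.≤-trans (ℕ.≤-trans (ℕ.≤-reflexive (≡.sym (ℕ.*-identityʳ T))) (ℕ.*-monoʳ-≤ T (2^-positive K))) i₀-large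

    explicit-controller : Controller G K (warm-up-time ℕ.+ (n ℕ.* 3 ℕ.+ B))
    explicit-controller = controller (begin
      ι (suc (ℕ.pred warm-up-time)) + q (suc (ℕ.pred warm-up-time)) * (ι β * (ι n * 3ℚ)) + ι B
        ≡⟨ cong (λ t → ι t + q t * (ι β * (ι n * 3ℚ)) + ι B) (suc-pred 1≤warm-up-time) ⟩
      ι warm-up-time + q warm-up-time * (ι β * (ι n * 3ℚ)) + ι B
        ≤⟨ ℚ.+-monoˡ-≤ (ι B) (ℚ.+-monoʳ-≤ (ι warm-up-time) leftover) ⟩
      ι warm-up-time + ι n * 3ℚ + ι B
        ≡⟨ cong (λ z → ι warm-up-time + ι n * z + ι B) ι-3 ⟨
      ι warm-up-time + ι n * ι 3 + ι B
        ≡⟨ cong (λ z → ι warm-up-time + z + ι B) (ι-* n 3) ⟨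
      ι warm-up-time + ι (n ℕ.* 3) + ι B
        ≡⟨ ℚ.+-assoc (ι warm-up-time) (ι (n ℕ.* 3)) (ι B) ⟩
      ι warm-up-time + (ι (n ℕ.* 3) + ι B)
        ≡⟨ cong (ι warm-up-time +_) (ι-+ (n ℕ.* 3) B) ⟨
      ι warm-up-time + ι (n ℕ.* 3 ℕ.+ B)
        ≡⟨ ι-+ warm-up-time (n ℕ.* 3 ℕ.+ B) ⟨
      ι (warm-up-time ℕ.+ (n ℕ.* 3 ℕ.+ B)) ∎)
      where
      q : ℕ → ℚ
      q t = (1ℚ - 1/ι (3 ℕ.* Q)) ^ t
      0≤3n : 0ℚ ≤ ι n * 3ℚ
      0≤3n = *-nonneg (0≤ι n) (+-nonneg 0≤1 (+-nonneg 0≤1 0≤1))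
      0≤q : 0ℚ ≤ q warm-up-time
      0≤q = ^-nonneg warm-up-time (p≤q⇒0≤q-p (1/ι≤1 (3 ℕ.* Q)))
      regroup : ∀ q b z → q * (b * z) ≡ (b * q) * z
      regroup = solve-∀ ring
      leftover : q warm-up-time * (ι β * (ι n * 3ℚ)) ≤ ι n * 3ℚ
      leftover = begin
        q warm-up-time * (ι β * (ι n * 3ℚ))  ≤⟨ *-monoˡ 0≤q (*-monoʳ 0≤3n β≤2^) ⟩
        q warm-up-time * (2ℚ ^ (K ℕ.* i₀) * (ι n * 3ℚ))  ≡⟨ regroup (q warm-up-time) (2ℚ ^ (K ℕ.* i₀)) (ι n * 3ℚ) ⟩
        (2ℚ ^ (K ℕ.* i₀) * q warm-up-time) * (ι n * 3ℚ)  ≤⟨ *-monoʳ 0≤3n (2^j*[1-1/n]^nj≤1 (K ℕ.* i₀) 1≤3Q) ⟩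
        1ℚ * (ι n * 3ℚ)  ≡⟨ ℚ.*-identityˡ _ ⟩
        ι n * 3ℚ  ∎

  -- Approximation

  half-pos : ∀ {δ} → 0ℚ < δ → 0ℚ < ½ * δ
  half-pos = *-pos (ℚ.positive⁻¹ ½)

  halves : ∀ δ → ½ * δ + ½ * δ ≡ δ
  halves = solve-∀ ring

  ≤-+ : ∀ {p δ} → 0ℚ < δ → p ≤ p + δ
  ≤-+ {p} {δ} 0<δ = ≤-by δ (ℚ.<⇒≤ 0<δ) refl

  shrink : ∀ {B δ} → 0ℚ < B → 0ℚ < δ → ∃ λ η → 0ℚ < η × B * η ≡ δ
  shrink {B} {δ} 0<B 0<δ with inverse 0<B
  ... | q , 0<q , Bq≡1 = q * δ , *-pos 0<q 0<δ , ≡.trans (≡.sym (ℚ.*-assoc B q δ)) (≡.trans (cong (_* δ) Bq≡1) (ℚ.*-identityˡ δ))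

  ≤∣∣ : ∀ p → p ≤ ∣ p ∣
  ≤∣∣ p with ℚ.≤-total 0ℚ p
  ... | inj₁ 0≤p = ℚ.≤-reflexive (≡.sym (ℚ.0≤p⇒∣p∣≡p 0≤p))
  ... | inj₂ p≤0 = ℚ.≤-trans p≤0 (ℚ.0≤∣p∣ p)

  -≤∣∣ : ∀ p → - p ≤ ∣ p ∣
  -≤∣∣ p = subst (- p ≤_) (ℚ.∣-p∣≡∣p∣ p) (≤∣∣ (- p))

  ∣∣≤ : ∀ {p b} → p ≤ b → - p ≤ b → ∣ p ∣ ≤ b
  ∣∣≤ {p} {b} p≤b -p≤b with ℚ.∣p∣≡p∨∣p∣≡-p p
  ... | inj₁ ≡p  = subst (_≤ b) (≡.sym ≡p) p≤b
  ... | inj₂ ≡-p = subst (_≤ b) (≡.sym ≡-p) -p≤b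

  -- For either sign of `p`, one factor is at least `- η` while the other is at most `B`: these are
  -- `q` and `p` if `p ≥ 0`, and `p` and `q` otherwise.
  almost-nonneg-* : ∀ {p q η B} → 0ℚ ≤ p + η → 0ℚ ≤ q + η → p ≤ B → q ≤ B → 0ℚ ≤ B → 0ℚ ≤ η → 0ℚ ≤ p * q + B * η
  almost-nonneg-* {p} {q} {η} {B} 0≤p+η 0≤q+η p≤B q≤B 0≤B 0≤η with ℚ.≤-total 0ℚ p
  ... | inj₁ 0≤p = subst (0ℚ ≤_) (expand p q η B) (+-nonneg (*-nonneg 0≤p 0≤q+η) (*-nonneg (p≤q⇒0≤q-p p≤B) 0≤η))
    where
    expand : ∀ p q η B → p * (q + η) + (B - p) * η ≡ p * q + B * η
    expand = solve-∀ ring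
  ... | inj₂ p≤0 = subst (0ℚ ≤_) (expand p q η B) (+-nonneg (*-nonneg (ℚ.neg-antimono-≤ p≤0) (p≤q⇒0≤q-p q≤B)) (*-nonneg 0≤B 0≤p+η))
    where
    expand : ∀ p q η B → - p * (B - q) + B * (p + η) ≡ p * q + B * η
    expand = solve-∀ ring

  *-bound : ∀ {p q z η B} → ∣ p - q ∣ ≤ η → ∣ z ∣ ≤ B → 0ℚ ≤ B → p * z ≤ q * z + B * η
  *-bound {p} {q} {z} {η} {B} p-q≤η z≤B 0≤B = begin
    p * z  ≡⟨ expand p q z ⟩
    q * z + (p - q) * z  ≤⟨ ℚ.+-monoʳ-≤ (q * z) (≤∣∣ ((p - q) * z)) ⟩
    q * z + ∣ (p - q) * z ∣  ≡⟨ cong (q * z +_) (ℚ.∣p*q∣≡∣p∣*∣q∣ (p - q) z) ⟩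
    q * z + ∣ p - q ∣ * ∣ z ∣  ≤⟨ ℚ.+-monoʳ-≤ (q * z) (*-mono (ℚ.≤-trans (ℚ.0≤∣p∣ (p - q)) p-q≤η) (ℚ.0≤∣p∣ z) p-q≤η z≤B) ⟩
    q * z + η * B  ≡⟨ cong (q * z +_) (ℚ.*-comm η B) ⟩
    q * z + B * η  ∎
    where
    expand : ∀ p q z → p * z ≡ q * z + (p - q) * z
    expand = solve-∀ ring

  +-≤-halves : ∀ {a b c d δ} → a ≤ b + ½ * δ → c ≤ d + ½ * δ → a + c ≤ (b + d) + δ
  +-≤-halves {a} {b} {c} {d} {δ} a≤ c≤ = begin
    a + c  ≤⟨ ℚ.+-mono-≤ a≤ c≤ ⟩
    (b + ½ * δ) + (d + ½ * δ)  ≡⟨ regroup b d (½ * δ) ⟩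
    (b + d) + (½ * δ + ½ * δ)  ≡⟨ cong ((b + d) +_) (halves δ) ⟩
    (b + d) + δ  ∎
    where
    regroup : ∀ b d h → (b + h) + (d + h) ≡ (b + d) + (h + h)
    regroup = solve-∀ ring

  trans-halves : ∀ {a b c δ} → a ≤ b + ½ * δ → b ≤ c + ½ * δ → a ≤ c + δ
  trans-halves {a} {b} {c} {δ} a≤ b≤ = begin
    a  ≤⟨ a≤ ⟩
    b + ½ * δ  ≤⟨ ℚ.+-monoˡ-≤ (½ * δ) b≤ ⟩
    (c + ½ * δ) + ½ * δ  ≡⟨ ℚ.+-assoc c (½ * δ) (½ * δ) ⟩
    c + (½ * δ + ½ * δ)  ≡⟨ cong (c +_) (halves δ) ⟩
    c + δ  ∎

  neg-≤-+ : ∀ {a b δ} → a ≤ b + δ → - b ≤ - a + δ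
  neg-≤-+ {a} {b} {δ} a≤ = subst (_≤ - a + δ) (cancel b δ) (ℚ.+-monoˡ-≤ δ (ℚ.neg-antimono-≤ a≤))
    where
    cancel : ∀ b δ → - (b + δ) + δ ≡ - b
    cancel = solve-∀ ring

  ∣-∣≤ : ∀ {p q δ} → p ≤ q + δ → q ≤ p + δ → ∣ p - q ∣ ≤ δ
  ∣-∣≤ {p} {q} {δ} p≤ q≤ = ∣∣≤ (move p q δ p≤) (subst (_≤ δ) (swap p q) (move q p δ q≤))
    where
    swap : ∀ p q → q - p ≡ - (p - q)
    swap = solve-∀ ring
    cancel : ∀ q δ → (q + δ) - q ≡ δ
    cancel = solve-∀ ring
    move : ∀ p q δ → p ≤ q + δ → p - q ≤ δ
    move p q δ p≤ = subst (p - q ≤_) (cancel q δ) (ℚ.+-monoˡ-≤ (- q) p≤)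

  <-contradicts : ∀ {p q} → q < p → ¬ (p ≤ q + ½ * (p - q))
  <-contradicts {p} {q} q<p p≤ = <⇒≱ {q + ½ * (p - q)} {p} (begin-strict
    q + ½ * (p - q)  ≡⟨ ℚ.+-identityʳ _ ⟨
    q + ½ * (p - q) + 0ℚ  <⟨ ℚ.+-monoʳ-< (q + ½ * (p - q)) (half-pos 0<p-q) ⟩
    q + ½ * (p - q) + ½ * (p - q)  ≡⟨ collect p q ⟩
    p  ∎) p≤
    where
    0<p-q : 0ℚ < p - q
    0<p-q = subst (_< p - q) (ℚ.+-inverseʳ q) (ℚ.+-monoˡ-< (- q) q<p)
    collect : ∀ p q → q + ½ * (p - q) + ½ * (p - q) ≡ p
    collect = solve-∀ ring

  -- Rayleigh quotients from the growth of moments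

  archimedean : ∀ p → ∃ λ N → p ≤ ι N
  archimedean (ℚ.mkℚ i d-1 c) = N , ℚ.toℚᵘ-cancel-≤ (ℚᵘ.≤-respʳ-≃ (ℚᵘ.≃-sym (toℚᵘ-ι N)) (ℚᵘ.*≤* (ℤ.≤-trans
    (ℤ.≤-reflexive (ℤ.*-identityʳ i)) (ℤ.≤-trans (i≤∣i∣ i) (ℤ.≤-trans
    (ℤ.≤-reflexive (≡.sym (ℤ.*-identityʳ (ℤ.+ N)))) (ℤ.*-monoˡ-≤-nonNeg (ℤ.+ N) {ℤ.+ 1} {ℤ.+ suc d-1} (ℤ.+≤+ (s≤s z≤n))))))))
    where
    N = ℤ.∣ i ∣
    i≤∣i∣ : ∀ i → i ℤ.≤ ℤ.+ ℤ.∣ i ∣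
    i≤∣i∣ (ℤ.+ n)    = ℤ.≤-refl
    i≤∣i∣ ℤ.-[1+ n ] = ℤ.-≤+

  square≤0⇒≡0 : ∀ {p} → p * p ≤ 0ℚ → p ≡ 0ℚ
  square≤0⇒≡0 {p} p²≤0 = ℚ.≤-antisym (square-cancel-≤ ℚ.≤-refl p²≤0)
    (subst (0ℚ ≤_) (neg-neg p) (ℚ.neg-antimono-≤ (square-cancel-≤ { - p} ℚ.≤-refl (subst (_≤ 0ℚ) (neg-square p) p²≤0))))
    where
    neg-neg : ∀ p → - - p ≡ p
    neg-neg = solve-∀ ring
    neg-square : ∀ p → p * p ≡ - p * - p
    neg-square = solve-∀ ring

  shifted : ∀ {n} → (Fin n → Fin n → ℚ) → ℚ → Vector ℚ n → Vector ℚ n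
  shifted A s f u = (A · f) u + s * f u

  shifted^ : ∀ {n} → (Fin n → Fin n → ℚ) → ℚ → ℕ → Vector ℚ n → Vector ℚ n
  shifted^ A s zero    f = f
  shifted^ A s (suc j) f = shifted A s (shifted^ A s j f)

  module _ {n : ℕ} {w : Vector ℚ n} {A : Fin n → Fin n → ℚ} (1≤w : ∀ u → 1ℚ ≤ w u) (rev : Reversible w A) where

    private
      0≤w : ∀ u → 0ℚ ≤ w u
      0≤w u = ℚ.≤-trans 0≤1 (1≤w u)

    inner-shifted : ∀ s f g → inner w f (shifted A s g) ≡ inner w f (A · g) + s * inner w f g
    inner-shifted s f g = ≡.trans (inner-+ʳ w f (A · g) (λ u → s * g u)) (cong (inner w f (A · g) +_) (inner-*ʳ w f s g))

    shifted-self-adjoint : ∀ s f g → inner w f (shifted A s g) ≡ inner w (shifted A s f) g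
    shifted-self-adjoint s f g = begin-equality
      inner w f (shifted A s g)  ≡⟨ inner-shifted s f g ⟩
      inner w f (A · g) + s * inner w f g  ≡⟨ cong₂ (λ x y → x + s * y) (≡.trans (self-adjoint {w = w} {A = A} rev f g) (inner-comm w (A · f) g)) (inner-comm w f g) ⟩
      inner w g (A · f) + s * inner w g f  ≡⟨ inner-shifted s g f ⟨
      inner w g (shifted A s f)  ≡⟨ inner-comm w g (shifted A s f) ⟩
      inner w (shifted A s f) g  ∎

    shifted^-self-adjoint : ∀ s i j f g → inner w f (shifted^ A s (i ℕ.+ j) g) ≡ inner w (shifted^ A s i f) (shifted^ A s j g)
    shifted^-self-adjoint s zero    j f g = refl
    shifted^-self-adjoint s (suc i) j f g = begin-equality
      inner w f (shifted A s (shifted^ A s (i ℕ.+ j) g))  ≡⟨ shifted-self-adjoint s f _ ⟩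
      inner w (shifted A s f) (shifted^ A s (i ℕ.+ j) g)  ≡⟨ shifted^-self-adjoint s i j (shifted A s f) g ⟩
      inner w (shifted^ A s i (shifted A s f)) (shifted^ A s j g)  ≡⟨ inner-cong w (λ u → cong (λ h → h u) (commute i)) (λ _ → refl) ⟩
      inner w (shifted A s (shifted^ A s i f)) (shifted^ A s j g)  ∎
      where
      commute : ∀ i → shifted^ A s i (shifted A s f) ≡ shifted A s (shifted^ A s i f)
      commute zero    = refl
      commute (suc i) = cong (shifted A s) (commute i)

    -- By Cauchy–Schwarz the moments ⟨f, Bᴺ f⟩ of B = A + s grow at least like the N-th power of
    -- ⟨f, B f⟩/⟨f, f⟩, for N a power of two.
    moment-growth : ∀ s f m → let a = inner w f f ; β = inner w f (shifted A s f) ; N = 2 ℕ.^ m in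
      0ℚ < a → 0ℚ ≤ β → a * β ^ N ≤ a ^ N * inner w f (shifted^ A s N f)
    moment-growth s f zero    0<a 0≤β = ℚ.≤-reflexive (units (inner w f f) (inner w f (shifted A s f)))
      where
      units : ∀ a b → a * (b * 1ℚ) ≡ (a * 1ℚ) * b
      units = solve-∀ ring
    moment-growth s f (suc m) 0<a 0≤β = *-cancelˡ 0<a (begin
      a * (a * β ^ (2 ℕ.* N))  ≡⟨ cong (λ z → a * (a * z)) (double β) ⟩
      a * (a * (β ^ N * β ^ N))  ≡⟨ regroup a (β ^ N) ⟩
      (a * β ^ N) * (a * β ^ N)  ≤⟨ *-mono (ℚ.≤-trans 0≤aβ^N (moment-growth s f m 0<a 0≤β)) 0≤aβ^N
                                                                (moment-growth s f m 0<a 0≤β) (moment-growth s f m 0<a 0≤β) ⟩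
      (a ^ N * x) * (a ^ N * x)  ≡⟨ regroup′ (a ^ N) x ⟩
      (a ^ N * a ^ N) * (x * x)  ≤⟨ *-monoˡ (*-nonneg (^-nonneg N 0≤a) (^-nonneg N 0≤a)) (cauchy-schwarz w f g 0≤w 0<a) ⟩
      (a ^ N * a ^ N) * (a * inner w g g)  ≡⟨ cong₂ (λ y z → y * (a * z)) (≡.sym (double a)) moment ⟩
      a ^ (2 ℕ.* N) * (a * x₂)  ≡⟨ swap (a ^ (2 ℕ.* N)) a x₂ ⟩
      a * (a ^ (2 ℕ.* N) * x₂)  ∎)
      where
      a = inner w f f
      β = inner w f (shifted A s f)
      N = 2 ℕ.^ m
      g = shifted^ A s N f
      x = inner w f g
      x₂ = inner w f (shifted^ A s (2 ℕ.* N) f)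
      0≤a : 0ℚ ≤ a
      0≤a = ℚ.<⇒≤ 0<a
      0≤aβ^N : 0ℚ ≤ a * β ^ N
      0≤aβ^N = *-nonneg 0≤a (^-nonneg N 0≤β)
      2N≡N+N : 2 ℕ.* N ≡ N ℕ.+ N
      2N≡N+N = cong (ℕ._+_ N) (ℕ.+-identityʳ N)
      double : ∀ p → p ^ (2 ℕ.* N) ≡ p ^ N * p ^ N
      double p = ≡.trans (cong (p ^_) 2N≡N+N) (^-homo-* p N N)
      moment : inner w g g ≡ x₂
      moment = ≡.trans (≡.sym (shifted^-self-adjoint s N N f f)) (cong (λ k → inner w f (shifted^ A s k f)) (≡.sym 2N≡N+N))
      regroup : ∀ a b → a * (a * (b * b)) ≡ (a * b) * (a * b)
      regroup = solve-∀ ring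
      regroup′ : ∀ a b → (a * b) * (a * b) ≡ (a * a) * (b * b)
      regroup′ = solve-∀ ring
      swap : ∀ a b c → a * (b * c) ≡ b * (a * c)
      swap = solve-∀ ring

    -- If the Rayleigh quotient exceeded `κ`, then `moment-growth` would make the moments grow with
    -- a ratio larger than `κ + s`. By Bernoulli the surplus grows at least linearly in the exponent
    -- and eventually exceeds the constant `C`. A vector of norm 0 is treated apart; it vanishes
    -- because `w ≥ 1`.
    rayleigh-≤ : ∀ s κ C f → 0ℚ < κ + s → (∀ j → inner w f (shifted^ A s j f) ≤ C * (κ + s) ^ j) →
      inner w f (A · f) ≤ κ * inner w f f
    rayleigh-≤ s κ C f 0<κ′ moments with 0ℚ ℚ.<? inner w f f
    ... | no  0≮a = ℚ.≤-reflexive (≡.trans vanishing (≡.sym (≡.trans (cong (κ *_) a≡0) (ℚ.*-zeroʳ κ))))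
      where
      f≡0 : ∀ u → f u ≡ 0ℚ
      f≡0 u = square≤0⇒≡0 (begin
        f u * f u  ≡⟨ ℚ.*-identityˡ _ ⟨
        1ℚ * (f u * f u)  ≤⟨ *-monoʳ (square-nonneg (f u)) (1≤w u) ⟩
        w u * (f u * f u)  ≤⟨ term≤sum (λ v → *-nonneg (0≤w v) (square-nonneg (f v))) u ⟩
        inner w f f  ≤⟨ ℚ.≮⇒≥ 0≮a ⟩
        0ℚ  ∎)
      zero-term : ∀ w g → w * (0ℚ * g) ≡ 0ℚ
      zero-term = solve-∀ ring
      inner≡0 : ∀ g → inner w f g ≡ 0ℚ
      inner≡0 g = sum-zero λ u → ≡.trans (cong (λ z → w u * (z * g u)) (f≡0 u)) (zero-term (w u) (g u))
      a≡0 : inner w f f ≡ 0ℚ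
      a≡0 = inner≡0 f
      vanishing : inner w f (A · f) ≡ 0ℚ
      vanishing = inner≡0 (A · f)
    ... | yes 0<a with inner w f (A · f) ℚ.≤? κ * inner w f f
    ...   | yes ≤κa = ≤κa
    ...   | no  ≰κa = contradiction upper (<⇒≱ lower)
      where
      a = inner w f f
      κ′ = κ + s
      β = inner w f (shifted A s f)
      p = κ′ * a
      d = β - p
      0<p : 0ℚ < p
      0<p = *-pos 0<κ′ 0<a
      p<β : p < β
      p<β = begin-strict
        (κ + s) * a  ≡⟨ ℚ.*-distribʳ-+ a κ s ⟩
        κ * a + s * a  <⟨ ℚ.+-monoˡ-< (s * a) (ℚ.≰⇒> ≰κa) ⟩
        inner w f (A · f) + s * a  ≡⟨ inner-shifted s f f ⟨
        β  ∎
      0<d : 0ℚ < d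
      0<d = subst (_< d) (ℚ.+-inverseʳ p) (ℚ.+-monoˡ-< (- p) p<β)
      0≤β : 0ℚ ≤ β
      0≤β = ℚ.<⇒≤ (ℚ.<-trans 0<p p<β)
      restore : ∀ p β → p + (β - p) ≡ β
      restore = solve-∀ ring
      d⁻¹ = proj₁ (inverse 0<d)
      -- Chosen so that `2^m * d > C * κ′`. The exponent has to be a power of two for
      -- `moment-growth`, and `m ≤ 2^m` makes that affordable.
      m = proj₁ (archimedean ((C * κ′ + d) * d⁻¹))
      M′ = ℕ.pred (2 ℕ.^ m)
      sucM′ : suc M′ ≡ 2 ℕ.^ m
      sucM′ = ℕ.suc-pred (2 ℕ.^ m) {{ℕ.m^n≢0 2 m}}
      lower : C * κ′ < ι (suc M′) * d
      lower = begin-strict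
        C * κ′  ≡⟨ ℚ.+-identityʳ _ ⟨
        C * κ′ + 0ℚ  <⟨ ℚ.+-monoʳ-< (C * κ′) 0<d ⟩
        C * κ′ + d  ≡⟨ ℚ.*-identityʳ _ ⟨
        (C * κ′ + d) * 1ℚ  ≡⟨ cong ((C * κ′ + d) *_) (proj₂ (proj₂ (inverse 0<d))) ⟨
        (C * κ′ + d) * (d * d⁻¹)  ≡⟨ regroup (C * κ′ + d) d d⁻¹ ⟩
        ((C * κ′ + d) * d⁻¹) * d  ≤⟨ *-monoʳ (ℚ.<⇒≤ 0<d) (proj₂ (archimedean ((C * κ′ + d) * d⁻¹))) ⟩
        ι m * d  ≤⟨ *-monoʳ (ℚ.<⇒≤ 0<d) (ι-mono (n≤2^n m)) ⟩
        ι (2 ℕ.^ m) * d  ≡⟨ cong (λ N → ι N * d) sucM′ ⟨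
        ι (suc M′) * d  ∎
        where
        regroup : ∀ c d i → c * (d * i) ≡ (c * i) * d
        regroup = solve-∀ ring
      growth : a * β ^ suc M′ ≤ a ^ suc M′ * (C * κ′ ^ suc M′)
      growth = subst (λ N → a * β ^ N ≤ a ^ N * (C * κ′ ^ N)) (≡.sym sucM′)
        (ℚ.≤-trans (moment-growth s f m 0<a 0≤β) (*-monoˡ (^-nonneg (2 ℕ.^ m) (ℚ.<⇒≤ 0<a)) (moments (2 ℕ.^ m))))
      upper : ι (suc M′) * d ≤ C * κ′
      upper = *-cancelˡ (*-pos 0<a (^-pos M′ 0<p)) (begin
        (a * p ^ M′) * (ι (suc M′) * d)  ≤⟨ ≤-by (a * p ^ suc M′) (*-nonneg (ℚ.<⇒≤ 0<a) (^-nonneg (suc M′) (ℚ.<⇒≤ 0<p)))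
                                                                    (regroup a (p ^ M′) (ι (suc M′)) d (p ^ suc M′)) ⟩
        a * (p ^ suc M′ + ι (suc M′) * (p ^ M′ * d))  ≤⟨ *-monoˡ (ℚ.<⇒≤ 0<a) (bernoulli M′ (ℚ.<⇒≤ 0<p) (ℚ.<⇒≤ 0<d)) ⟩
        a * (p + d) ^ suc M′  ≡⟨ cong (λ z → a * z ^ suc M′) (restore p β) ⟩
        a * β ^ suc M′  ≤⟨ growth ⟩
        a ^ suc M′ * (C * κ′ ^ suc M′)  ≡⟨ swap (a ^ suc M′) C (κ′ ^ suc M′) ⟩
        C * (κ′ ^ suc M′ * a ^ suc M′)  ≡⟨ cong (C *_) (^-distrib-* κ′ a (suc M′)) ⟨
        C * (p * p ^ M′)  ≡⟨ regroup′ C κ′ a (p ^ M′) ⟩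
        (a * p ^ M′) * (C * κ′)  ∎)
        where
        regroup : ∀ a q m d r → a * (r + m * (q * d)) ≡ (a * q) * (m * d) + a * r
        regroup = solve-∀ ring
        swap : ∀ x y z → x * (y * z) ≡ y * (z * x)
        swap = solve-∀ ring
        regroup′ : ∀ c k a q → c * ((k * a) * q) ≡ (a * q) * (c * k)
        regroup′ = solve-∀ ring

open Rational

-- The bound in terms of n and the bias

n<2^[1+log₂n] : ∀ n → n ℕ.< 2 ℕ.^ suc ⌊log₂ n ⌋
n<2^[1+log₂n] n = ℕ.≰⇒> λ 2^≤n → ℕ.<-irrefl refl
  (ℕ.≤-trans (ℕ.≤-reflexive (≡.sym (⌊log₂[2^n]⌋≡n (suc ⌊log₂ n ⌋)))) (⌊log₂⌋-mono-≤ 2^≤n))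

log₂n≤n : ∀ n → ⌊log₂ n ⌋ ℕ.≤ n
log₂n≤n n = ℕ.≤-trans (⌊log₂⌋-mono-≤ (n≤2^n n)) (ℕ.≤-reflexive (⌊log₂[2^n]⌋≡n n))

2^m≤n⇒m≤log₂n : ∀ {m n} → 2 ℕ.^ m ℕ.≤ n → m ℕ.≤ ⌊log₂ n ⌋
2^m≤n⇒m≤log₂n {m} 2^m≤n = ℕ.≤-trans (ℕ.≤-reflexive (≡.sym (⌊log₂[2^n]⌋≡n m))) (⌊log₂⌋-mono-≤ 2^m≤n)

relax : ∀ {n} {G : Graph n} {K C C′} → C ℕ.≤ C′ → Controller G K C → Controller G K C′
relax C≤C′ c = record
  { control = control; nonneg = nonneg; total = total; neighbour = neighbour
  ; bound = λ t v → ℚ.≤-trans (bound t v) (ι-mono C≤C′)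
  }
  where open Controller c

module Asymptotics (Δ D : ℕ) (1≤D : 1 ℕ.≤ D) where

  open import Data.Nat using (_+_; _*_; _^_; _≤_)
  open ℕ.≤-Reasoning

  -- `e` gives `T ≤ e * log₂ n`. The 12 is the 3 and 2 of the warm-up time `3 * (2 D Δ² n) * K * i₀`
  -- times the 2 of `i₀ ≤ 2 * loglog n`; the second group collects the terms linear in `n`: the
  -- leftover `3 n`, `T ≤ e n` and `X = 2 Δ n`.
  c e constant : ℕ
  c = 2 * (Δ * Δ)
  e = 2 * D * (c + 2)
  constant = 12 * (D * (Δ * Δ)) + (3 + e + 2 * Δ)

  controller : ∀ k → ∃ λ N → ∀ n → N ≤ n → (G : Graph n) →
    (∀ u → Graph.degree G u ≤ Δ) → HasGap G D →
    Controller G (2 + k) (constant * ((2 + k) * (n * loglog n)))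
  -- From this threshold on `loglog n ≥ e + 1 + K`, so the constants inside `i₀` at most double it;
  -- `K` then survives only as an explicit factor.
  controller k = 2 ^ (2 ^ (e + 1 + K)) , large
    where
    K = 2 + k
    large : ∀ n → 2 ^ (2 ^ (e + 1 + K)) ≤ n → (G : Graph n) →
      (∀ u → Graph.degree G u ≤ Δ) → HasGap G D → Controller G K (constant * (K * (n * loglog n)))
    large n N≤n G degree≤Δ gap = relax total≤
      (Assembly.explicit-controller G Δ D 1≤n 1≤D (degree≥1 G 2≤n) degree≤Δ gap J 1≤J J-large k i₀ 1≤i₀ i₀-large)
      where
      ℓ ℓℓ J i₀ T : ℕ
      ℓ = ⌊log₂ n ⌋
      ℓℓ = loglog n
      -- Exponents whose powers of 2 dominate the factors required: `c` and `n` for `J`; `e`, `ℓ`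
      -- and `2 ^ K` for `i₀`, as `T ≤ e * ℓ`.
      J = c + suc ℓ
      i₀ = e + suc ℓℓ + K
      T = 2 * D * J

      ℓ-large : 2 ^ (e + 1 + K) ≤ ℓ
      ℓ-large = 2^m≤n⇒m≤log₂n N≤n

      ℓℓ-large : e + 1 + K ≤ ℓℓ
      ℓℓ-large = 2^m≤n⇒m≤log₂n ℓ-large

      1≤ℓ : 1 ≤ ℓ
      1≤ℓ = ℕ.≤-trans (2^-positive (e + 1 + K)) ℓ-large

      1≤ℓℓ : 1 ≤ ℓℓ
      1≤ℓℓ = ℕ.≤-trans (ℕ.≤-trans (ℕ.m≤n+m 1 e) (ℕ.m≤m+n (e + 1) K)) ℓℓ-large

      2≤n : 2 ≤ n
      2≤n = ℕ.≤-trans (ℕ.^-monoʳ-≤ 2 (2^-positive (e + 1 + K))) N≤n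

      1≤n : 1 ≤ n
      1≤n = ℕ.≤-trans (s≤s z≤n) 2≤n

      1≤J : 1 ≤ J
      1≤J = ℕ.≤-trans (s≤s z≤n) (ℕ.m≤n+m (suc ℓ) c)

      1≤i₀ : 1 ≤ i₀
      1≤i₀ = ℕ.≤-trans (s≤s z≤n) (ℕ.m≤n+m K (e + suc ℓℓ))

      J-large : 2 * (Δ * Δ * n) ≤ 2 ^ J
      J-large = begin
        2 * (Δ * Δ * n)  ≡⟨ ℕ.*-assoc 2 (Δ * Δ) n ⟨
        c * n  ≤⟨ ℕ.*-mono-≤ (n≤2^n c) (ℕ.<⇒≤ (n<2^[1+log₂n] n)) ⟩
        2 ^ c * 2 ^ suc ℓ  ≡⟨ ℕ.^-distribˡ-+-* 2 c (suc ℓ) ⟨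
        2 ^ J  ∎

      T≤eℓ : T ≤ e * ℓ
      T≤eℓ = begin
        2 * D * (c + suc ℓ)  ≤⟨ ℕ.*-monoʳ-≤ (2 * D) (begin
          c + suc ℓ  ≡⟨ rearrange c ℓ ⟩
          (c + 1) * 1 + ℓ  ≤⟨ ℕ.+-monoˡ-≤ ℓ (ℕ.*-monoʳ-≤ (c + 1) 1≤ℓ) ⟩
          (c + 1) * ℓ + ℓ  ≡⟨ rearrange′ c ℓ ⟩
          (c + 2) * ℓ  ∎) ⟩
        2 * D * ((c + 2) * ℓ)  ≡⟨ ℕ.*-assoc (2 * D) (c + 2) ℓ ⟨
        e * ℓ  ∎
        where
        rearrange : ∀ c ℓ → c + suc ℓ ≡ (c + 1) * 1 + ℓ
        rearrange = ℕ-solve-∀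
        rearrange′ : ∀ c ℓ → (c + 1) * ℓ + ℓ ≡ (c + 2) * ℓ
        rearrange′ = ℕ-solve-∀

      i₀-large : T * 2 ^ K ≤ 2 ^ i₀
      i₀-large = begin
        T * 2 ^ K  ≤⟨ ℕ.*-monoˡ-≤ (2 ^ K) T≤eℓ ⟩
        e * ℓ * 2 ^ K  ≤⟨ ℕ.*-monoˡ-≤ (2 ^ K) (ℕ.*-mono-≤ (n≤2^n e) (ℕ.<⇒≤ (n<2^[1+log₂n] ℓ))) ⟩
        2 ^ e * 2 ^ suc ℓℓ * 2 ^ K  ≡⟨ cong (_* 2 ^ K) (ℕ.^-distribˡ-+-* 2 e (suc ℓℓ)) ⟨
        2 ^ (e + suc ℓℓ) * 2 ^ K  ≡⟨ ℕ.^-distribˡ-+-* 2 (e + suc ℓℓ) K ⟨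
        2 ^ i₀  ∎

      i₀≤2ℓℓ : i₀ ≤ 2 * ℓℓ
      i₀≤2ℓℓ = begin
        e + suc ℓℓ + K  ≡⟨ rearrange e ℓℓ K ⟩
        (e + 1 + K) + ℓℓ  ≤⟨ ℕ.+-monoˡ-≤ ℓℓ ℓℓ-large ⟩
        ℓℓ + ℓℓ  ≡⟨ cong (_+_ ℓℓ) (ℕ.+-identityʳ ℓℓ) ⟨
        2 * ℓℓ  ∎
        where
        rearrange : ∀ e l K → e + suc l + K ≡ (e + 1 + K) + l
        rearrange = ℕ-solve-∀

      n≤Knℓℓ : n ≤ K * (n * ℓℓ)
      n≤Knℓℓ = begin
        n  ≡⟨ ℕ.*-identityʳ n ⟨
        n * 1  ≤⟨ ℕ.*-monoʳ-≤ n 1≤ℓℓ ⟩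
        n * ℓℓ  ≤⟨ ℕ.m≤m+n (n * ℓℓ) (suc k * (n * ℓℓ)) ⟩
        K * (n * ℓℓ)  ∎

      total≤ : 3 * (2 * D * Δ * (Δ * n)) * (K * i₀) + (n * 3 + (T + 2 * (Δ * n))) ℕ.≤
        constant * (K * (n * ℓℓ))
      total≤ = begin
        3 * (2 * D * Δ * (Δ * n)) * (K * i₀) + (n * 3 + (T + 2 * (Δ * n)))
          ≤⟨ ℕ.+-mono-≤ (ℕ.*-monoʳ-≤ (3 * (2 * D * Δ * (Δ * n))) (ℕ.*-monoʳ-≤ K i₀≤2ℓℓ))
               (ℕ.+-monoʳ-≤ (n * 3) (ℕ.+-monoˡ-≤ (2 * (Δ * n)) (ℕ.≤-trans T≤eℓ (ℕ.*-monoʳ-≤ e (log₂n≤n n))))) ⟩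
        3 * (2 * D * Δ * (Δ * n)) * (K * (2 * ℓℓ)) + (n * 3 + (e * n + 2 * (Δ * n)))
          ≡⟨ regroup D Δ n K ℓℓ e ⟩
        12 * (D * (Δ * Δ)) * (K * (n * ℓℓ)) + (3 + e + 2 * Δ) * n
          ≤⟨ ℕ.+-monoʳ-≤ (12 * (D * (Δ * Δ)) * (K * (n * ℓℓ))) (ℕ.*-monoʳ-≤ (3 + e + 2 * Δ) n≤Knℓℓ) ⟩
        12 * (D * (Δ * Δ)) * (K * (n * ℓℓ)) + (3 + e + 2 * Δ) * (K * (n * ℓℓ))
          ≡⟨ ℕ.*-distribʳ-+ (K * (n * ℓℓ)) (12 * (D * (Δ * Δ))) (3 + e + 2 * Δ) ⟨
        constant * (K * (n * ℓℓ)) ∎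
        where
        regroup : ∀ D Δ n K l e → 3 * (2 * D * Δ * (Δ * n)) * (K * (2 * l)) + (n * 3 + (e * n + 2 * (Δ * n)))
          ≡ 12 * (D * (Δ * Δ)) * (K * (n * l)) + (3 + e + 2 * Δ) * n
        regroup = ℕ-solve-∀

open import Defs

-- Real numbers

Eventually : (ℕ → Set) → Set
Eventually P = ∃ λ N → ∀ n → N ℕ.≤ n → P n

map-eventually : ∀ {P Q : ℕ → Set} → (∀ n → P n → Q n) → Eventually P → Eventually Q
map-eventually f (N , p) = N , λ n N≤n → f n (p n N≤n)

both : ∀ {P Q : ℕ → Set} → Eventually P → Eventually Q → Eventually λ n → P n × Q n
both (M , p) (N , q) = M ℕ.⊔ N , λ n M⊔N≤n → p n (ℕ.m⊔n≤o⇒m≤o M N M⊔N≤n) , q n (ℕ.m⊔n≤o⇒n≤o M N M⊔N≤n)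

always : ∀ {P : ℕ → Set} → (∀ n → P n) → Eventually P
always p = 0 , λ n _ → p n

≤-pointwise : ∀ {x y} → (∀ n → seq x n ℚ.≤ seq y n) → x ≤ y
≤-pointwise {x} {y} x≤y = mk≤ λ δ 0<δ → always λ n → ℚ.≤-trans (x≤y n) (≤-+ {seq y n} 0<δ)

≈-pointwise : ∀ {x y} → (∀ n → seq x n ≡ seq y n) → x ≈ y
≈-pointwise x≡y = mk≈ (≤-pointwise λ n → ℚ.≤-reflexive (x≡y n)) (≤-pointwise λ n → ℚ.≤-reflexive (≡.sym (x≡y n)))

≈-eventually : ∀ {x y} → Eventually (λ n → seq x n ≡ seq y n) → x ≈ y
≈-eventually {x} {y} x≡y = mk≈
  (mk≤ λ δ 0<δ → map-eventually (λ n e → subst (λ z → seq x n ℚ.≤ z ℚ.+ δ) e (≤-+ {seq x n} 0<δ)) x≡y)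
  (mk≤ λ δ 0<δ → map-eventually (λ n e → subst (λ z → z ℚ.≤ seq x n ℚ.+ δ) e (≤-+ {seq x n} 0<δ)) x≡y)

≤-refl : ∀ {x} → x ≤ x
≤-refl = ≤-pointwise λ n → ℚ.≤-refl

≤-trans : ∀ {x y z} → x ≤ y → y ≤ z → x ≤ z
≤-trans {x} {y} {z} (mk≤ x≤y) (mk≤ y≤z) = mk≤ λ δ 0<δ →
  map-eventually (λ n (p , q) → trans-halves {seq x n} {seq y n} {seq z n} {δ} p q) (both (x≤y (½ ℚ.* δ) (half-pos 0<δ)) (y≤z (½ ℚ.* δ) (half-pos 0<δ)))

≈-refl : ∀ {x} → x ≈ x
≈-refl = mk≈ ≤-refl ≤-refl

≈-sym : ∀ {x y} → x ≈ y → y ≈ x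
≈-sym (mk≈ x≤y y≤x) = mk≈ y≤x x≤y

≈-trans : ∀ {x y z} → x ≈ y → y ≈ z → x ≈ z
≈-trans (mk≈ x≤y y≤x) (mk≈ y≤z z≤y) = mk≈ (≤-trans x≤y y≤z) (≤-trans z≤y y≤x)

≈⇒≤ : ∀ {x y} → x ≈ y → x ≤ y
≈⇒≤ = _≈_.below

≈⇒≥ : ∀ {x y} → x ≈ y → y ≤ x
≈⇒≥ = _≈_.above

≈⇒near : ∀ {x y} → x ≈ y → ∀ δ → 0ℚ ℚ.< δ → Eventually λ n → ℚ.∣ seq x n ℚ.- seq y n ∣ ℚ.≤ δ
≈⇒near {x} {y} (mk≈ (mk≤ x≤y) (mk≤ y≤x)) δ 0<δ = map-eventually (λ n (p , q) → ∣-∣≤ {seq x n} {seq y n} {δ} p q) (both (x≤y δ 0<δ) (y≤x δ 0<δ))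

+-mono-≤ : ∀ {x y u v} → x ≤ y → u ≤ v → x + u ≤ y + v
+-mono-≤ {x} {y} {u} {v} (mk≤ x≤y) (mk≤ u≤v) = mk≤ λ δ 0<δ →
  map-eventually (λ n (p , q) → +-≤-halves {seq x n} {seq y n} {seq u n} {seq v n} {δ} p q) (both (x≤y (½ ℚ.* δ) (half-pos 0<δ)) (u≤v (½ ℚ.* δ) (half-pos 0<δ)))

neg-mono-≤ : ∀ {x y} → x ≤ y → - y ≤ - x
neg-mono-≤ {x} {y} (mk≤ x≤y) = mk≤ λ δ 0<δ → map-eventually (λ n → neg-≤-+ {seq x n} {seq y n} {δ}) (x≤y δ 0<δ)

bounded : ∀ x → ∃ λ B → 0ℚ ℚ.< B × Eventually λ n → ℚ.∣ seq x n ∣ ℚ.≤ B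
bounded x with cauchy x 1ℚ 0<1
... | N , close = ℚ.∣ seq x N ∣ ℚ.+ 1ℚ , ℚ.+-mono-≤-< (ℚ.0≤∣p∣ (seq x N)) 0<1 , N , λ n N≤n → begin
    ℚ.∣ seq x n ∣  ≡⟨ cong ℚ.∣_∣ (split (seq x n) (seq x N)) ⟩
    ℚ.∣ seq x N ℚ.+ (seq x n ℚ.- seq x N) ∣  ≤⟨ ℚ.∣p+q∣≤∣p∣+∣q∣ (seq x N) (seq x n ℚ.- seq x N) ⟩
    ℚ.∣ seq x N ∣ ℚ.+ ℚ.∣ seq x n ℚ.- seq x N ∣  ≤⟨ ℚ.+-monoʳ-≤ ℚ.∣ seq x N ∣ (close n N N≤n ℕ.≤-refl) ⟩
    ℚ.∣ seq x N ∣ ℚ.+ 1ℚ  ∎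
  where
  open ℚ.≤-Reasoning
  split : ∀ a b → a ≡ b ℚ.+ (a ℚ.- b)
  split = solve-∀ ring

*-congʳ-≤ : ∀ {x y} z → x ≈ y → x * z ≤ y * z
*-congʳ-≤ {x} {y} z x≈y = mk≤ λ δ 0<δ →
  let (B , 0<B , z≤B) = bounded z
      (η , 0<η , Bη≡δ) = shrink 0<B 0<δ
  in map-eventually (λ n (p , q) → subst (λ d → seq x n ℚ.* seq z n ℚ.≤ seq y n ℚ.* seq z n ℚ.+ d) Bη≡δ (*-bound {seq x n} {seq y n} {seq z n} {η} {B} p q (ℚ.<⇒≤ 0<B)))
       (both (≈⇒near x≈y η 0<η) z≤B)

ℝ-ring : CommutativeRing 0ℓ 0ℓ
ℝ-ring = record
  { Carrier = ℝ ; _≈_ = _≈_ ; _+_ = _+_ ; _*_ = _*_ ; -_ = -_ ; 0# = 0ℝ ; 1# = 1ℝ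
  ; isCommutativeRing = record
    { isRing = record
      { +-isAbelianGroup = record
        { isGroup = record
          { isMonoid = record
            { isSemigroup = record
              { isMagma = record
                { isEquivalence = record { refl = ≈-refl ; sym = ≈-sym ; trans = ≈-trans }
                ; ∙-cong = λ { (mk≈ a b) (mk≈ c d) → mk≈ (+-mono-≤ a c) (+-mono-≤ b d) }
                }
              ; assoc = λ x y z → ≈-pointwise λ n → ℚ.+-assoc (seq x n) (seq y n) (seq z n)
              }
            ; identity = (λ x → ≈-pointwise λ n → ℚ.+-identityˡ (seq x n)) , (λ x → ≈-pointwise λ n → ℚ.+-identityʳ (seq x n))
            }
          ; inverse = (λ x → ≈-pointwise λ n → ℚ.+-inverseˡ (seq x n)) , (λ x → ≈-pointwise λ n → ℚ.+-inverseʳ (seq x n))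
          ; ⁻¹-cong = λ { (mk≈ a b) → mk≈ (neg-mono-≤ b) (neg-mono-≤ a) }
          }
        ; comm = λ x y → ≈-pointwise λ n → ℚ.+-comm (seq x n) (seq y n)
        }
      ; *-cong = λ {x} {y} {u} {v} x≈y u≈v → ≈-trans (*-congʳ x≈y) (≈-trans (*-comm y u) (≈-trans (*-congʳ u≈v) (*-comm v y)))
      ; *-assoc = λ x y z → ≈-pointwise λ n → ℚ.*-assoc (seq x n) (seq y n) (seq z n)
      ; *-identity = (λ x → ≈-pointwise λ n → ℚ.*-identityˡ (seq x n)) , (λ x → ≈-pointwise λ n → ℚ.*-identityʳ (seq x n))
      ; distrib = (λ x y z → ≈-pointwise λ n → ℚ.*-distribˡ-+ (seq x n) (seq y n) (seq z n)) ,
                  (λ x y z → ≈-pointwise λ n → ℚ.*-distribʳ-+ (seq x n) (seq y n) (seq z n))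
      }
    ; *-comm = *-comm
    }
  }
  where
  *-comm : ∀ x y → x * y ≈ y * x
  *-comm x y = ≈-pointwise λ n → ℚ.*-comm (seq x n) (seq y n)
  *-congʳ : ∀ {x y z} → x ≈ y → x * z ≈ y * z
  *-congʳ {z = z} x≈y = mk≈ (*-congʳ-≤ z x≈y) (*-congʳ-≤ z (≈-sym x≈y))

*-nonneg-ℝ : ∀ {x y} → 0ℝ ≤ x → 0ℝ ≤ y → 0ℝ ≤ x * y
*-nonneg-ℝ {x} {y} (mk≤ 0≤x) (mk≤ 0≤y) = mk≤ λ δ 0<δ →
  let (A , 0<A , x≤A) = bounded x
      (B , 0<B , y≤B) = bounded y
      0<A+B = ℚ.+-mono-< 0<A 0<B
      (η , 0<η , ≡δ) = shrink 0<A+B 0<δ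
  in map-eventually (λ n ((p , q) , (r , s)) → subst (λ d → 0ℚ ℚ.≤ seq x n ℚ.* seq y n ℚ.+ d) ≡δ
       (almost-nonneg-* {seq x n} {seq y n} {η} {A ℚ.+ B} p q
         (ℚ.≤-trans (≤∣∣ (seq x n)) (ℚ.≤-trans r (≤-+ {A} 0<B)))
         (ℚ.≤-trans (≤∣∣ (seq y n)) (ℚ.≤-trans s (subst (B ℚ.≤_) (ℚ.+-comm B A) (≤-+ {B} 0<A))))
         (ℚ.<⇒≤ 0<A+B) (ℚ.<⇒≤ 0<η)))
     (both (both (0≤x η 0<η) (0≤y η 0<η)) (both x≤A y≤B))

x≤y⇒0≤y-x : ∀ {x y} → x ≤ y → 0ℝ ≤ y - x
x≤y⇒0≤y-x {x} {y} x≤y = ≤-trans (≈⇒≥ (≈-pointwise λ n → ℚ.+-inverseʳ (seq x n))) (+-mono-≤ x≤y (≤-refl { - x}))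

0≤y-x⇒x≤y : ∀ {x y} → 0ℝ ≤ y - x → x ≤ y
0≤y-x⇒x≤y {x} {y} 0≤y-x = ≤-trans (≈⇒≥ (≈-pointwise λ n → ℚ.+-identityʳ (seq x n)))
  (≤-trans (+-mono-≤ (≤-refl {x}) 0≤y-x) (≈⇒≤ (≈-pointwise λ n → restore (seq x n) (seq y n))))
  where
  restore : ∀ a b → a ℚ.+ (b ℚ.- a) ≡ b
  restore = solve-∀ ring

*-monoʳ-ℝ : ∀ {x y z} → 0ℝ ≤ z → x ≤ y → x * z ≤ y * z
*-monoʳ-ℝ {x} {y} {z} 0≤z x≤y = 0≤y-x⇒x≤y (≤-trans (*-nonneg-ℝ (x≤y⇒0≤y-x x≤y) 0≤z)
  (≈⇒≤ (≈-pointwise λ n → expand (seq x n) (seq y n) (seq z n))))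
  where
  expand : ∀ a b c → (b ℚ.- a) ℚ.* c ≡ b ℚ.* c ℚ.- a ℚ.* c
  expand = solve-∀ ring

*-monoˡ-ℝ : ∀ {x y z} → 0ℝ ≤ z → x ≤ y → z * x ≤ z * y
*-monoˡ-ℝ {x} {y} {z} 0≤z x≤y = ≤-trans (≈⇒≤ (≈-pointwise λ n → ℚ.*-comm (seq z n) (seq x n)))
  (≤-trans (*-monoʳ-ℝ 0≤z x≤y) (≈⇒≤ (≈-pointwise λ n → ℚ.*-comm (seq y n) (seq z n))))

fromℚ-mono : ∀ {p q} → p ℚ.≤ q → fromℚ p ≤ fromℚ q
fromℚ-mono p≤q = ≤-pointwise λ _ → p≤q

fromℚ-cong : ∀ {p q} → p ≡ q → fromℚ p ≈ fromℚ q
fromℚ-cong p≡q = ≈-pointwise λ _ → p≡q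

-- If `p > q`, the approximate inequality fails at the tolerance `(p - q)/2`. It is how exact
-- rational bounds are recovered from the spectrum.
fromℚ-cancel : ∀ {p q} → fromℚ p ≤ fromℚ q → p ℚ.≤ q
fromℚ-cancel {p} {q} (mk≤ within) with p ℚ.≤? q
... | yes p≤q = p≤q
... | no  p≰q with within (½ ℚ.* (p ℚ.- q)) (half-pos (subst (ℚ._< p ℚ.- q) (ℚ.+-inverseʳ q) (ℚ.+-monoˡ-< (ℚ.- q) (ℚ.≰⇒> p≰q))))
...   | N , close = contradiction (close N ℕ.≤-refl) (<-contradicts (ℚ.≰⇒> p≰q))

<⇒≤-ℝ : ∀ {x y} → x < y → x ≤ y
<⇒≤-ℝ {x} {y} (mk< gap 0<gap N separated) = mk≤ λ δ 0<δ →
  N , λ n N≤n → ℚ.≤-trans (ℚ.≤-trans (≤-+ {seq x n} 0<gap) (separated n N≤n)) (≤-+ {seq y n} 0<δ)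

<-≤-trans-ℝ : ∀ {x y z} → x < y → y ≤ z → x < z
<-≤-trans-ℝ {x} {y} {z} (mk< gap 0<gap N separated) (mk≤ y≤z) with y≤z (½ ℚ.* gap) (half-pos 0<gap)
... | M , close = mk< (½ ℚ.* gap) (half-pos 0<gap) (N ℕ.⊔ M) λ n N⊔M≤n →
  drop {seq x n} {seq z n} (ℚ.≤-trans (separated n (ℕ.m⊔n≤o⇒m≤o N M N⊔M≤n)) (close n (ℕ.m⊔n≤o⇒n≤o N M N⊔M≤n)))
  where
  cancel : ∀ a h → (a ℚ.+ h) ℚ.- h ≡ a
  cancel = solve-∀ ring
  regroup : ∀ a g → (a ℚ.+ g) ℚ.- ½ ℚ.* g ≡ a ℚ.+ ½ ℚ.* g
  regroup = solve-∀ ring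
  drop : ∀ {a b} → a ℚ.+ gap ℚ.≤ b ℚ.+ ½ ℚ.* gap → a ℚ.+ ½ ℚ.* gap ℚ.≤ b
  drop {a} {b} h = ≡.subst₂ ℚ._≤_ (regroup a gap) (cancel b (½ ℚ.* gap)) (ℚ.+-monoˡ-≤ (ℚ.- (½ ℚ.* gap)) h)

inv-inverse : ∀ x (0<x : 0ℝ < x) → x * inv x 0<x ≈ 1ℝ
inv-inverse x (mk< d 0<d N h) = ≈-eventually (N , λ n N≤n →
  inverseʳ (seq x n) (seq x n ℚ.⊔ d) {{nonZero n}} (ℚ.p≥q⇒p⊔q≡p (subst (ℚ._≤ seq x n) (ℚ.+-identityˡ d) (h n N≤n))))
  where
  inverseʳ : ∀ p r .{{_ : ℚ.NonZero r}} → r ≡ p → p ℚ.* (ℚ.1/ r) ≡ 1ℚ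
  inverseʳ p .p refl = ℚ.*-inverseʳ p
  nonZero : ∀ n → ℚ.NonZero (seq x n ℚ.⊔ d)
  nonZero n = ℚ.pos⇒nonZero (seq x n ℚ.⊔ d) {{ℚ.positive (ℚ.<-≤-trans 0<d (ℚ.p≤q⊔p (seq x n) d))}}

-- Holds at every index, not just eventually, because each denominator is a maximum with a positive
-- rational; `rational-bias` rounds up one single term.
inv-nonneg : ∀ x (0<x : 0ℝ < x) n → 0ℚ ℚ.≤ seq (inv x 0<x) n
inv-nonneg x (mk< d 0<d N h) n = 1/-nonneg (seq x n ℚ.⊔ d) (ℚ.<-≤-trans 0<d (ℚ.p≤q⊔p (seq x n) d))
  where
  1/-nonneg : ∀ p → (0<p : 0ℚ ℚ.< p) → 0ℚ ℚ.≤ (ℚ.1/ p) {{ℚ.pos⇒nonZero p {{ℚ.positive 0<p}}}}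
  1/-nonneg p 0<p = ℚ.<⇒≤ (ℚ.positive⁻¹ ((ℚ.1/ p) {{ℚ.pos⇒nonZero p {{ℚ.positive 0<p}}}}) {{ℚ.1/pos⇒pos p {{ℚ.positive 0<p}}}})

0≤inv : ∀ x (0<x : 0ℝ < x) → 0ℝ ≤ inv x 0<x
0≤inv x 0<x = ≤-pointwise (inv-nonneg x 0<x)

-- The spectral gap

module ℚ-sums = Linear ℚ.+-*-commutativeRing
module ℝ-sums = Linear ℝ-ring
module ℝ-laws = CommutativeRing ℝ-ring

open Exp (CommutativeRing.commutativeSemiring ℚ.+-*-commutativeRing) using (_^_)

≡⇒≈ : ∀ {x y : ℝ} → x ≡ y → x ≈ y
≡⇒≈ refl = ≈-refl

∑≈sum : ∀ {n} (f : Vector ℝ n) → ∑ f ≈ ℝ-sums.sum f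
∑≈sum f = ≡⇒≈ (≡.sym (ℝ-sums.sum-def f))

fromℚ-sum : ∀ {n} (f : Vector ℚ n) → ℝ-sums.sum (λ i → fromℚ (f i)) ≈ fromℚ (ℚ-sums.sum f)
fromℚ-sum {zero}  f = ≈-trans (≡⇒≈ (ℝ-sums.sum-[] (λ i → fromℚ (f i)))) (fromℚ-cong (≡.sym (ℚ-sums.sum-[] f)))
fromℚ-sum {suc n} f = ≈-trans (≡⇒≈ (ℝ-sums.sum-suc (λ i → fromℚ (f i))))
  (≈-trans (ℝ-laws.+-cong {fromℚ (f zero)} {fromℚ (f zero)} ≈-refl (fromℚ-sum (λ i → f (suc i))))
    (≈-pointwise λ _ → ≡.sym (ℚ-sums.sum-suc f)))

fromℚ-· : ∀ {n} (A : Fin n → Fin n → ℚ) (f : Vector ℚ n) u →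
  ((λ u v → fromℚ (A u v)) ℝ-sums.· (λ v → fromℚ (f v))) u ≈ fromℚ ((A ℚ-sums.· f) u)
fromℚ-· A f u = ≈-trans (ℝ-sums.sum-cong λ v → ≈-pointwise λ _ → refl) (fromℚ-sum λ v → A u v ℚ.* f v)

fromℚ-inner : ∀ {n} (w f g : Vector ℚ n) →
  ℝ-sums.inner (λ u → fromℚ (w u)) (λ u → fromℚ (f u)) (λ u → fromℚ (g u)) ≈ fromℚ (ℚ-sums.inner w f g)
fromℚ-inner w f g = ≈-trans (ℝ-sums.sum-cong λ u → ≈-pointwise λ _ → refl) (fromℚ-sum λ u → w u ℚ.* (f u ℚ.* g u))

sum-mono-ℝ : ∀ {n} {f g : Vector ℝ n} → (∀ i → f i ≤ g i) → ℝ-sums.sum f ≤ ℝ-sums.sum g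
sum-mono-ℝ {zero}  {f} {g} f≤g = ≈⇒≤ (≡⇒≈ (≡.trans (ℝ-sums.sum-[] f) (≡.sym (ℝ-sums.sum-[] g))))
sum-mono-ℝ {suc n} {f} {g} f≤g = ≤-trans (≈⇒≤ (≡⇒≈ (ℝ-sums.sum-suc f)))
  (≤-trans (+-mono-≤ (f≤g zero) (sum-mono-ℝ λ i → f≤g (suc i))) (≈⇒≤ (≡⇒≈ (≡.sym (ℝ-sums.sum-suc g)))))

upper-bound : ℝ → ℚ
upper-bound x = proj₁ (bounded x)

0<bound : ∀ x → 0ℚ ℚ.< upper-bound x
0<bound x = proj₁ (proj₂ (bounded x))

≤bound : ∀ x → x ≤ fromℚ (upper-bound x)
≤bound x = mk≤ λ δ 0<δ → map-eventually (λ n ∣x∣≤B → ℚ.≤-trans (≤∣∣ (seq x n)) (ℚ.≤-trans ∣x∣≤B (≤-+ {upper-bound x} 0<δ))) (proj₂ (proj₂ (bounded x)))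

0≤x+bound : ∀ x → 0ℝ ≤ x + fromℚ (upper-bound x)
0≤x+bound x = mk≤ λ δ 0<δ → map-eventually
  (λ n ∣x∣≤B → ℚ.≤-trans (subst (0ℚ ℚ.≤_) (rearrange (seq x n) (upper-bound x)) (p≤q⇒0≤q-p (ℚ.≤-trans (-≤∣∣ (seq x n)) ∣x∣≤B)))
    (≤-+ {seq x n ℚ.+ upper-bound x} 0<δ))
  (proj₂ (proj₂ (bounded x)))
  where
  rearrange : ∀ x b → b ℚ.- ℚ.- x ≡ x ℚ.+ b
  rearrange = solve-∀ ring

recip≈ : ∀ d → recip d ≈ fromℚ (1/ι d)
recip≈ zero    = fromℚ-cong (≡.sym 1/ι-0)
recip≈ (suc d) = fromℚ-cong (≡.sym (1/ι-suc d))

transition≈ : ∀ {n} (G : Graph n) u v → transition G u v ≈ fromℚ (walk G u v)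
transition≈ G u v with Graph._~?_ G u v
... | yes _ = recip≈ (Graph.degree G u)
... | no  _ = ≈-refl

identity≈ : ∀ {n} (u v : Fin n) → identity u v ≈ fromℚ (point v u)
identity≈ u v with u Fin.≟ v
... | yes _ = ≈-refl
... | no  _ = ≈-refl

lazyTransition≈ : ∀ {n} (G : Graph n) u v → lazyTransition G u v ≈ fromℚ (lazy G u v)
lazyTransition≈ G u v = ≈-trans
  (ℝ-laws.*-cong {fromℚ ½} {fromℚ ½} ≈-refl (ℝ-laws.+-cong (identity≈ u v) (transition≈ G u v)))
  (≈-pointwise λ _ → refl)

module Moments {m : ℕ} (G : Graph (suc m)) (degree≥1 : ∀ u → 1 ℕ.≤ Graph.degree G u)
  {λs : Vector ℝ (suc m)} (spectrum : IsSpectrum (lazyTransition G) λs)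
  (μ : ℝ) (0<1-μ : 0ℝ < 1ℝ - μ) (λs≤μ : ∀ i → i ≢ zero → λs i ≤ μ)
  (κ : ℚ) (0≤κ : 0ℚ ℚ.≤ κ) (μ≤κ : μ ≤ fromℚ κ)
  (f : Vector ℚ (suc m)) (f-centred : ℚ-sums.sum (λ u → weight G u ℚ.* f u) ≡ 0ℚ)
  where

  open IsSpectrum spectrum renaming (basis to b)

  private
    L = lazy G
    w = weight G
    A : Fin (suc m) → Fin (suc m) → ℝ
    A u v = fromℚ (L u v)
    ŵ f̂ : Vector ℝ (suc m)
    ŵ u = fromℚ (w u)
    f̂ u = fromℚ (f u)

  1≤weight : ∀ u → 1ℚ ℚ.≤ w u
  1≤weight u = 1≤ι (degree≥1 u)

  0<W : 0ℚ ℚ.< ℚ-sums.sum w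
  0<W = ℚ.<-≤-trans 0<1 (ℚ.≤-trans (1≤weight zero) (term≤sum (λ u → ℚ.≤-trans 0≤1 (1≤weight u)) zero))

  A-reversible : ℝ-sums.Reversible ŵ A
  A-reversible u v = ≈-pointwise λ _ → lazy-reversible G degree≥1 u v

  A-stochastic : ℝ-sums.Stochastic A
  A-stochastic u = ≈-trans (fromℚ-sum (L u)) (fromℚ-cong (lazy-stochastic G degree≥1 u))

  A-eigen : ∀ i u → (A ℝ-sums.· b i) u ≈ λs i * b i u
  A-eigen i u = ≈-trans (ℝ-sums.sum-cong λ v → ℝ-laws.*-cong (≈-sym (lazyTransition≈ G u v)) (≈-refl {b i v}))
    (≈-trans (≈-sym (∑≈sum λ v → lazyTransition G u v * b i v)) (eigenvector i u))

  cancel : ∀ i → i ≢ zero → ∀ x → x * (1ℝ - λs i) ≈ 0ℝ → x ≈ 0ℝ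
  cancel i i≢0 x x[1-λ]≈0 = begin
    x  ≈⟨ ℝ-laws.*-identityʳ x ⟨
    x * 1ℝ  ≈⟨ ℝ-laws.*-cong (≈-refl {x}) (inv-inverse (1ℝ - λs i) 0<1-λ) ⟨
    x * ((1ℝ - λs i) * inv (1ℝ - λs i) 0<1-λ) ≈⟨ ℝ-laws.*-assoc x (1ℝ - λs i) (inv (1ℝ - λs i) 0<1-λ) ⟨
    (x * (1ℝ - λs i)) * inv (1ℝ - λs i) 0<1-λ ≈⟨ ℝ-laws.*-cong x[1-λ]≈0 (≈-refl {inv (1ℝ - λs i) 0<1-λ}) ⟩
    0ℝ * inv (1ℝ - λs i) 0<1-λ  ≈⟨ ℝ-laws.zeroˡ (inv (1ℝ - λs i) 0<1-λ) ⟩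
    0ℝ  ∎
    where
    open SetoidReasoning ℝ-laws.setoid
    0<1-λ : 0ℝ < 1ℝ - λs i
    0<1-λ = <-≤-trans-ℝ 0<1-μ (+-mono-≤ (≤-refl {1ℝ}) (neg-mono-≤ (λs≤μ i i≢0)))

  c : Vector ℝ (suc m)
  c = proj₁ (spanning f̂)

  f≈ : ∀ u → f̂ u ≈ ℝ-sums.sum (λ i → c i * b i u)
  f≈ u = ≈-trans (proj₂ (spanning f̂) u) (∑≈sum λ i → c i * b i u)

  c₀≈0 : c zero ≈ 0ℝ
  c₀≈0 = begin
    c zero  ≈⟨ ℝ-laws.*-identityʳ (c zero) ⟨
    c zero * 1ℝ  ≈⟨ ℝ-laws.*-cong (≈-refl {c zero}) (≈-pointwise {Ŵ * W⁻¹} {1ℝ} λ _ → proj₂ (proj₂ (inverse 0<W))) ⟨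
    c zero * (Ŵ * W⁻¹)  ≈⟨ ℝ-laws.*-assoc (c zero) Ŵ W⁻¹ ⟨
    (c zero * Ŵ) * W⁻¹  ≈⟨ ℝ-laws.*-cong (ℝ-laws.*-cong (≈-refl {c zero}) (fromℚ-sum w)) (≈-refl {W⁻¹}) ⟨
    (c zero * ℝ-sums.sum ŵ) * W⁻¹  ≈⟨ ℝ-laws.*-cong c₀W≈0 (≈-refl {W⁻¹}) ⟩
    0ℝ * W⁻¹  ≈⟨ ℝ-laws.zeroˡ W⁻¹ ⟩
    0ℝ  ∎
    where
    open SetoidReasoning ℝ-laws.setoid
    Ŵ = fromℚ (ℚ-sums.sum w)
    W⁻¹ = fromℚ (proj₁ (inverse 0<W))
    mean≈0 : ℝ-sums.sum (λ u → ŵ u * f̂ u) ≈ 0ℝ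
    mean≈0 = ≈-trans (ℝ-sums.sum-cong λ u → ≈-pointwise λ _ → refl)
      (≈-trans (fromℚ-sum λ u → w u ℚ.* f u) (fromℚ-cong f-centred))
    c₀W≈0 : c zero * ℝ-sums.sum ŵ ≈ 0ℝ
    c₀W≈0 = ℝ-sums.coefficient≈0 {w = ŵ} {A = A} A-reversible A-stochastic b λs zero A-eigen cancel c f̂ f≈
      (proj₁ (spanning λ _ → 1ℝ)) (λ u → ≈-trans (proj₂ (spanning λ _ → 1ℝ) u) (∑≈sum λ i → proj₁ (spanning λ _ → 1ℝ) i * b i u))
      mean≈0

  -- Large enough to make every `λs i + s` non-negative, so that powers of these numbers are
  -- monotone in the eigenvalue; the summand 1 makes `κ + s` positive.
  s : ℚ
  s = 1ℚ ℚ.+ ℚ-sums.sum λ i → upper-bound (λs i)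

  0≤bounds : ∀ i → 0ℚ ℚ.≤ upper-bound (λs i)
  0≤bounds i = ℚ.<⇒≤ (0<bound (λs i))

  0<κ+s : 0ℚ ℚ.< κ ℚ.+ s
  0<κ+s = ℚ.<-≤-trans 0<1 (≤-by (κ ℚ.+ ℚ-sums.sum λ i → upper-bound (λs i)) (+-nonneg 0≤κ (sum-nonneg 0≤bounds))
    (rearrange κ (ℚ-sums.sum λ i → upper-bound (λs i))))
    where
    rearrange : ∀ k x → k ℚ.+ (1ℚ ℚ.+ x) ≡ 1ℚ ℚ.+ (k ℚ.+ x)
    rearrange = solve-∀ ring

  0≤λ+s : ∀ i → 0ℝ ≤ λs i + fromℚ s
  0≤λ+s i = ≤-trans (0≤x+bound (λs i)) (+-mono-≤ (≤-refl {λs i}) (fromℚ-mono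
    (ℚ.≤-trans (term≤sum 0≤bounds i) (≤-by 1ℚ 0≤1 (ℚ.+-comm 1ℚ (ℚ-sums.sum λ i → upper-bound (λs i)))))))

  -- The powers `(λs i + s)^j`, the eigenvalues of the iterated shifted operator.
  r : ℕ → Vector ℝ (suc m)
  r zero    i = 1ℝ
  r (suc j) i = r j i * (λs i + fromℚ s)

  0≤r : ∀ j i → 0ℝ ≤ r j i
  0≤r zero    i = fromℚ-mono 0≤1
  0≤r (suc j) i = *-nonneg-ℝ (0≤r j i) (0≤λ+s i)

  r≤ : ∀ j i → i ≢ zero → r j i ≤ fromℚ ((κ ℚ.+ s) ^ j)
  r≤ zero    i i≢0 = ≤-refl
  r≤ (suc j) i i≢0 = ≤-trans (*-monoʳ-ℝ (0≤λ+s i) (r≤ j i i≢0))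
    (≤-trans (*-monoˡ-ℝ (fromℚ-mono (^-nonneg j (ℚ.<⇒≤ 0<κ+s))) (+-mono-≤ (≤-trans (λs≤μ i i≢0) μ≤κ) (≤-refl {fromℚ s})))
      (≈⇒≤ (≈-pointwise λ _ → ℚ.*-comm ((κ ℚ.+ s) ^ j) (κ ℚ.+ s))))

  expansion : ∀ j u → fromℚ (shifted^ L s j f u) ≈ ℝ-sums.sum (λ i → (c i * r j i) * b i u)
  expansion zero    u = ≈-trans (f≈ u) (ℝ-sums.sum-cong λ i → ℝ-laws.*-cong (≈-sym (ℝ-laws.*-identityʳ (c i))) (≈-refl {b i u}))
  expansion (suc j) u = begin
    fromℚ ((L ℚ-sums.· g) u ℚ.+ s ℚ.* g u)
      ≈⟨ ≈-pointwise (λ _ → refl) ⟩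
    fromℚ ((L ℚ-sums.· g) u) + fromℚ s * fromℚ (g u)
      ≈⟨ ℝ-laws.+-cong (≈-sym (fromℚ-· L g u)) (≈-refl {fromℚ s * fromℚ (g u)}) ⟩
    (A ℝ-sums.· (λ v → fromℚ (g v))) u + fromℚ s * fromℚ (g u)
      ≈⟨ ℝ-laws.+-cong (ℝ-sums.·-cong A (expansion j) u) (ℝ-laws.*-cong (≈-refl {fromℚ s}) (expansion j u)) ⟩
    (A ℝ-sums.· (λ v → ℝ-sums.sum λ i → a i * b i v)) u + fromℚ s * ℝ-sums.sum (λ i → a i * b i u)
      ≈⟨ ℝ-laws.+-cong (ℝ-sums.·-sum A (λ i v → a i * b i v) u) (ℝ-sums.*-sumˡ (fromℚ s) (λ i → a i * b i u)) ⟩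
    ℝ-sums.sum (λ i → (A ℝ-sums.· (λ v → a i * b i v)) u) + ℝ-sums.sum (λ i → fromℚ s * (a i * b i u))
      ≈⟨ ℝ-sums.sum-+ _ _ ⟨
    ℝ-sums.sum (λ i → (A ℝ-sums.· (λ v → a i * b i v)) u + fromℚ s * (a i * b i u))
      ≈⟨ ℝ-sums.sum-cong (λ i → ≈-trans (ℝ-laws.+-cong (≈-trans (ℝ-sums.·-* A (a i) (b i) u) (ℝ-laws.*-cong (≈-refl {a i}) (A-eigen i u))) (≈-refl {fromℚ s * (a i * b i u)})) (collect i)) ⟩
    ℝ-sums.sum (λ i → (c i * (r j i * (λs i + fromℚ s))) * b i u) ∎
    where
    open SetoidReasoning ℝ-laws.setoid
    g = shifted^ L s j f
    a : Vector ℝ (suc m)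
    a i = c i * r j i
    factor : ∀ c r l s b → (c ℚ.* r) ℚ.* (l ℚ.* b) ℚ.+ s ℚ.* ((c ℚ.* r) ℚ.* b) ≡ (c ℚ.* (r ℚ.* (l ℚ.+ s))) ℚ.* b
    factor = solve-∀ ring
    collect : ∀ i → a i * (λs i * b i u) + fromℚ s * (a i * b i u) ≈ (c i * (r j i * (λs i + fromℚ s))) * b i u
    collect i = ≈-pointwise λ n → factor (seq (c i) n) (seq (r j i) n) (seq (λs i) n) s (seq (b i u) n)

  e : Vector ℝ (suc m)
  e i = ℝ-sums.inner ŵ f̂ (b i)

  -- The moment is the sum of `(c i * e i) * r j i`. Without orthogonality the numbers `c i * e i`
  -- may have either sign, but an upper bound that does not depend on `j` is all that a growth rate
  -- asks for.
  C : ℚ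
  C = ℚ-sums.sum λ i → upper-bound (c i * e i)

  coefficient-≤ : ∀ j i → (c i * r j i) * e i ≤ fromℚ (upper-bound (c i * e i) ℚ.* (κ ℚ.+ s) ^ j)
  coefficient-≤ j i with i Fin.≟ zero
  ... | yes refl = ≤-trans (≈⇒≤ vanishing) (fromℚ-mono (*-nonneg (ℚ.<⇒≤ (0<bound (c zero * e zero))) (^-nonneg j (ℚ.<⇒≤ 0<κ+s))))
    where
    open SetoidReasoning ℝ-laws.setoid
    vanishing : (c zero * r j zero) * e zero ≈ 0ℝ
    vanishing = begin
      (c zero * r j zero) * e zero  ≈⟨ ℝ-laws.*-assoc (c zero) (r j zero) (e zero) ⟩
      c zero * (r j zero * e zero)  ≈⟨ ℝ-laws.*-cong c₀≈0 (≈-refl {r j zero * e zero}) ⟩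
      0ℝ * (r j zero * e zero)  ≈⟨ ℝ-laws.zeroˡ (r j zero * e zero) ⟩
      0ℝ  ∎
  ... | no i≢0 = ≤-trans (≈⇒≤ (≈-pointwise λ n → swap (seq (c i) n) (seq (r j i) n) (seq (e i) n)))
      (≤-trans (*-monoʳ-ℝ (0≤r j i) (≤bound (c i * e i)))
        (≤-trans (*-monoˡ-ℝ (fromℚ-mono (ℚ.<⇒≤ (0<bound (c i * e i)))) (r≤ j i i≢0)) (≈⇒≤ (≈-pointwise λ _ → refl))))
    where
    swap : ∀ c r e → (c ℚ.* r) ℚ.* e ≡ (c ℚ.* e) ℚ.* r
    swap = solve-∀ ring

  moment-≤ : ∀ j → ℚ-sums.inner w f (shifted^ L s j f) ℚ.≤ C ℚ.* (κ ℚ.+ s) ^ j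
  moment-≤ j = fromℚ-cancel (≤-trans (≈⇒≤ moment≈) (≤-trans (sum-mono-ℝ (coefficient-≤ j))
    (≈⇒≤ (≈-trans (fromℚ-sum λ i → upper-bound (c i * e i) ℚ.* (κ ℚ.+ s) ^ j) (fromℚ-cong (≡.sym (ℚ-sums.*-sumʳ ((κ ℚ.+ s) ^ j) _)))))))
    where
    open SetoidReasoning ℝ-laws.setoid
    moment≈ : fromℚ (ℚ-sums.inner w f (shifted^ L s j f)) ≈ ℝ-sums.sum (λ i → (c i * r j i) * e i)
    moment≈ = begin
      fromℚ (ℚ-sums.inner w f (shifted^ L s j f))
        ≈⟨ fromℚ-inner w f (shifted^ L s j f) ⟨
      ℝ-sums.inner ŵ f̂ (λ u → fromℚ (shifted^ L s j f u))
        ≈⟨ ℝ-sums.inner-cong ŵ {f̂} {f̂} (λ u → ≈-refl) (expansion j) ⟩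
      ℝ-sums.inner ŵ f̂ (λ u → ℝ-sums.sum λ i → (c i * r j i) * b i u)
        ≈⟨ ℝ-sums.inner-sumʳ ŵ f̂ (λ i u → (c i * r j i) * b i u) ⟩
      ℝ-sums.sum (λ i → ℝ-sums.inner ŵ f̂ (λ u → (c i * r j i) * b i u))
        ≈⟨ ℝ-sums.sum-cong (λ i → ℝ-sums.inner-*ʳ ŵ f̂ (c i * r j i) (b i)) ⟩
      ℝ-sums.sum (λ i → (c i * r j i) * e i) ∎

-- From `1/(1 - μ) ≤ D` follows `μ ≤ 1 - 1/D`, and by the ordering every eigenvalue except the first
-- is at most `μ`; the first has coefficient 0 in a centred `f`.
relaxation⇒gap : ∀ {n} (G : Graph n) → (∀ u → 1 ℕ.≤ Graph.degree G u) → ∀ {t D} → 1 ℕ.≤ D →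
  IsRelaxationTime G t → t ≤ fromℚ (ι D) → HasGap G D
relaxation⇒gap {zero} G degree≥1 1≤D (μ , (λs , spectrum , () , _ , _) , _) t≤D
relaxation⇒gap {suc m} G degree≥1 {t} {D} 1≤D (μ , (λs , spectrum , i₁ , i₁≡1 , μ≈λ₁) , 0<1-μ , t≈) t≤D f f-centred =
  rayleigh-≤ {w = weight G} {A = lazy G} 1≤weight (lazy-reversible G degree≥1) s (1ℚ ℚ.- 1/ι D) C f 0<κ+s moment-≤
  where
  λs≤μ : ∀ i → i ≢ zero → λs i ≤ μ
  λs≤μ zero    i≢0 = contradiction refl i≢0
  λs≤μ (suc i) _   = ≤-trans (IsSpectrum.ordered spectrum (subst (ℕ._≤ suc (Fin.toℕ i)) (≡.sym i₁≡1) (s≤s z≤n))) (≈⇒≥ μ≈λ₁)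
  1≤[1-μ]D : 1ℝ ≤ (1ℝ - μ) * fromℚ (ι D)
  1≤[1-μ]D = ≤-trans (≈⇒≥ (inv-inverse (1ℝ - μ) 0<1-μ))
    (*-monoˡ-ℝ (<⇒≤-ℝ 0<1-μ) (≤-trans (≈⇒≥ t≈) t≤D))
  1/D≤1-μ : fromℚ (1/ι D) ≤ 1ℝ - μ
  1/D≤1-μ = ≤-trans (≈⇒≥ (ℝ-laws.*-identityˡ (fromℚ (1/ι D))))
    (≤-trans (*-monoʳ-ℝ (fromℚ-mono (0≤1/ι D)) 1≤[1-μ]D)
      (≈⇒≤ (≈-trans (ℝ-laws.*-assoc (1ℝ - μ) (fromℚ (ι D)) (fromℚ (1/ι D)))
        (≈-trans (ℝ-laws.*-cong (≈-refl {1ℝ - μ}) (≈-pointwise {fromℚ (ι D) * fromℚ (1/ι D)} {1ℝ} λ _ → ι*1/ι 1≤D)) (ℝ-laws.*-identityʳ (1ℝ - μ))))))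
  μ≤κ : μ ≤ fromℚ (1ℚ ℚ.- 1/ι D)
  μ≤κ = ≤-trans (≈⇒≤ (≈-pointwise {μ} {1ℝ - (1ℝ - μ)} λ n → double-negation (seq μ n)))
    (≤-trans (+-mono-≤ (≤-refl {1ℝ}) (neg-mono-≤ 1/D≤1-μ))
      (≈⇒≤ (≈-pointwise {1ℝ - fromℚ (1/ι D)} {fromℚ (1ℚ ℚ.- 1/ι D)} λ _ → refl)))
    where
    double-negation : ∀ x → x ≡ 1ℚ ℚ.- (1ℚ ℚ.- x)
    double-negation = solve-∀ ring
  open Moments G degree≥1 spectrum μ 0<1-μ λs≤μ (1ℚ ℚ.- 1/ι D) (p≤q⇒0≤q-p (1/ι≤1 D)) μ≤κ f f-centred

-- From rational to real bias

ceiling : ∀ {q} → 0ℚ ℚ.≤ q → ∃ λ k → q ℚ.≤ ι k × ι k ℚ.≤ 1ℚ ℚ.+ q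
ceiling {q} 0≤q = search (proj₁ (archimedean q)) (proj₂ (archimedean q))
  where
  search : ∀ M → q ℚ.≤ ι M → ∃ λ k → q ℚ.≤ ι k × ι k ℚ.≤ 1ℚ ℚ.+ q
  search zero    q≤0 = 0 , q≤0 , subst (ℚ._≤ 1ℚ ℚ.+ q) (≡.sym ι-0) (+-nonneg 0≤1 0≤q)
  search (suc M) q≤M with q ℚ.≤? ι M
  ... | yes q≤M = search M q≤M
  ... | no  q≰M = suc M , q≤M , subst (ℚ._≤ 1ℚ ℚ.+ q) (≡.sym (ι-suc M)) (ℚ.+-monoʳ-≤ 1ℚ (ℚ.<⇒≤ (ℚ.≰⇒> q≰M)))

fromℕ≡ : ∀ n → fromℕ n ≡ fromℚ (ι n)
fromℕ≡ n = cong fromℚ (≡.sym (ι-def n))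

-- When given the choice, the controller will act only with probability 1/(Kε); this turns the
-- bias ε into the rational bias 1/K.
rational-bias : ∀ ε (ε>0 : 0ℝ < ε) → ε ≤ 1ℝ → ∃ λ k →
  inv ε ε>0 ≤ fromℚ (ι (2 ℕ.+ k)) × fromℚ (ι (2 ℕ.+ k)) ≤ fromℚ (ι 5) * inv ε ε>0
rational-bias ε ε>0 ε≤1 with cauchy (inv ε ε>0) 1ℚ 0<1
... | N , close with ceiling (inv-nonneg ε ε>0 N)
...   | k , q≤k , k≤1+q = k , y≤K , K≤5y
  where
  y = inv ε ε>0
  q = seq y N
  1≤y : 1ℝ ≤ y
  1≤y = ≤-trans (≈⇒≥ (inv-inverse ε ε>0)) (≤-trans (*-monoʳ-ℝ (0≤inv ε ε>0) ε≤1) (≈⇒≤ (ℝ-laws.*-identityˡ y)))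
  add : ∀ {a b} → a ℚ.- b ℚ.≤ 1ℚ → a ℚ.≤ b ℚ.+ 1ℚ
  add {a} {b} a-b≤1 = ≡.subst₂ ℚ._≤_ (restore a b) (ℚ.+-comm 1ℚ b) (ℚ.+-monoˡ-≤ b a-b≤1)
    where
    restore : ∀ a b → a ℚ.- b ℚ.+ b ≡ a
    restore = solve-∀ ring
  y≤q+1 : y ≤ fromℚ (q ℚ.+ 1ℚ)
  y≤q+1 = mk≤ λ δ 0<δ → N , λ n N≤n →
    ℚ.≤-trans (add (ℚ.≤-trans (≤∣∣ (seq y n ℚ.- q)) (close n N N≤n ℕ.≤-refl))) (≤-+ {q ℚ.+ 1ℚ} 0<δ)
  q≤y+1 : fromℚ q ≤ y + 1ℝ
  q≤y+1 = mk≤ λ δ 0<δ → N , λ n N≤n →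
    ℚ.≤-trans (add (ℚ.≤-trans (≤∣∣ (q ℚ.- seq y n)) (close N n ℕ.≤-refl N≤n))) (≤-+ {seq y n ℚ.+ 1ℚ} 0<δ)
  ι-2+k : ι (2 ℕ.+ k) ≡ 2ℚ ℚ.+ ι k
  ι-2+k = ≡.trans (ι-+ 2 k) (cong (ℚ._+ ι k) ι-2)
  y≤K : y ≤ fromℚ (ι (2 ℕ.+ k))
  y≤K = ≤-trans y≤q+1 (fromℚ-mono (subst (q ℚ.+ 1ℚ ℚ.≤_) (≡.sym ι-2+k)
    (≤-by _ (+-nonneg (p≤q⇒0≤q-p q≤k) 0≤1) (rearrange q (ι k)))))
    where
    rearrange : ∀ q k → 2ℚ ℚ.+ k ≡ q ℚ.+ 1ℚ ℚ.+ (k ℚ.- q ℚ.+ 1ℚ)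
    rearrange = solve-∀ ring
  K≤q+3 : ι (2 ℕ.+ k) ℚ.≤ q ℚ.+ 3ℚ
  K≤q+3 = subst (ℚ._≤ q ℚ.+ 3ℚ) (≡.sym ι-2+k)
    (≤-by _ (p≤q⇒0≤q-p k≤1+q) (rearrange q (ι k)))
    where
    rearrange : ∀ q k → q ℚ.+ 3ℚ ≡ 2ℚ ℚ.+ k ℚ.+ (1ℚ ℚ.+ q ℚ.- k)
    rearrange = solve-∀ ring
  ι-5 : ι 5 ≡ 2ℚ ℚ.+ 3ℚ
  ι-5 = ≡.trans (ι-+ 2 3) (cong₂ ℚ._+_ ι-2 ι-3)
  4ℝ = fromℚ (1ℚ ℚ.+ 3ℚ)
  0≤4 : 0ℚ ℚ.≤ 1ℚ ℚ.+ 3ℚ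
  0≤4 = +-nonneg 0≤1 (+-nonneg 0≤1 (+-nonneg 0≤1 0≤1))
  -- `K ≤ q + 3 ≤ y + 4`, and `ε ≤ 1` gives `1 ≤ y`, whence the factor 5.
  K≤5y : fromℚ (ι (2 ℕ.+ k)) ≤ fromℚ (ι 5) * y
  K≤5y = ≤-trans (fromℚ-mono K≤q+3)
    (≤-trans (≈⇒≤ (≈-pointwise {fromℚ (q ℚ.+ 3ℚ)} {fromℚ q + fromℚ 3ℚ} λ _ → refl))
    (≤-trans (+-mono-≤ q≤y+1 (≤-refl {fromℚ 3ℚ}))
    (≤-trans (≈⇒≤ (≈-pointwise {y + 1ℝ + fromℚ 3ℚ} {y + 4ℝ * 1ℝ} λ n → regroup (seq y n)))
    (≤-trans (+-mono-≤ (≤-refl {y}) (*-monoˡ-ℝ (fromℚ-mono 0≤4) 1≤y))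
    (≈⇒≤ (≈-pointwise {y + 4ℝ * y} {fromℚ (ι 5) * y} λ n → ≡.trans (collect (seq y n)) (cong (ℚ._* seq y n) (≡.sym ι-5))))))))
    where
    regroup : ∀ y → y ℚ.+ 1ℚ ℚ.+ 3ℚ ≡ y ℚ.+ (1ℚ ℚ.+ 3ℚ) ℚ.* 1ℚ
    regroup = solve-∀ ring
    collect : ∀ y → y ℚ.+ (1ℚ ℚ.+ 3ℚ) ℚ.* y ≡ (2ℚ ℚ.+ 3ℚ) ℚ.* y
    collect = solve-∀ ring

module Simulation {n : ℕ} (G : Graph n) (degree≥1 : ∀ u → 1 ℕ.≤ Graph.degree G u)
  (ε : ℝ) (ε>0 : 0ℝ < ε) (K : ℕ) (1≤K : 1 ℕ.≤ K) (1/ε≤K : inv ε ε>0 ≤ fromℚ (ι K))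
  {C : ℕ} (controller : Controller G K C)
  where

  open Controller controller

  θ : ℝ
  θ = fromℚ (1/ι K) * inv ε ε>0

  0≤θ : 0ℝ ≤ θ
  0≤θ = *-nonneg-ℝ (fromℚ-mono (0≤1/ι K)) (0≤inv ε ε>0)

  θ≤1 : θ ≤ 1ℝ
  θ≤1 = ≤-trans (*-monoˡ-ℝ (fromℚ-mono (0≤1/ι K)) 1/ε≤K)
    (≈⇒≤ (≈-pointwise {fromℚ (1/ι K) * fromℚ (ι K)} {1ℝ} λ _ → 1/ι*ι 1≤K))

  εθ≈1/K : ε * θ ≈ fromℚ (1/ι K)
  εθ≈1/K = ≈-trans (≈-pointwise {ε * θ} {fromℚ (1/ι K) * (ε * inv ε ε>0)} λ m → swap (seq ε m) (1/ι K) (seq (inv ε ε>0) m))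
    (≈-trans (ℝ-laws.*-cong (≈-refl {fromℚ (1/ι K)}) (inv-inverse ε ε>0)) (ℝ-laws.*-identityʳ (fromℚ (1/ι K))))
    where
    swap : ∀ a b c → a ℚ.* (b ℚ.* c) ≡ b ℚ.* (a ℚ.* c)
    swap = solve-∀ ring

  transition-nonneg : ∀ u v → 0ℝ ≤ transition G u v
  transition-nonneg u v = ≤-trans (fromℚ-mono (walk-nonneg G u v)) (≈⇒≥ (transition≈ G u v))

  mixture : List (Fin n) → Fin n → Fin n → ℝ
  mixture past u v = (1ℝ - θ) * transition G u v + θ * fromℚ (control past u v)

  mixture-total : ∀ past u → ∑ (mixture past u) ≈ 1ℝ
  mixture-total past u = begin
    ∑ (mixture past u)
      ≈⟨ ∑≈sum (mixture past u) ⟩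
    ℝ-sums.sum (mixture past u)
      ≈⟨ ℝ-sums.sum-+ (λ v → (1ℝ - θ) * transition G u v) (λ v → θ * fromℚ (control past u v)) ⟩
    ℝ-sums.sum (λ v → (1ℝ - θ) * transition G u v) + ℝ-sums.sum (λ v → θ * fromℚ (control past u v))
      ≈⟨ ℝ-laws.+-cong (ℝ-sums.*-sumˡ (1ℝ - θ) (transition G u)) (ℝ-sums.*-sumˡ θ (λ v → fromℚ (control past u v))) ⟨
    (1ℝ - θ) * ℝ-sums.sum (transition G u) + θ * ℝ-sums.sum (λ v → fromℚ (control past u v))
      ≈⟨ ℝ-laws.+-cong (ℝ-laws.*-cong (≈-refl {1ℝ - θ}) transition-total) (ℝ-laws.*-cong (≈-refl {θ}) control-total) ⟩
    (1ℝ - θ) * 1ℝ + θ * 1ℝ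
      ≈⟨ ≈-pointwise {(1ℝ - θ) * 1ℝ + θ * 1ℝ} {1ℝ} (λ m → collect (seq θ m)) ⟩
    1ℝ ∎
    where
    open SetoidReasoning ℝ-laws.setoid
    collect : ∀ a → (1ℚ ℚ.- a) ℚ.* 1ℚ ℚ.+ a ℚ.* 1ℚ ≡ 1ℚ
    collect = solve-∀ ring
    transition-total : ℝ-sums.sum (transition G u) ≈ 1ℝ
    transition-total = ≈-trans (ℝ-sums.sum-cong (transition≈ G u)) (≈-trans (fromℚ-sum (walk G u)) (fromℚ-cong (walk-stochastic G degree≥1 u)))
    control-total : ℝ-sums.sum (λ v → fromℚ (control past u v)) ≈ 1ℝ
    control-total = ≈-trans (fromℚ-sum (control past u)) (fromℚ-cong (total past u))

  strategy : Strategy G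
  strategy = record
    { choice       = mixture
    ; nonneg       = λ past u v → ≤-trans (≈⇒≥ (ℝ-laws.+-identityˡ 0ℝ)) (+-mono-≤
        (*-nonneg-ℝ (x≤y⇒0≤y-x θ≤1) (transition-nonneg u v))
        (*-nonneg-ℝ 0≤θ (fromℚ-mono (nonneg past u v))))
    ; total        = mixture-total
    ; to-neighbour = λ past u v u≁v → ≈-trans
        (ℝ-laws.+-cong
          (≈-trans (ℝ-laws.*-cong (≈-refl {1ℝ - θ}) (≈-trans (transition≈ G u v) (fromℚ-cong (walk-off-edge G u v u≁v)))) (ℝ-laws.zeroʳ (1ℝ - θ)))
          (≈-trans (ℝ-laws.*-cong (≈-refl {θ}) (fromℚ-cong (neighbour past u v u≁v))) (ℝ-laws.zeroʳ θ)))
        (ℝ-laws.+-identityˡ 0ℝ)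
    }

  open TBRW G ε strategy

  -- The control is diluted twice, by ε and by `θ`, and only the product `ε θ = 1/K` matters; the
  -- rest of the mass is the simple walk either way.
  step≈ : ∀ past u v → step past u v ≈ fromℚ (law past u v)
  step≈ past u v = begin
    (1ℝ - ε) * t + ε * ((1ℝ - θ) * t + θ * g)
      ≈⟨ ≈-pointwise {(1ℝ - ε) * t + ε * ((1ℝ - θ) * t + θ * g)} {(1ℝ - ε * θ) * t + (ε * θ) * g} (λ m → collect (seq ε m) (seq θ m) (seq t m) (seq g m)) ⟩
    (1ℝ - ε * θ) * t + (ε * θ) * g
      ≈⟨ ℝ-laws.+-cong (ℝ-laws.*-cong (ℝ-laws.+-cong (≈-refl {1ℝ}) (ℝ-laws.-‿cong εθ≈1/K)) (transition≈ G u v)) (ℝ-laws.*-cong εθ≈1/K (≈-refl {g})) ⟩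
    (1ℝ - fromℚ (1/ι K)) * fromℚ (walk G u v) + fromℚ (1/ι K) * g
      ≈⟨ ≈-pointwise {(1ℝ - fromℚ (1/ι K)) * fromℚ (walk G u v) + fromℚ (1/ι K) * g} {fromℚ (law past u v)} (λ _ → refl) ⟩
    fromℚ (law past u v) ∎
    where
    open SetoidReasoning ℝ-laws.setoid
    t = transition G u v
    g = fromℚ (control past u v)
    collect : ∀ e a t g → (1ℚ ℚ.- e) ℚ.* t ℚ.+ e ℚ.* ((1ℚ ℚ.- a) ℚ.* t ℚ.+ a ℚ.* g) ≡ (1ℚ ℚ.- e ℚ.* a) ℚ.* t ℚ.+ (e ℚ.* a) ℚ.* g
    collect = solve-∀ ring

  𝔼≈ : ∀ T (f : List (Fin n) → Fin n → ℕ) past u →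
    𝔼 T (λ past u → fromℕ (f past u)) past u ≈ fromℚ (expect law T (λ past u → ι (f past u)) past u)
  𝔼≈ zero    f past u = ≡⇒≈ (fromℕ≡ (f past u))
  𝔼≈ (suc T) f past u = begin
    ∑ (λ v → step past u v * 𝔼 T (λ past u → fromℕ (f past u)) (u ∷ past) v)
      ≈⟨ ∑≈sum (λ v → step past u v * 𝔼 T (λ past u → fromℕ (f past u)) (u ∷ past) v) ⟩
    ℝ-sums.sum (λ v → step past u v * 𝔼 T (λ past u → fromℕ (f past u)) (u ∷ past) v)
      ≈⟨ ℝ-sums.sum-cong (λ v → ≈-trans (ℝ-laws.*-cong (step≈ past u v) (𝔼≈ T f (u ∷ past) v))
           (≈-pointwise {fromℚ (law past u v) * fromℚ (rest v)} {fromℚ (law past u v ℚ.* rest v)} λ _ → refl)) ⟩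
    ℝ-sums.sum (λ v → fromℚ (law past u v ℚ.* rest v))
      ≈⟨ fromℚ-sum (λ v → law past u v ℚ.* rest v) ⟩
    fromℚ (ℚ-sums.sum λ v → law past u v ℚ.* rest v) ∎
    where
    open SetoidReasoning ℝ-laws.setoid
    rest : Vector ℚ n
    rest v = expect law T (λ past u → ι (f past u)) (u ∷ past) v

  coverTime≤ : ∀ {B} → fromℚ (ι C) ≤ B → coverTime G ε ≤ᵘ B
  -- The same strategy serves every starting vertex.
  coverTime≤ C≤B v = strategy , λ T →
    ≤-trans (≈⇒≤ (𝔼≈ T (truncatedCoverTime G) [] v)) (≤-trans (fromℚ-mono (bound T v)) C≤B)

two-vertices : ∀ {n} (G : Graph n) {t} → IsRelaxationTime G t → 2 ℕ.≤ n
two-vertices {n} G (_ , (_ , _ , i₁ , i₁≡1 , _) , _) = subst (λ i → suc i ℕ.≤ n) i₁≡1 (Fin.toℕ<n i₁)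

rescale : ∀ c K n l {y} → fromℚ (ι K) ≤ fromℚ (ι 5) * y →
  fromℚ (ι (c ℕ.* (K ℕ.* (n ℕ.* l)))) ≤ fromℕ (c ℕ.* 5) * (fromℕ n * y) * fromℕ l
rescale c K n l {y} K≤5y = ≤-trans (≈⇒≤ (≈-pointwise {fromℚ (ι (c ℕ.* (K ℕ.* (n ℕ.* l))))} {fromℚ x * fromℚ (ι K)} λ _ → split))
  (≤-trans (*-monoˡ-ℝ (fromℚ-mono (*-nonneg (0≤ι c) (*-nonneg (0≤ι n) (0≤ι l)))) K≤5y)
  (≈⇒≤ (≈-pointwise {fromℚ x * (fromℚ (ι 5) * y)} {fromℕ (c ℕ.* 5) * (fromℕ n * y) * fromℕ l} λ m → combine (seq y m))))
  where
  x = ι c ℚ.* (ι n ℚ.* ι l)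
  split : ι (c ℕ.* (K ℕ.* (n ℕ.* l))) ≡ x ℚ.* ι K
  split = ≡.trans (ι-* c _) (≡.trans (cong (ι c ℚ.*_) (≡.trans (ι-* K _) (cong (ι K ℚ.*_) (ι-* n l))))
    (rearrange (ι c) (ι K) (ι n) (ι l)))
    where
    rearrange : ∀ c k n l → c ℚ.* (k ℚ.* (n ℚ.* l)) ≡ (c ℚ.* (n ℚ.* l)) ℚ.* k
    rearrange = solve-∀ ring
  combine : ∀ z → x ℚ.* (ι 5 ℚ.* z) ≡ (ℤ.+ (c ℕ.* 5) ℚ./ 1) ℚ.* ((ℤ.+ n ℚ./ 1) ℚ.* z) ℚ.* (ℤ.+ l ℚ./ 1)
  combine z = ≡.trans (rearrange (ι c) (ι 5) (ι n) (ι l) z)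
    (cong₂ ℚ._*_ (cong₂ ℚ._*_ (≡.trans (≡.sym (ι-* c 5)) (ι-def (c ℕ.* 5))) (cong (ℚ._* z) (ι-def n))) (ι-def l))
    where
    rearrange : ∀ c f n l z → (c ℚ.* (n ℚ.* l)) ℚ.* (f ℚ.* z) ≡ (c ℚ.* f) ℚ.* (n ℚ.* z) ℚ.* l
    rearrange = solve-∀ ring

coverTime-bound : ∀ {n} {G : Graph n} {Δ D ε t C} (ε>0 : 0ℝ < ε) → 1 ℕ.≤ D → ∀ k →
  inv ε ε>0 ≤ fromℚ (ι (2 ℕ.+ k)) → fromℚ (ι (2 ℕ.+ k)) ≤ fromℚ (ι 5) * inv ε ε>0 →
  (∀ u → Graph.degree G u ℕ.≤ Δ) → IsRelaxationTime G t → t ≤ fromℚ (ι D) →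
  ((∀ u → Graph.degree G u ℕ.≤ Δ) → HasGap G D → Controller G (2 ℕ.+ k) (C ℕ.* ((2 ℕ.+ k) ℕ.* (n ℕ.* loglog n)))) →
  coverTime G ε ≤ᵘ fromℕ (C ℕ.* 5) * (fromℕ n * inv ε ε>0) * fromℕ (loglog n)
coverTime-bound {n} {G} {ε = ε} {C = C} ε>0 1≤D k 1/ε≤K K≤5/ε degree≤Δ relaxation-time t≤D controller =
  Simulation.coverTime≤ G degrees ε ε>0 (2 ℕ.+ k) (s≤s z≤n) 1/ε≤K
    (controller degree≤Δ (relaxation⇒gap G degrees 1≤D relaxation-time t≤D))
    (rescale C (2 ℕ.+ k) n (loglog n) K≤5/ε)
  where
  degrees : ∀ u → 1 ℕ.≤ Graph.degree G u
  degrees = degree≥1 G (two-vertices G relaxation-time)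

corollary3p3 :
    (G : ∀ n → Graph n) → BoundedDegree G → Expanders G →
    ∃ λ (C : ℝ) →
    (ε : ℝ) → (ε>0 : 0ℝ < ε) → ε ≤ 1ℝ →
    ∃ λ (N : ℕ) → ∀ n → N ℕ.≤ n →
    coverTime (G n) ε ≤ᵘ C * (fromℕ n * inv ε ε>0) * fromℕ (loglog n)
corollary3p3 G (Δ , degree≤Δ) (_ , t-max , _ , N₁ , relaxation) = fromℕ (constant Δ D 1≤D ℕ.* 5) , uniform
  where
  open Asymptotics

  D : ℕ
  -- The successor ensures `1 ≤ D`.
  D = suc (proj₁ (archimedean (upper-bound t-max)))

  1≤D : 1 ℕ.≤ D
  1≤D = s≤s z≤n

  t-max≤D : t-max ≤ fromℚ (ι D)
  t-max≤D = ≤-trans (≤bound t-max) (fromℚ-mono (ℚ.≤-trans (proj₂ (archimedean (upper-bound t-max))) (ι-mono (ℕ.n≤1+n _))))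

  -- Only `k`, and through it the threshold `N₂`, depends on ε; `Δ` and `D`, which fix the constant,
  -- come from the sequence of graphs alone.
  uniform : (ε : ℝ) → (ε>0 : 0ℝ < ε) → ε ≤ 1ℝ → ∃ λ (N : ℕ) → ∀ n → N ℕ.≤ n →
    coverTime (G n) ε ≤ᵘ fromℕ (constant Δ D 1≤D ℕ.* 5) * (fromℕ n * inv ε ε>0) * fromℕ (loglog n)
  uniform ε ε>0 ε≤1 =
    let (k , 1/ε≤K , K≤5/ε) = rational-bias ε ε>0 ε≤1
        (N₂ , controllers) = controller Δ D 1≤D k
    in N₁ ℕ.⊔ N₂ , λ n N≤n →
      let (t , relaxation-time , _ , t≤) = relaxation n (ℕ.m⊔n≤o⇒m≤o N₁ N₂ N≤n)
      in coverTime-bound {G = G n} {C = constant Δ D 1≤D} ε>0 1≤D k 1/ε≤K K≤5/ε (degree≤Δ n) relaxation-time (≤-trans t≤ t-max≤D)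
           (controllers n (ℕ.m⊔n≤o⇒n≤o N₁ N₂ N≤n) (G n))
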